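{- Let $m\ge 3$ be odd, $q=2^m$, $N=2q=2^{m+1}$. Let $K\subseteq \mathbb{Z}_4^q$ be a $\mathbb{Z}_4$-linear Kerdock code and $P=K^{\perp}$ the corresponding $\mathbb{Z}_4$-linear Preparata code (see context). Fix a coordinate position $i$. Let $K_{\rm short}\subseteq \mathbb{Z}_4^{q-1}$ be the code obtained from $K$ by shortening at $i$, let $C=P_{\rm punct}\subseteq \mathbb{Z}_4^{q-1}$ be the code obtained from $P$ by puncturing at $i$, and let $A=\mathbb{Z}_4^{q-1}$ (so $K_{\rm short}^{\perp}=C$ and $|K_{\rm short}|=|A/C|=4^m$). (i) Define relations on $K_{\rm short}$ by: $(x,y)\in R_0$ if $x-y$ has Lee weight $0$; $(x,y)\in R_1$ if $x-y$ has Lee weight $2^m+2^{(m-1)/2}$; $(x,y)\in R_2$ if $x-y$ has Lee weight $2^m-2^{(m-1)/2}$; $(x,y)\in R_3$ if $x-y$ has Lee weight $2^m$. Then $(K_{\rm short},\{R_0,R_1,R_2,R_3\})$ is a three-class (abelian) association scheme with first and second eigenmatrices $$P=\begin{pmatrix} 1 & \frac{(N-2\sqrt{N})(N-2)}{8} & \frac{(N+2\sqrt{N})(N-2)}{8} & \frac{N}{2}-1 \\ 1 & -\frac{\sqrt{N}(N-4)}{8} & \frac{\sqrt{N}(N-4)}{8} & -1 \\ 1 & \frac{\sqrt{N}}{2} & -\frac{\sqrt{N}}{2} & -1 \\ 1 & -\frac{N-2\sqrt{N}}{4} & -\frac{N+2\sqrt{N}}{4} & \frac{N}{2}-1 \end{pmatrix},\qquad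 Q=\begin{pmatrix} 1 & N-2 & \frac{(N-2)(N-4)}{4} & \frac{N}{2}-1 \\ 1 & -\sqrt{N}-2 & \sqrt{N}+2 & -1 \\ 1 & \sqrt{N}-2 & -\sqrt{N}+2 & -1 \\ 1 & -2 & -\frac{N}{2}+2 & \frac{N}{2}-1 \end{pmatrix}.$$ (ii) Let $e_j$ denote the $j$-th standard unit vector of $A$. Define relations on the set $A/C$ of cosets by: $(x,y)\in R'_0$ if $x-y= C$; $(x,y)\in R'_1$ if $x-y=\pm e_j+C$ for some $j$; $(x,y)\in R'_2$ if $x-y=e_j-e_k+C$ for some $j\neq k$; $(x,y)\in R'_3$ if $x-y=2e_j+C$ for some $j$. Then $(A/C,\{R'_0,\dots,R'_3\})$ is a three-class association scheme which is the dual of the scheme in (i) (with respect to the nondegenerate pairing $K_{\rm short}\times A/C\to\mathbb{Z}_4$, $(x,y+C)\mapsto x\cdot y$, identifying $A/C$ with the character group of $K_{\rm short}$), and its first and second eigenmatrices are $P'=Q$ and $Q'=P$.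
   Context: $\mathbb{Z}_4$-valued quadratic forms: let $V=\mathbb{F}_2^m$; for a binary symmetric $m\times m$ matrix $R$ (entries identified with $0,1\in\mathbb{Z}_4$) define $T_R:V\to\mathbb{Z}_4$ by $T_R(v)=\sum_i R_{ii}\hat v_i^2+2\sum_{i<j}R_{ij}\hat v_i\hat v_j$, where $\hat v\in\mathbb{Z}_4^m$ reduces to $v$ mod 2. A $\mathbb{Z}_4$-Kerdock code of length $q=2^m$ (coordinates indexed by $V$) is a code $\{(T_R(v)+2\hat s\cdot\hat v+\varepsilon)_{v\in V}: R\in S,\ s\in V,\ \varepsilon\in\mathbb{Z}_4\}$, where $S$ is a set of $2^m$ binary symmetric $m\times m$ matrices whose pairwise differences are nonsingular; it is called $\mathbb{Z}_4$-linear if it is an additive subgroup of $\mathbb{Z}_4^q$ (e.g. the Hammons–Kumar–Calderbank–Sloane–Solé quaternary Kerdock code built from the Galois ring $GR(4,m)$). The Preparata code is $P=K^\perp$ with respect to the standard dot product over $\mathbb{Z}_4$. Lee weight on $\mathbb{Z}_4$: $wt(0)=0$, $wt(\pm1)=1$, $wt(2)=2$, extended additively to vectors. Puncturing at $i$ deletes coordinate $i$ from all codewords; shortening at $i$ takes the codewords with $0$ at $i$ and deletes that coordinate. Eigenmatrix conventions: for a scheme with adjacency matrices $A_j$ and primitive idempotents $E_i$, $A_j=\sum_i P_{ij}E_i$ and $E_j=\frac{1}{|X|}\sum_i Q_{ij}A_i$. -}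

module Defs where

open import Data.Bool as B using (Bool; true; false; _∧_; _∨_; _xor_; if_then_else_; T)
open import Data.Nat as ℕ using (ℕ; zero; suc; _^_; _∸_; ⌊_/2⌋; _≡ᵇ_; _<ᵇ_)
open import Data.Nat.Properties using (suc-pred; m^n≢0)
open import Data.Fin as F using (Fin; toℕ)
open import Data.Vec as V using (Vec; []; _∷_; lookup; tabulate; zipWith; removeAt; insertAt)
open import Data.Vec.Properties using (≡-dec)
open import Data.List as L using (List; deduplicate)
import Data.Bool.ListAction as BL
open import Data.List.Membership.Propositional using (_∈_)
open import Data.Integer as Z using (ℤ)
open import Data.Rational as Q using (ℚ; 0ℚ; 1ℚ)
open import Data.Sum using (_⊎_; inj₁; inj₂)
open import Data.Product using (Σ; ∃; _×_; _,_)
open import Relation.Nullary using (¬_; yes; no)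
open import Relation.Nullary.Decidable using (T?)
open import Relation.Binary.PropositionalEquality using (_≡_; _≢_; refl)
open import Relation.Binary.Definitions using (DecidableEquality)

data ℤ₄ : Set where
  z0 z1 z2 z3 : ℤ₄

allℤ₄ : List ℤ₄
allℤ₄ = z0 L.∷ z1 L.∷ z2 L.∷ z3 L.∷ L.[]

suc₄ : ℤ₄ → ℤ₄
suc₄ z0 = z1
suc₄ z1 = z2
suc₄ z2 = z3
suc₄ z3 = z0

infixl 6 _⊕_
infixl 7 _⊗_

_⊕_ : ℤ₄ → ℤ₄ → ℤ₄
z0 ⊕ y = y
z1 ⊕ y = suc₄ y
z2 ⊕ y = suc₄ (suc₄ y)
z3 ⊕ y = suc₄ (suc₄ (suc₄ y))

neg₄ : ℤ₄ → ℤ₄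
neg₄ z0 = z0
neg₄ z1 = z3
neg₄ z2 = z2
neg₄ z3 = z1

_⊗_ : ℤ₄ → ℤ₄ → ℤ₄
z0 ⊗ y = z0
z1 ⊗ y = y
z2 ⊗ y = y ⊕ y
z3 ⊗ y = neg₄ y

_≟₄_ : DecidableEquality ℤ₄
z0 ≟₄ z0 = yes refl
z0 ≟₄ z1 = no λ ()
z0 ≟₄ z2 = no λ ()
z0 ≟₄ z3 = no λ ()
z1 ≟₄ z0 = no λ ()
z1 ≟₄ z1 = yes refl
z1 ≟₄ z2 = no λ ()
z1 ≟₄ z3 = no λ ()
z2 ≟₄ z0 = no λ ()
z2 ≟₄ z1 = no λ ()
z2 ≟₄ z2 = yes refl
z2 ≟₄ z3 = no λ ()
z3 ≟₄ z0 = no λ ()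
z3 ≟₄ z1 = no λ ()
z3 ≟₄ z2 = no λ ()
z3 ≟₄ z3 = yes refl

isZero₄ : ℤ₄ → Bool
isZero₄ z0 = true
isZero₄ _  = false

leeWt : ℤ₄ → ℕ
leeWt z0 = 0
leeWt z1 = 1
leeWt z2 = 2
leeWt z3 = 1

lift : Bool → ℤ₄
lift false = z0
lift true  = z1

Word : ℕ → Set
Word n = Vec ℤ₄ n

_≟w_ : ∀ {n} → DecidableEquality (Word n)
_≟w_ = ≡-dec _≟₄_

sum₄ : ∀ {k} → Vec ℤ₄ k → ℤ₄
sum₄ = V.foldr _ _⊕_ z0

_+w_ : ∀ {n} → Word n → Word n → Word n
_+w_ = zipWith _⊕_

-w_ : ∀ {n} → Word n → Word n
-w_ = V.map neg₄

_-w_ : ∀ {n} → Word n → Word n → Word n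
x -w y = x +w (-w y)

0w : ∀ {n} → Word n
0w = V.replicate _ z0

dot : ∀ {n} → Word n → Word n → ℤ₄
dot x y = sum₄ (zipWith _⊗_ x y)

leeWeight : ∀ {n} → Word n → ℕ
leeWeight w = V.foldr _ ℕ._+_ 0 (V.map leeWt w)

unit : ∀ {n} → Fin n → Word n
unit j = tabulate λ k → if toℕ j ≡ᵇ toℕ k then z1 else z0

_·w_ : ∀ {n} → ℤ₄ → Word n → Word n
a ·w w = V.map (a ⊗_) w

allWords : (n : ℕ) → List (Word n)
allWords zero    = [] L.∷ L.[]
allWords (suc n) = L.concatMap (λ a → L.map (a ∷_) (allWords n)) allℤ₄

Bits : ℕ → Set
Bits m = Vec Bool m

allBits : (m : ℕ) → List (Bits m)
allBits zero    = [] L.∷ L.[]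
allBits (suc m) = L.concatMap (λ b → L.map (b ∷_) (allBits m)) (false L.∷ true L.∷ L.[])

-- coordinate positions Fin (2^m) are identified with V = F₂^m by binary expansion
toBits : (m : ℕ) → Fin (2 ^ m) → Bits m
toBits zero    _ = []
toBits (suc m) c with F.splitAt (2 ^ m) c
... | inj₁ j = false ∷ toBits m j
... | inj₂ j with F.splitAt (2 ^ m) {0} j
...   | inj₁ j′ = true ∷ toBits m j′
...   | inj₂ ()

BinMat : ℕ → Set
BinMat m = Vec (Vec Bool m) m

entry : ∀ {m} → BinMat m → Fin m → Fin m → Bool
entry R i j = lookup (lookup R i) j

Symmetric : ∀ {m} → BinMat m → Set
Symmetric R = ∀ i j → entry R i j ≡ entry R j i

_+₂_ : ∀ {m} → BinMat m → BinMat m → BinMat m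
_+₂_ = zipWith (zipWith _xor_)

_·₂_ : ∀ {m} → BinMat m → Bits m → Bits m
R ·₂ v = V.map (λ row → V.foldr _ _xor_ false (zipWith _∧_ row v)) R

Nonsingular : ∀ {m} → BinMat m → Set
Nonsingular {m} R = ∀ v → R ·₂ v ≡ V.replicate m false → v ≡ V.replicate m false

T-form : ∀ {m} → BinMat m → Bits m → ℤ₄
T-form {m} R v =
  sum₄ (tabulate λ i → lift (entry R i i) ⊗ lift (lookup v i) ⊗ lift (lookup v i))
  ⊕ z2 ⊗ sum₄ (tabulate λ i → sum₄ (tabulate λ j →
        if toℕ i <ᵇ toℕ j then lift (entry R i j) ⊗ lift (lookup v i) ⊗ lift (lookup v j) else z0))

twoDot : ∀ {m} → Bits m → Bits m → ℤ₄
twoDot s v = z2 ⊗ sum₄ (zipWith (λ a b → lift a ⊗ lift b) s v)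

kerdockWord : ∀ {m} → BinMat m → Bits m → ℤ₄ → Word (2 ^ m)
kerdockWord {m} R s ε = tabulate λ c → T-form R (toBits m c) ⊕ twoDot s (toBits m c) ⊕ ε

record IsKerdockSet (m : ℕ) (S : List (BinMat m)) : Set where
  field
    size      : L.length S ≡ 2 ^ m
    symmetric : ∀ a → Symmetric (L.lookup S a)
    nonsing   : ∀ a b → a ≢ b → Nonsingular (L.lookup S a +₂ L.lookup S b)

kerdockCode : ∀ {m} → List (BinMat m) → List (Word (2 ^ m))
kerdockCode {m} S =
  L.concatMap (λ R → L.concatMap (λ s → L.map (kerdockWord R s) allℤ₄) (allBits m)) S

record IsZ4Linear {n} (K : List (Word n)) : Set where
  field
    has-zero   : 0w ∈ K
    closed-add : ∀ x y → x ∈ K → y ∈ K → (x +w y) ∈ K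
    closed-neg : ∀ x → x ∈ K → (-w x) ∈ K

Σℕ : ∀ {n} → (Fin n → ℕ) → ℕ
Σℕ {zero}  f = 0
Σℕ {suc n} f = f F.zero ℕ.+ Σℕ (λ i → f (F.suc i))

count : ∀ {n} → (Fin n → Bool) → ℕ
count p = Σℕ λ i → if p i then 1 else 0

Σℚ : ∀ {n} → (Fin n → ℚ) → ℚ
Σℚ {zero}  f = 0ℚ
Σℚ {suc n} f = f F.zero Q.+ Σℚ (λ i → f (F.suc i))

Σℤ : ∀ {n} → (Fin n → ℤ) → ℤ
Σℤ {zero}  f = Z.+ 0
Σℤ {suc n} f = f F.zero Z.+ Σℤ (λ i → f (F.suc i))

ιℚ : ℕ → ℚ
ιℚ n = Z.+ n Q./ 1

ιℤℚ : ℤ → ℚ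
ιℤℚ z = z Q./ 1

Rels : ℕ → ℕ → Set
Rels n d = Fin (suc d) → Fin n → Fin n → Bool

record IsAssocScheme {n d : ℕ} (R : Rels n d) : Set where
  field
    partition    : ∀ x y → count (λ j → R j x y) ≡ 1
    diagonal     : ∀ x y → R F.zero x y ≡ true → x ≡ y
    diagonal′    : ∀ x → R F.zero x x ≡ true
    symmetric    : ∀ j x y → R j x y ≡ R j y x
    nonempty     : ∀ j → Σ (Fin n) λ x → Σ (Fin n) λ y → R j x y ≡ true
    intersection : Σ (Fin (suc d) → Fin (suc d) → Fin (suc d) → ℕ) λ p →
                     ∀ i j k x y → R k x y ≡ true →
                       count (λ z → R i x z ∧ R j z y) ≡ p i j k

Mat : ℕ → Set
Mat n = Fin n → Fin n → ℚ

adjacency : ∀ {n d} → Rels n d → Fin (suc d) → Mat n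
adjacency R j x y = if R j x y then 1ℚ else 0ℚ

_⊙_ : ∀ {n} → Mat n → Mat n → Mat n
(M ⊙ N) x y = Σℚ λ z → M x z Q.* N z y

δ : ∀ {k} → Fin k → Fin k → ℚ
δ i k with i F.≟ k
... | yes _ = 1ℚ
... | no  _ = 0ℚ

-- P and Q are the first and second eigenmatrices of the scheme:
-- there are primitive idempotents E_0,…,E_d (of the Bose–Mesner algebra) with
-- A_j = Σ_i P_ij E_i and E_j = (1/|X|) Σ_i Q_ij A_i.
HasEigenmatrices : ∀ {n d} → Rels n d →
                   (Pm Qm : Fin (suc d) → Fin (suc d) → ℚ) → Set
HasEigenmatrices {n} {d} R Pm Qm =
  Σ (Fin (suc d) → Mat n) λ E →
    (∀ i k x y → (E i ⊙ E k) x y ≡ δ i k Q.* E i x y)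
    × (∀ x y → Σℚ (λ i → E i x y) ≡ δ x y)
    × (∀ j x y → adjacency R j x y ≡ Σℚ (λ i → Pm i j Q.* E i x y))
    × (∀ j x y → ιℚ n Q.* E j x y ≡ Σℚ (λ i → Qm i j Q.* adjacency R i x y))

Odd : ℕ → Set
Odd m = Σ ℕ λ k → m ≡ suc (k ℕ.+ k)

-- N = 2^(m+1), √N = 2^((m+1)/2) (m odd)
Nℚ : ℕ → ℚ
Nℚ m = ιℚ (2 ^ suc m)

sqrtNℚ : ℕ → ℚ
sqrtNℚ m = ιℚ (2 ^ suc ⌊ m /2⌋)

_÷_ : ℚ → (k : ℕ) → .{{_ : ℕ.NonZero k}} → ℚ
x ÷ k = x Q.* (Z.+ 1 Q./ k)

Pmat : ℕ → Fin 4 → Fin 4 → ℚ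
Pmat m i j = row i j
  where
  N s : ℚ
  N = Nℚ m
  s = sqrtNℚ m
  row : Fin 4 → Fin 4 → ℚ
  row F.zero F.zero = 1ℚ
  row F.zero (F.suc F.zero) = ((N Q.- ιℚ 2 Q.* s) Q.* (N Q.- ιℚ 2)) ÷ 8
  row F.zero (F.suc (F.suc F.zero)) = ((N Q.+ ιℚ 2 Q.* s) Q.* (N Q.- ιℚ 2)) ÷ 8
  row F.zero (F.suc (F.suc (F.suc F.zero))) = (N ÷ 2) Q.- 1ℚ
  row (F.suc F.zero) F.zero = 1ℚ
  row (F.suc F.zero) (F.suc F.zero) = Q.- ((s Q.* (N Q.- ιℚ 4)) ÷ 8)
  row (F.suc F.zero) (F.suc (F.suc F.zero)) = (s Q.* (N Q.- ιℚ 4)) ÷ 8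
  row (F.suc F.zero) (F.suc (F.suc (F.suc F.zero))) = Q.- 1ℚ
  row (F.suc (F.suc F.zero)) F.zero = 1ℚ
  row (F.suc (F.suc F.zero)) (F.suc F.zero) = s ÷ 2
  row (F.suc (F.suc F.zero)) (F.suc (F.suc F.zero)) = Q.- (s ÷ 2)
  row (F.suc (F.suc F.zero)) (F.suc (F.suc (F.suc F.zero))) = Q.- 1ℚ
  row (F.suc (F.suc (F.suc F.zero))) F.zero = 1ℚ
  row (F.suc (F.suc (F.suc F.zero))) (F.suc F.zero) = Q.- ((N Q.- ιℚ 2 Q.* s) ÷ 4)
  row (F.suc (F.suc (F.suc F.zero))) (F.suc (F.suc F.zero)) = Q.- ((N Q.+ ιℚ 2 Q.* s) ÷ 4)
  row (F.suc (F.suc (F.suc F.zero))) (F.suc (F.suc (F.suc F.zero))) = (N ÷ 2) Q.- 1ℚ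

Qmat : ℕ → Fin 4 → Fin 4 → ℚ
Qmat m i j = row i j
  where
  N s : ℚ
  N = Nℚ m
  s = sqrtNℚ m
  row : Fin 4 → Fin 4 → ℚ
  row F.zero F.zero = 1ℚ
  row F.zero (F.suc F.zero) = N Q.- ιℚ 2
  row F.zero (F.suc (F.suc F.zero)) = ((N Q.- ιℚ 2) Q.* (N Q.- ιℚ 4)) ÷ 4
  row F.zero (F.suc (F.suc (F.suc F.zero))) = (N ÷ 2) Q.- 1ℚ
  row (F.suc F.zero) F.zero = 1ℚ
  row (F.suc F.zero) (F.suc F.zero) = Q.- s Q.- ιℚ 2
  row (F.suc F.zero) (F.suc (F.suc F.zero)) = s Q.+ ιℚ 2
  row (F.suc F.zero) (F.suc (F.suc (F.suc F.zero))) = Q.- 1ℚ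
  row (F.suc (F.suc F.zero)) F.zero = 1ℚ
  row (F.suc (F.suc F.zero)) (F.suc F.zero) = s Q.- ιℚ 2
  row (F.suc (F.suc F.zero)) (F.suc (F.suc F.zero)) = Q.- s Q.+ ιℚ 2
  row (F.suc (F.suc F.zero)) (F.suc (F.suc (F.suc F.zero))) = Q.- 1ℚ
  row (F.suc (F.suc (F.suc F.zero))) F.zero = 1ℚ
  row (F.suc (F.suc (F.suc F.zero))) (F.suc F.zero) = Q.- ιℚ 2
  row (F.suc (F.suc (F.suc F.zero))) (F.suc (F.suc F.zero)) = Q.- (N ÷ 2) Q.+ ιℚ 2
  row (F.suc (F.suc (F.suc F.zero))) (F.suc (F.suc (F.suc F.zero))) = (N ÷ 2) Q.- 1ℚ

q₁ : ℕ → ℕ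
q₁ m = ℕ.pred (2 ^ m)

q≡ : ∀ m → 2 ^ m ≡ suc (q₁ m)
q≡ m with suc-pred (2 ^ m) {{m^n≢0 2 m}}
... | e = Relation.Binary.PropositionalEquality.sym e
  where import Relation.Binary.PropositionalEquality

module Setting (m : ℕ) (S : List (BinMat m)) (i : Fin (2 ^ m)) where

  n : ℕ
  n = q₁ m

  pos : Fin (suc n)
  pos = F.cast (q≡ m) i

  K : List (Word (suc n))
  K = L.map (V.cast (q≡ m)) (kerdockCode S)

  Kshort : List (Word n)
  Kshort = deduplicate _≟w_
             (L.map (λ w → removeAt w pos)
               (L.filter (λ w → lookup w pos ≟₄ z0) K))

  inP : Word (suc n) → Bool
  inP w = BL.all (λ k → isZero₄ (dot k w)) K

  inC : Word n → Bool
  inC y = BL.any (λ a → inP (insertAt y pos a)) allℤ₄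

  -- A/C: one representative for each coset of C in A = ℤ₄^(q-1)
  cosetReps : List (Word n)
  cosetReps = deduplicate (λ x y → T? (inC (x -w y))) (allWords n)

  nK nA : ℕ
  nK = L.length Kshort
  nA = L.length cosetReps

  elK : Fin nK → Word n
  elK = L.lookup Kshort

  elA : Fin nA → Word n
  elA = L.lookup cosetReps

  classK : Fin 4 → Word n → Bool
  classK F.zero w = leeWeight w ≡ᵇ 0
  classK (F.suc F.zero) w = leeWeight w ≡ᵇ (2 ^ m ℕ.+ 2 ^ ⌊ m /2⌋)
  classK (F.suc (F.suc F.zero)) w = leeWeight w ≡ᵇ (2 ^ m ∸ 2 ^ ⌊ m /2⌋)
  classK (F.suc (F.suc (F.suc F.zero))) w = leeWeight w ≡ᵇ 2 ^ m

  relK : Rels nK 3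
  relK j x y = classK j (elK x -w elK y)

  anyFin : ∀ {k} → (Fin k → Bool) → Bool
  anyFin f = BL.any f (L.allFin _)

  classA : Fin 4 → Word n → Bool
  classA F.zero d = inC d
  classA (F.suc F.zero) d = anyFin λ j → inC (d -w unit j) ∨ inC (d +w unit j)
  classA (F.suc (F.suc F.zero)) d =
    anyFin λ j → anyFin λ k → B.not (toℕ j ≡ᵇ toℕ k) ∧ inC (d -w (unit j -w unit k))
  classA (F.suc (F.suc (F.suc F.zero))) d = anyFin λ j → inC (d -w (z2 ·w unit j))

  relA : Rels nA 3
  relA j x y = classA j (elA x -w elA y)

  -- real and imaginary parts of i^a ∈ ℂ for a ∈ ℤ₄
  reI imI : ℤ₄ → ℤ
  reI z0 = Z.+ 1
  reI z1 = Z.+ 0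
  reI z2 = Z.- (Z.+ 1)
  reI z3 = Z.+ 0
  imI z0 = Z.+ 0
  imI z1 = Z.+ 1
  imI z2 = Z.+ 0
  imI z3 = Z.- (Z.+ 1)

  -- Σ_{x ∈ D_j} χ_y(x), D_j = {x ∈ K_short : (x,0) ∈ R_j}, χ_y(x) = i^{x·y}
  charSumRe charSumIm : Word n → Fin 4 → ℤ
  charSumRe y j = Σℤ λ x → if classK j (elK x) then reI (dot (elK x) y) else Z.+ 0
  charSumIm y j = Σℤ λ x → if classK j (elK x) then imI (dot (elK x) y) else Z.+ 0

  -- (A/C, R') is the dual of (K_short, R) w.r.t. the pairing (x, y + C) ↦ x·y:
  -- the class R'_i (relative to the zero coset) consists exactly of the characters
  -- χ with Σ_{x ∈ D_j} χ(x) = P_ij for all j.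
  IsDual : Set
  IsDual = ∀ (a : Fin nA) (r : Fin 4) →
             (classA r (elA a) ≡ true →
                ∀ j → (ιℤℚ (charSumRe (elA a) j) ≡ Pmat m r j) × (charSumIm (elA a) j ≡ Z.+ 0))
           × ((∀ j → (ιℤℚ (charSumRe (elA a) j) ≡ Pmat m r j) × (charSumIm (elA a) j ≡ Z.+ 0))
                → classA r (elA a) ≡ true)

{-# OPTIONS --safe #-}
module Submission where

-- Put q = 2^m and u = 2^((m-1)/2).  The difference of two Kerdock codewords is a ℤ₄-valued
-- quadratic function c on F₂^m whose polarization is 0 or nonsingular.  In the nonsingular
-- case the Gauss sum G = Σ i^c(v) has |G|² = q = 2u², and descent on a² + b² = 2u² gives
-- Re G = ± u, Im G = ± u; in particular c is not even-valued, so Σ (-1)^c(v) = 0.  Otherwise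
-- c is affine.  This determines all Lee weights, and also the character sums of x ∈ K_short
-- over the four sets {0}, {± e_j}, {e_j - e_k}, {2 e_j}: they form the row of Q belonging
-- to the class of x.
--
-- The rows of Q sum to q² δ, so Fourier inversion on K_short shows that the words in these
-- four sets represent every coset of C = K_short^⊥ equally often, namely q² / |K_short| = 1
-- times.  Hence R′ is a partition and E_j = H Δ_j Hᵀ / q², where H is the Hartley matrix of
-- the pairing K_short × A/C (real, with H Hᵀ = Hᵀ H = q² I) and Δ_j the indicator of R′_j.
-- The matrices E_j are orthogonal idempotents, and QP = q² I expresses the adjacency
-- matrices through them; transposing H and exchanging P and Q gives the dual scheme.

-- The definition of eigenmatrices asks for rational idempotents, whereas the characters of `Kshort`
-- take the values of i^a. The kernel `cas` = re + im has values 1 and -1 and satisfies cas a cas b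
-- = re (a - b) + im (a + b). Every list `W j` is closed under negation, so the imaginary term
-- always sums to zero, and a matrix with entries 1 and -1 does the work of the complex character
-- table on both sides of the duality. Neither the size nor the minimum distance of C is computed.
-- The transversal property comes from the row sums of Q together with the bound |K_short| ≥ q²,
-- which holds because a codeword vanishing at i may be prescribed by its pair (R, s). The number of
-- cosets is then read off from H. Intersection numbers are not evaluated either: expanding the
-- adjacency matrices in the idempotents shows that they depend on the class alone. The condition m
-- ≥ 3 enters as u ≥ 2, which keeps all valencies nonzero, so that no relation is empty.

open import Defs
open import Algebra.Properties.Group using (⁻¹-involutive)
open import Data.Bool as Bool using (Bool; true; false; _∧_; _∨_; _xor_; not; if_then_else_; T)
import Data.Bool.ListAction as BL
import Data.Bool.Properties as Boolₚ
open import Data.Fin as Fin using (Fin; zero; suc; toℕ; _↑ˡ_; _↑ʳ_)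
import Data.Fin.Properties as Finₚ
open import Data.Integer as ℤ using (ℤ; +_; -[1+_]; 0ℤ; 1ℤ; -1ℤ; _+_; _*_; -_; _-_; ∣_∣)
import Data.Integer.Properties as ℤₚ
open import Data.Integer.Solver using (module +-*-Solver)
open import Data.Integer.Tactic.RingSolver using (solve-∀)
open import Data.List as List using (List; []; _∷_; _++_; concatMap; allFin)
import Data.List.Properties as Listₚ
open import Data.List.Membership.Propositional using (_∈_; find)
import Data.List.Membership.Propositional.Properties as ∈ₚ
import Data.List.Relation.Unary.All as All
import Data.List.Relation.Unary.All.Properties as Allₚ
open import Data.List.Relation.Unary.AllPairs as AllPairs using (AllPairs)
open import Data.List.Relation.Unary.Any as Any using (here; there)
import Data.List.Relation.Unary.Any.Properties as Anyₚ
import Data.List.Relation.Unary.Unique.DecSetoid.Properties as Uniqueₚ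
open import Data.Nat as ℕ using (ℕ; zero; suc; _^_; _≤_; _∸_; _<ᵇ_; _≡ᵇ_; ⌊_/2⌋; z≤n; s≤s; NonZero)
import Data.Nat.DivMod as ℕ
import Data.Nat.Properties as ℕₚ
import Data.Nat.Tactic.RingSolver as ℕSolver
open import Data.Product using (∃; _×_; _,_; proj₁; proj₂)
open import Data.Rational as ℚ using (ℚ; 1ℚ; fromℚᵘ; toℚᵘ)
import Data.Rational.Properties as ℚₚ
import Data.Rational.Unnormalised as ℚᵘ
import Data.Rational.Unnormalised.Properties as ℚᵘₚ
open import Data.Sum using (_⊎_; inj₁; inj₂)
open import Data.Unit using (tt)
open import Data.Vec as Vec using (Vec; []; _∷_; lookup; tabulate; zipWith; insertAt; removeAt)
import Data.Vec.Properties as Vecₚ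
open import Function using (_∘_; id)
open import Relation.Binary.Bundles using (DecSetoid)
open import Relation.Binary.PropositionalEquality
open import Relation.Binary.PropositionalEquality.Properties using () renaming (decSetoid to ≡-decSetoid)
open import Relation.Nullary using (¬_; Dec; yes; no; does; contradiction)
open import Relation.Nullary.Decidable using (from-yes; map′; _×-dec_; _→-dec_; ¬?; T?)
open +-*-Solver using (Polynomial; var; con; _:+_; _:*_; _:-_; :-_; prove) renaming (⟦_⟧ to ⟦_⟧ₚ)

-- Arithmetic and characters of ℤ₄

infix 4 _≈?_
_≈?_ : (a b : ℤ₄) → Dec (a ≡ b)
_≈?_ = _≟₄_

-- Identities in a few variables over `ℤ₄` are settled below by running this exhaustive search under
-- `from-yes`.
all₄? : ∀ {p} {P : ℤ₄ → Set p} → (∀ a → Dec (P a)) → Dec (∀ a → P a)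
all₄? {P = P} P? = map′ to from (P? z0 ×-dec P? z1 ×-dec P? z2 ×-dec P? z3)
  where
  to : P z0 × P z1 × P z2 × P z3 → ∀ a → P a
  to (p0 , p1 , p2 , p3) z0 = p0
  to (p0 , p1 , p2 , p3) z1 = p1
  to (p0 , p1 , p2 , p3) z2 = p2
  to (p0 , p1 , p2 , p3) z3 = p3
  from : (∀ a → P a) → P z0 × P z1 × P z2 × P z3
  from f = f z0 , f z1 , f z2 , f z3

-- a ↦ i^a = re a + i im a; cas is the real-valued Hartley kernel replacing this character.
re im cas : ℤ₄ → ℤ
re z0 = 1ℤ
re z1 = 0ℤ
re z2 = -1ℤ
re z3 = 0ℤ
im z0 = 0ℤ
im z1 = 1ℤ
im z2 = 0ℤ
im z3 = -1ℤ
cas a = re a + im a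

⊕-comm : ∀ a b → a ⊕ b ≡ b ⊕ a
⊕-comm = from-yes (all₄? λ a → all₄? λ b → a ⊕ b ≈? b ⊕ a)

⊕-assoc : ∀ a b c → a ⊕ b ⊕ c ≡ a ⊕ (b ⊕ c)
⊕-assoc = from-yes (all₄? λ a → all₄? λ b → all₄? λ c → a ⊕ b ⊕ c ≈? a ⊕ (b ⊕ c))

⊕-identityʳ : ∀ a → a ⊕ z0 ≡ a
⊕-identityʳ = from-yes (all₄? λ a → a ⊕ z0 ≈? a)

⊕-inverseʳ : ∀ a → a ⊕ neg₄ a ≡ z0
⊕-inverseʳ = from-yes (all₄? λ a → a ⊕ neg₄ a ≈? z0)

⊕-interchange : ∀ a b c d → (a ⊕ b) ⊕ (c ⊕ d) ≡ (a ⊕ c) ⊕ (b ⊕ d)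
⊕-interchange = from-yes (all₄? λ a → all₄? λ b → all₄? λ c → all₄? λ d →
  (a ⊕ b) ⊕ (c ⊕ d) ≈? (a ⊕ c) ⊕ (b ⊕ d))

⊖≡0⇒≡ : ∀ a b → a ⊕ neg₄ b ≡ z0 → a ≡ b
⊖≡0⇒≡ = from-yes (all₄? λ a → all₄? λ b → (a ⊕ neg₄ b ≈? z0) →-dec (a ≈? b))

neg-⊕ : ∀ a b → neg₄ (a ⊕ b) ≡ neg₄ a ⊕ neg₄ b
neg-⊕ = from-yes (all₄? λ a → all₄? λ b → neg₄ (a ⊕ b) ≈? neg₄ a ⊕ neg₄ b)

⊗-comm : ∀ a b → a ⊗ b ≡ b ⊗ a
⊗-comm = from-yes (all₄? λ a → all₄? λ b → a ⊗ b ≈? b ⊗ a)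

⊗-zeroʳ : ∀ a → a ⊗ z0 ≡ z0
⊗-zeroʳ = from-yes (all₄? λ a → a ⊗ z0 ≈? z0)

⊗-distribˡ : ∀ a b c → a ⊗ (b ⊕ c) ≡ a ⊗ b ⊕ a ⊗ c
⊗-distribˡ = from-yes (all₄? λ a → all₄? λ b → all₄? λ c → a ⊗ (b ⊕ c) ≈? a ⊗ b ⊕ a ⊗ c)

⊗-distribʳ : ∀ c a b → (a ⊕ b) ⊗ c ≡ a ⊗ c ⊕ b ⊗ c
⊗-distribʳ = from-yes (all₄? λ c → all₄? λ a → all₄? λ b → (a ⊕ b) ⊗ c ≈? a ⊗ c ⊕ b ⊗ c)

neg-⊗ʳ : ∀ a b → a ⊗ neg₄ b ≡ neg₄ (a ⊗ b)
neg-⊗ʳ = from-yes (all₄? λ a → all₄? λ b → a ⊗ neg₄ b ≈? neg₄ (a ⊗ b))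

neg-⊗ˡ : ∀ a b → neg₄ a ⊗ b ≡ neg₄ (a ⊗ b)
neg-⊗ˡ = from-yes (all₄? λ a → all₄? λ b → neg₄ a ⊗ b ≈? neg₄ (a ⊗ b))

⊗-swap : ∀ a b c → a ⊗ (b ⊗ c) ≡ b ⊗ (a ⊗ c)
⊗-swap = from-yes (all₄? λ a → all₄? λ b → all₄? λ c → a ⊗ (b ⊗ c) ≈? b ⊗ (a ⊗ c))

re-⊖ : ∀ a b → re (a ⊕ neg₄ b) ≡ re a * re b + im a * im b
re-⊖ = from-yes (all₄? λ a → all₄? λ b → re (a ⊕ neg₄ b) ℤ.≟ re a * re b + im a * im b)

im-⊖ : ∀ a b → im (a ⊕ neg₄ b) ≡ im a * re b - re a * im b
im-⊖ = from-yes (all₄? λ a → all₄? λ b → im (a ⊕ neg₄ b) ℤ.≟ im a * re b - re a * im b)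

-- Addition formulas for cosine and sine at multiples of a right angle. The second summand is odd
-- under a simultaneous change of sign, so it cancels in sums over sets closed under negation.
cas-* : ∀ a b → cas a * cas b ≡ re (a ⊕ neg₄ b) + im (a ⊕ b)
cas-* = from-yes (all₄? λ a → all₄? λ b → cas a * cas b ℤ.≟ re (a ⊕ neg₄ b) + im (a ⊕ b))

cas-square : ∀ a → cas a * cas a ≡ 1ℤ
cas-square = from-yes (all₄? λ a → cas a * cas a ℤ.≟ 1ℤ)

⟦_⟧ : Bool → ℤ
⟦ true ⟧  = 1ℤ
⟦ false ⟧ = 0ℤ

⟦⟧-∧ : ∀ a b → ⟦ a ∧ b ⟧ ≡ ⟦ a ⟧ * ⟦ b ⟧
⟦⟧-∧ true  true  = refl
⟦⟧-∧ true  false = refl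
⟦⟧-∧ false b     = refl

⟦⟧-injective : ∀ {a b} → ⟦ a ⟧ ≡ ⟦ b ⟧ → a ≡ b
⟦⟧-injective {true}  {true}  _ = refl
⟦⟧-injective {false} {false} _ = refl

⟦⟧-nonNeg : ∀ b → 0ℤ ℤ.≤ ⟦ b ⟧
⟦⟧-nonNeg true  = ℤ.+≤+ ℕ.z≤n
⟦⟧-nonNeg false = ℤ.+≤+ ℕ.z≤n

-- Finite sums

private variable
  α β : Set

∑ : List α → (α → ℤ) → ℤ
∑ []       f = 0ℤ
∑ (x ∷ xs) f = f x + ∑ xs f

∑F : ∀ {n} → (Fin n → ℤ) → ℤ
∑F = ∑ (allFin _)

∑-cong-∈ : ∀ (xs : List α) {f g} → (∀ x → x ∈ xs → f x ≡ g x) → ∑ xs f ≡ ∑ xs g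
∑-cong-∈ []       e = refl
∑-cong-∈ (x ∷ xs) e = cong₂ _+_ (e x (here refl)) (∑-cong-∈ xs λ y y∈ → e y (there y∈))

∑-cong : ∀ (xs : List α) {f g} → (∀ x → f x ≡ g x) → ∑ xs f ≡ ∑ xs g
∑-cong xs e = ∑-cong-∈ xs λ x _ → e x

∑-0 : ∀ (xs : List α) → ∑ xs (λ _ → 0ℤ) ≡ 0ℤ
∑-0 []       = refl
∑-0 (x ∷ xs) = trans (ℤₚ.+-identityˡ _) (∑-0 xs)

∑-+ : ∀ (xs : List α) f g → ∑ xs (λ x → f x + g x) ≡ ∑ xs f + ∑ xs g
∑-+ []       f g = refl
∑-+ (x ∷ xs) f g = trans (cong (_+_ (f x + g x)) (∑-+ xs f g)) (lemma (f x) (g x) (∑ xs f) (∑ xs g))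
  where
  lemma : ∀ a b c d → (a + b) + (c + d) ≡ (a + c) + (b + d)
  lemma = solve-∀

∑-*ˡ : ∀ (xs : List α) c f → ∑ xs (λ x → c * f x) ≡ c * ∑ xs f
∑-*ˡ []       c f = sym (ℤₚ.*-zeroʳ c)
∑-*ˡ (x ∷ xs) c f = trans (cong (_+_ (c * f x)) (∑-*ˡ xs c f)) (sym (ℤₚ.*-distribˡ-+ c (f x) (∑ xs f)))

∑-*ʳ : ∀ (xs : List α) c f → ∑ xs (λ x → f x * c) ≡ ∑ xs f * c
∑-*ʳ xs c f = trans (∑-cong xs λ x → ℤₚ.*-comm (f x) c) (trans (∑-*ˡ xs c f) (ℤₚ.*-comm c _))

∑-neg : ∀ (xs : List α) f → ∑ xs (λ x → - f x) ≡ - ∑ xs f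
∑-neg []       f = refl
∑-neg (x ∷ xs) f = trans (cong (_+_ (- f x)) (∑-neg xs f)) (sym (ℤₚ.neg-distrib-+ (f x) (∑ xs f)))

∑-swap : ∀ (xs : List α) (ys : List β) (f : α → β → ℤ) →
         ∑ xs (λ x → ∑ ys (f x)) ≡ ∑ ys (λ y → ∑ xs (λ x → f x y))
∑-swap []       ys f = sym (∑-0 ys)
∑-swap (x ∷ xs) ys f =
  trans (cong (_+_ (∑ ys (f x))) (∑-swap xs ys f)) (sym (∑-+ ys (f x) _))

∑-++ : ∀ (xs ys : List α) f → ∑ (xs ++ ys) f ≡ ∑ xs f + ∑ ys f
∑-++ []       ys f = sym (ℤₚ.+-identityˡ _)
∑-++ (x ∷ xs) ys f = trans (cong (_+_ (f x)) (∑-++ xs ys f)) (sym (ℤₚ.+-assoc (f x) _ _))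

∑-map : ∀ (h : α → β) xs f → ∑ (List.map h xs) f ≡ ∑ xs (f ∘ h)
∑-map h []       f = refl
∑-map h (x ∷ xs) f = cong (_+_ (f (h x))) (∑-map h xs f)

∑-concatMap : ∀ (h : α → List β) xs f → ∑ (concatMap h xs) f ≡ ∑ xs (λ x → ∑ (h x) f)
∑-concatMap h []       f = refl
∑-concatMap h (x ∷ xs) f = trans (∑-++ (h x) _ f) (cong (_+_ (∑ (h x) f)) (∑-concatMap h xs f))

∑-1 : ∀ (xs : List α) → ∑ xs (λ _ → 1ℤ) ≡ + List.length xs
∑-1 []       = refl
∑-1 (x ∷ xs) = cong (_+_ 1ℤ) (∑-1 xs)

∑F-1 : ∀ n → ∑F {n} (λ _ → 1ℤ) ≡ + n
∑F-1 n = trans (∑-1 (allFin n)) (cong +_ (Listₚ.length-tabulate id))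

∑-nonNeg : ∀ (xs : List α) {f} → (∀ x → 0ℤ ℤ.≤ f x) → 0ℤ ℤ.≤ ∑ xs f
∑-nonNeg []       p = ℤₚ.≤-refl
∑-nonNeg (x ∷ xs) p = ℤₚ.+-mono-≤ (p x) (∑-nonNeg xs p)

∑-term≤ : ∀ {xs : List α} {f x} → (∀ x → 0ℤ ℤ.≤ f x) → x ∈ xs → f x ℤ.≤ ∑ xs f
∑-term≤ {xs = x ∷ xs} {f} p (here refl) =
  subst (ℤ._≤ f x + ∑ xs f) (ℤₚ.+-identityʳ (f x)) (ℤₚ.+-monoʳ-≤ (f x) (∑-nonNeg xs p))
∑-term≤ {xs = y ∷ xs} {f} {x} p (there x∈) =
  subst (ℤ._≤ f y + ∑ xs f) (ℤₚ.+-identityˡ (f x)) (ℤₚ.+-mono-≤ (p y) (∑-term≤ p x∈))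

∑≢0⇒∃ : ∀ (xs : List α) {f} → ∑ xs f ≢ 0ℤ → ∃ λ x → x ∈ xs × f x ≢ 0ℤ
∑≢0⇒∃ []           ne = contradiction refl ne
∑≢0⇒∃ (x ∷ xs) {f} ne with f x ℤ.≟ 0ℤ
... | no  fx≢0 = x , here refl , fx≢0
... | yes fx≡0 with ∑≢0⇒∃ xs {f} (λ e → ne (cong₂ _+_ fx≡0 e))
...   | y , y∈ , fy≢0 = y , there y∈ , fy≢0

∑F-suc : ∀ {n} (f : Fin (suc n) → ℤ) → ∑F f ≡ f zero + ∑F (f ∘ suc)
∑F-suc f = cong (_+_ (f zero)) (trans (cong (λ xs → ∑ xs f) (sym (Listₚ.map-tabulate id suc)))
                                      (∑-map suc (allFin _) f))

∑F≡Σℤ : ∀ {n} (f : Fin n → ℤ) → ∑F f ≡ Σℤ f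
∑F≡Σℤ {zero}  f = refl
∑F≡Σℤ {suc n} f = trans (∑F-suc f) (cong (_+_ (f zero)) (∑F≡Σℤ (f ∘ suc)))

∑F-lookup : ∀ (xs : List α) f → ∑F (f ∘ List.lookup xs) ≡ ∑ xs f
∑F-lookup []       f = refl
∑F-lookup (x ∷ xs) f = trans (∑F-suc (f ∘ List.lookup (x ∷ xs))) (cong (_+_ (f x)) (∑F-lookup xs f))

-- Stated for a predicate with a unique solution rather than for equality, since it also has to pick
-- out the representative of a coset and the zero word among the elements of type `zero`.
∑F-delta : ∀ {n} (p : Fin n → Bool) (f : Fin n → ℤ) a → p a ≡ true → (∀ b → p b ≡ true → b ≡ a) →
           ∑F (λ b → ⟦ p b ⟧ * f b) ≡ f a
∑F-delta {suc n} p f zero pa uniq = begin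
  ∑F (λ b → ⟦ p b ⟧ * f b)                              ≡⟨ ∑F-suc (λ b → ⟦ p b ⟧ * f b) ⟩
  ⟦ p zero ⟧ * f zero + ∑F (λ b → ⟦ p (suc b) ⟧ * f (suc b))
    ≡⟨ cong₂ _+_ (trans (cong (λ b → ⟦ b ⟧ * f zero) pa) (ℤₚ.*-identityˡ _))
         (trans (∑-cong (allFin n) λ b → vanish b) (∑-0 (allFin n))) ⟩
  f zero + 0ℤ                                           ≡⟨ ℤₚ.+-identityʳ _ ⟩
  f zero ∎
  where
  open ≡-Reasoning
  vanish : ∀ b → ⟦ p (suc b) ⟧ * f (suc b) ≡ 0ℤ
  vanish b with p (suc b) in eq
  ... | false = refl
  ... | true  = contradiction (uniq (suc b) eq) λ ()
∑F-delta {suc n} p f (suc a) pa uniq = begin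
  ∑F (λ b → ⟦ p b ⟧ * f b)                              ≡⟨ ∑F-suc (λ b → ⟦ p b ⟧ * f b) ⟩
  ⟦ p zero ⟧ * f zero + ∑F (λ b → ⟦ p (suc b) ⟧ * f (suc b))
    ≡⟨ cong₂ _+_ vanish
         (∑F-delta (p ∘ suc) (f ∘ suc) a pa λ b pb → Finₚ.suc-injective (uniq (suc b) pb)) ⟩
  0ℤ + f (suc a)                                        ≡⟨ ℤₚ.+-identityˡ _ ⟩
  f (suc a) ∎
  where
  open ≡-Reasoning
  vanish : ⟦ p zero ⟧ * f zero ≡ 0ℤ
  vanish with p zero in eq
  ... | false = refl
  ... | true  = contradiction (uniq zero eq) λ ()

infix 4 _==_
_==_ : ∀ {n} → Fin n → Fin n → Bool
a == b = does (a Fin.≟ b)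

==-refl : ∀ {n} (a : Fin n) → (a == a) ≡ true
==-refl a with a Fin.≟ a
... | yes _  = refl
... | no a≢a = contradiction refl a≢a

==⇒≡ : ∀ {n} {a b : Fin n} → (a == b) ≡ true → a ≡ b
==⇒≡ {a = a} {b} e with a Fin.≟ b
... | yes p = p

∑F-== : ∀ {n} (f : Fin n → ℤ) a → ∑F (λ b → ⟦ a == b ⟧ * f b) ≡ f a
∑F-== f a = ∑F-delta (a ==_) f a (==-refl a) λ b e → sym (==⇒≡ e)

-- ℤ₄-valued quadratic forms

allB? : ∀ {p} {P : Bool → Set p} → (∀ a → Dec (P a)) → Dec (∀ a → P a)
allB? {P = P} P? = map′ to (λ f → f true , f false) (P? true ×-dec P? false)
  where
  to : P true × P false → ∀ a → P a
  to (p , q) true  = p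
  to (p , q) false = q

s₄ : ∀ {n} → (Fin n → ℤ₄) → ℤ₄
s₄ f = sum₄ (tabulate f)

s₄-cong : ∀ {n} {f g : Fin n → ℤ₄} → (∀ i → f i ≡ g i) → s₄ f ≡ s₄ g
s₄-cong e = cong sum₄ (Vecₚ.tabulate-cong e)

s₄-⊕ : ∀ {n} (f g : Fin n → ℤ₄) → s₄ (λ i → f i ⊕ g i) ≡ s₄ f ⊕ s₄ g
s₄-⊕ {zero}  f g = refl
s₄-⊕ {suc n} f g = trans (cong (f zero ⊕ g zero ⊕_) (s₄-⊕ (f ∘ suc) (g ∘ suc)))
                         (⊕-interchange (f zero) (g zero) _ _)

s₄-⊗ : ∀ {n} a (f : Fin n → ℤ₄) → a ⊗ s₄ f ≡ s₄ (λ i → a ⊗ f i)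
s₄-⊗ {zero}  a f = ⊗-zeroʳ a
s₄-⊗ {suc n} a f = trans (⊗-distribˡ a (f zero) _) (cong (a ⊗ f zero ⊕_) (s₄-⊗ a (f ∘ suc)))

-- Brings a double sum into the shape of `T-form`: a diagonal part and a part over i < j.
s₄-triangle : ∀ {n} (f : Fin n → Fin n → ℤ₄) →
  s₄ (λ i → s₄ (f i)) ≡
  s₄ (λ i → f i i) ⊕ s₄ (λ i → s₄ λ j → if toℕ i <ᵇ toℕ j then f i j ⊕ f j i else z0)
s₄-triangle {zero}  f = refl
s₄-triangle {suc n} f = begin
  f00 ⊕ X ⊕ s₄ (λ i → f (suc i) zero ⊕ s₄ (f′ i))     ≡⟨ cong (f00 ⊕ X ⊕_) (s₄-⊕ (λ i → f (suc i) zero) _) ⟩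
  f00 ⊕ X ⊕ (Y ⊕ s₄ (λ i → s₄ (f′ i)))                ≡⟨ cong (λ z → f00 ⊕ X ⊕ (Y ⊕ z)) (s₄-triangle f′) ⟩
  f00 ⊕ X ⊕ (Y ⊕ (D ⊕ U))                             ≡⟨ rearrange f00 X Y D U ⟩
  (f00 ⊕ D) ⊕ ((X ⊕ Y) ⊕ U)
    ≡⟨ cong (λ z → (f00 ⊕ D) ⊕ (z ⊕ U)) (sym (s₄-⊕ (λ j → f zero (suc j)) (λ j → f (suc j) zero))) ⟩
  (f00 ⊕ D) ⊕ (s₄ (λ j → f zero (suc j) ⊕ f (suc j) zero) ⊕ U) ∎
  where
  open ≡-Reasoning
  f00 = f zero zero
  f′ : Fin n → Fin n → ℤ₄
  f′ i j = f (suc i) (suc j)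
  X = s₄ (λ j → f zero (suc j))
  Y = s₄ (λ i → f (suc i) zero)
  D = s₄ (λ i → f′ i i)
  U = s₄ (λ i → s₄ λ j → if toℕ i <ᵇ toℕ j then f′ i j ⊕ f′ j i else z0)
  rearrange : ∀ a b c d e → a ⊕ b ⊕ (c ⊕ (d ⊕ e)) ≡ (a ⊕ d) ⊕ ((b ⊕ c) ⊕ e)
  rearrange = from-yes (all₄? λ a → all₄? λ b → all₄? λ c → all₄? λ d → all₄? λ e →
    a ⊕ b ⊕ (c ⊕ (d ⊕ e)) ≈? (a ⊕ d) ⊕ ((b ⊕ c) ⊕ e))

-- Bit vectors and the doubled bilinear pairing

infixl 6 _⊞_
_⊞_ : ∀ {m} → Bits m → Bits m → Bits m
_⊞_ = zipWith _xor_

0b : ∀ {m} → Bits m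
0b = Vec.replicate _ false

⊞-comm : ∀ {m} (v w : Bits m) → v ⊞ w ≡ w ⊞ v
⊞-comm = Vecₚ.zipWith-comm Boolₚ.xor-comm

⊞-self : ∀ {m} (v : Bits m) → v ⊞ v ≡ 0b
⊞-self []      = refl
⊞-self (b ∷ v) = cong₂ _∷_ (Boolₚ.xor-same b) (⊞-self v)

⊞-identityʳ : ∀ {m} (v : Bits m) → v ⊞ 0b ≡ v
⊞-identityʳ []      = refl
⊞-identityʳ (b ∷ v) = cong₂ _∷_ (Boolₚ.xor-identityʳ b) (⊞-identityʳ v)

⊞-assoc : ∀ {m} (u v w : Bits m) → u ⊞ v ⊞ w ≡ u ⊞ (v ⊞ w)
⊞-assoc = Vecₚ.zipWith-assoc Boolₚ.xor-assoc

⊞-cancelˡ : ∀ {m} (v w : Bits m) → v ⊞ (v ⊞ w) ≡ w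
⊞-cancelˡ v w = trans (sym (⊞-assoc v v w))
  (trans (cong (_⊞ w) (⊞-self v)) (trans (⊞-comm 0b w) (⊞-identityʳ w)))

⊞≡0⇒≡ : ∀ {m} (v w : Bits m) → v ⊞ w ≡ 0b → v ≡ w
⊞≡0⇒≡ v w e = trans (sym (⊞-identityʳ v)) (trans (cong (v ⊞_) (sym e)) (⊞-cancelˡ v w))

bitDot : ∀ {m} → Bits m → Bits m → ℤ₄
bitDot s v = sum₄ (zipWith (λ a b → lift a ⊗ lift b) s v)

-- The lift of a xor b is a + b - 2ab, and the factor 2 kills the carry.
twoDot-⊞ˡ : ∀ {m} (s t v : Bits m) → twoDot (s ⊞ t) v ≡ twoDot s v ⊕ twoDot t v
twoDot-⊞ˡ []      []      []      = refl
twoDot-⊞ˡ (a ∷ s) (b ∷ t) (c ∷ v) = begin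
  z2 ⊗ (lift (a xor b) ⊗ lift c ⊕ bitDot (s ⊞ t) v)     ≡⟨ ⊗-distribˡ z2 (lift (a xor b) ⊗ lift c) _ ⟩
  z2 ⊗ (lift (a xor b) ⊗ lift c) ⊕ twoDot (s ⊞ t) v
    ≡⟨ cong₂ _⊕_ (bit a b c) (twoDot-⊞ˡ s t v) ⟩
  (z2 ⊗ (lift a ⊗ lift c) ⊕ z2 ⊗ (lift b ⊗ lift c)) ⊕ (twoDot s v ⊕ twoDot t v)
    ≡⟨ ⊕-interchange (z2 ⊗ (lift a ⊗ lift c)) _ _ _ ⟩
  (z2 ⊗ (lift a ⊗ lift c) ⊕ twoDot s v) ⊕ (z2 ⊗ (lift b ⊗ lift c) ⊕ twoDot t v)
    ≡⟨ cong₂ _⊕_ (sym (⊗-distribˡ z2 (lift a ⊗ lift c) _)) (sym (⊗-distribˡ z2 (lift b ⊗ lift c) _)) ⟩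
  twoDot (a ∷ s) (c ∷ v) ⊕ twoDot (b ∷ t) (c ∷ v) ∎
  where
  open ≡-Reasoning
  bit : ∀ a b c → z2 ⊗ (lift (a xor b) ⊗ lift c) ≡ z2 ⊗ (lift a ⊗ lift c) ⊕ z2 ⊗ (lift b ⊗ lift c)
  bit = from-yes (allB? λ a → allB? λ b → allB? λ c →
    z2 ⊗ (lift (a xor b) ⊗ lift c) ≈? z2 ⊗ (lift a ⊗ lift c) ⊕ z2 ⊗ (lift b ⊗ lift c))

twoDot-comm : ∀ {m} (s v : Bits m) → twoDot s v ≡ twoDot v s
twoDot-comm s v = cong (λ x → z2 ⊗ sum₄ x) (Vecₚ.zipWith-comm (λ a b → ⊗-comm (lift a) (lift b)) s v)

twoDot-⊞ʳ : ∀ {m} (s v w : Bits m) → twoDot s (v ⊞ w) ≡ twoDot s v ⊕ twoDot s w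
twoDot-⊞ʳ s v w = trans (twoDot-comm s (v ⊞ w))
  (trans (twoDot-⊞ˡ v w s) (cong₂ _⊕_ (twoDot-comm v s) (twoDot-comm w s)))

twoDot-zeroˡ : ∀ {m} (v : Bits m) → twoDot 0b v ≡ z0
twoDot-zeroˡ []      = refl
twoDot-zeroˡ (b ∷ v) = twoDot-zeroˡ v

twoDot-s₄ : ∀ {m} (s v : Bits m) →
            twoDot s v ≡ s₄ (λ i → z2 ⊗ (lift (lookup s i) ⊗ lift (lookup v i)))
twoDot-s₄ []      []      = refl
twoDot-s₄ (a ∷ s) (b ∷ v) = trans (⊗-distribˡ z2 (lift a ⊗ lift b) _) (cong (z2 ⊗ (lift a ⊗ lift b) ⊕_) (twoDot-s₄ s v))

-- Again the doubling makes the xor of a row product agree with its sum in `ℤ₄`.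
row-s₄ : ∀ {m} (r w : Bits m) b →
  z2 ⊗ (lift (Vec.foldr _ _xor_ false (zipWith _∧_ r w)) ⊗ lift b) ≡
  s₄ (λ j → z2 ⊗ (lift (lookup r j) ⊗ (lift (lookup w j) ⊗ lift b)))
row-s₄ []      []      b = refl
row-s₄ (x ∷ r) (y ∷ w) b = trans (bit x y _ b) (cong (z2 ⊗ (lift x ⊗ (lift y ⊗ lift b)) ⊕_) (row-s₄ r w b))
  where
  bit : ∀ x y z b → z2 ⊗ (lift ((x ∧ y) xor z) ⊗ lift b) ≡ z2 ⊗ (lift x ⊗ (lift y ⊗ lift b)) ⊕ z2 ⊗ (lift z ⊗ lift b)
  bit = from-yes (allB? λ x → allB? λ y → allB? λ z → allB? λ b →
    z2 ⊗ (lift ((x ∧ y) xor z) ⊗ lift b) ≈? z2 ⊗ (lift x ⊗ (lift y ⊗ lift b)) ⊕ z2 ⊗ (lift z ⊗ lift b))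

module _ {m} (R : BinMat m) (R-sym : Symmetric R) where

  private
    polar : Bits m → Bits m → Fin m → Fin m → ℤ₄
    polar v w i j = z2 ⊗ (lift (entry R i j) ⊗ (lift (lookup w j) ⊗ lift (lookup v i)))

    twoDot-·₂ : ∀ v w → twoDot (R ·₂ w) v ≡ s₄ (λ i → s₄ (polar v w i))
    twoDot-·₂ v w = trans (twoDot-s₄ (R ·₂ w) v) (s₄-cong λ i →
      trans (cong (λ b → z2 ⊗ (lift b ⊗ lift (lookup v i))) (Vecₚ.lookup-map i _ R))
            (row-s₄ (lookup R i) w (lookup v i)))

    diag : Bits m → Fin m → ℤ₄
    diag v i = lift (entry R i i) ⊗ lift (lookup v i) ⊗ lift (lookup v i)

    off : Bits m → Fin m → Fin m → ℤ₄
    off v i j = if toℕ i <ᵇ toℕ j then lift (entry R i j) ⊗ lift (lookup v i) ⊗ lift (lookup v j) else z0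

    -- Reducing x + y modulo 2 changes it by an even number, so its square is unchanged modulo 4;
    -- the cross term 2xy is the diagonal of the polar form.
    diag-polar : ∀ v w i → diag (v ⊞ w) i ≡ diag v i ⊕ diag w i ⊕ polar v w i i
    diag-polar v w i = trans
      (cong (λ b → lift (entry R i i) ⊗ lift b ⊗ lift b) (Vecₚ.lookup-zipWith _xor_ i v w))
      (bit (entry R i i) (lookup v i) (lookup w i))
      where
      bit : ∀ r x y → lift r ⊗ lift (x xor y) ⊗ lift (x xor y) ≡
            lift r ⊗ lift x ⊗ lift x ⊕ lift r ⊗ lift y ⊗ lift y ⊕ z2 ⊗ (lift r ⊗ (lift y ⊗ lift x))
      bit = from-yes (allB? λ r → allB? λ x → allB? λ y →
        lift r ⊗ lift (x xor y) ⊗ lift (x xor y) ≈?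
        lift r ⊗ lift x ⊗ lift x ⊕ lift r ⊗ lift y ⊗ lift y ⊕ z2 ⊗ (lift r ⊗ (lift y ⊗ lift x)))

    -- With the factor 2 in front only parities matter, so the product expands bilinearly; symmetry
    -- of R distributes the two cross terms over (i, j) and (j, i).
    off-polar : ∀ v w i j → z2 ⊗ off (v ⊞ w) i j ≡
      z2 ⊗ off v i j ⊕ z2 ⊗ off w i j ⊕ (if toℕ i <ᵇ toℕ j then polar v w i j ⊕ polar v w j i else z0)
    off-polar v w i j
      rewrite Vecₚ.lookup-zipWith _xor_ i v w | Vecₚ.lookup-zipWith _xor_ j v w | R-sym j i =
      bit (toℕ i <ᵇ toℕ j) (entry R i j) (lookup v i) (lookup v j) (lookup w i) (lookup w j)
      where
      bit : ∀ p r x x′ y y′ → z2 ⊗ (if p then lift r ⊗ lift (x xor y) ⊗ lift (x′ xor y′) else z0) ≡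
        z2 ⊗ (if p then lift r ⊗ lift x ⊗ lift x′ else z0) ⊕ z2 ⊗ (if p then lift r ⊗ lift y ⊗ lift y′ else z0)
        ⊕ (if p then z2 ⊗ (lift r ⊗ (lift y′ ⊗ lift x)) ⊕ z2 ⊗ (lift r ⊗ (lift y ⊗ lift x′)) else z0)
      bit = from-yes (allB? λ p → allB? λ r → allB? λ x → allB? λ x′ → allB? λ y → allB? λ y′ →
        z2 ⊗ (if p then lift r ⊗ lift (x xor y) ⊗ lift (x′ xor y′) else z0) ≈?
        z2 ⊗ (if p then lift r ⊗ lift x ⊗ lift x′ else z0) ⊕ z2 ⊗ (if p then lift r ⊗ lift y ⊗ lift y′ else z0)
        ⊕ (if p then z2 ⊗ (lift r ⊗ (lift y′ ⊗ lift x)) ⊕ z2 ⊗ (lift r ⊗ (lift y ⊗ lift x′)) else z0))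

    s₄-⊕³ : ∀ {n} (f g h : Fin n → ℤ₄) → s₄ (λ i → f i ⊕ g i ⊕ h i) ≡ s₄ f ⊕ s₄ g ⊕ s₄ h
    s₄-⊕³ f g h = trans (s₄-⊕ (λ i → f i ⊕ g i) h) (cong (_⊕ s₄ h) (s₄-⊕ f g))

    z2-s₄² : (f : Fin m → Fin m → ℤ₄) → z2 ⊗ s₄ (λ i → s₄ (f i)) ≡ s₄ (λ i → s₄ λ j → z2 ⊗ f i j)
    z2-s₄² f = trans (s₄-⊗ z2 (λ i → s₄ (f i))) (s₄-cong λ i → s₄-⊗ z2 (f i))

  -- The polar form of T_R is twice the bilinear form of R: the diagonal and the off-diagonal cross
  -- terms recombine by `s₄-triangle`.
  T-form-⊞ : ∀ v w → T-form R (v ⊞ w) ≡ T-form R v ⊕ T-form R w ⊕ twoDot (R ·₂ w) v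
  T-form-⊞ v w = begin
    s₄ (diag (v ⊞ w)) ⊕ z2 ⊗ s₄ (λ i → s₄ (off (v ⊞ w) i))
      ≡⟨ cong₂ _⊕_ (trans (s₄-cong (diag-polar v w)) (s₄-⊕³ (diag v) (diag w) (λ i → polar v w i i)))
                   (trans (z2-s₄² (off (v ⊞ w))) (trans (s₄-cong λ i → trans (s₄-cong (off-polar v w i))
                     (s₄-⊕³ (λ j → z2 ⊗ off v i j) (λ j → z2 ⊗ off w i j) (upper i)))
                     (s₄-⊕³ (λ i → s₄ λ j → z2 ⊗ off v i j) (λ i → s₄ λ j → z2 ⊗ off w i j) (λ i → s₄ (upper i))))) ⟩
    (s₄ (diag v) ⊕ s₄ (diag w) ⊕ D) ⊕ (s₄ (λ i → s₄ λ j → z2 ⊗ off v i j) ⊕ s₄ (λ i → s₄ λ j → z2 ⊗ off w i j) ⊕ U)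
      ≡⟨ cong₂ (λ a b → (s₄ (diag v) ⊕ s₄ (diag w) ⊕ D) ⊕ (a ⊕ b ⊕ U)) (sym (z2-s₄² (off v))) (sym (z2-s₄² (off w))) ⟩
    (s₄ (diag v) ⊕ s₄ (diag w) ⊕ D) ⊕ (O v ⊕ O w ⊕ U)
      ≡⟨ rearrange (s₄ (diag v)) (s₄ (diag w)) D (O v) (O w) U ⟩
    T-form R v ⊕ T-form R w ⊕ (D ⊕ U)
      ≡⟨ cong (T-form R v ⊕ T-form R w ⊕_) (sym (trans (twoDot-·₂ v w) (s₄-triangle (polar v w)))) ⟩
    T-form R v ⊕ T-form R w ⊕ twoDot (R ·₂ w) v ∎
    where
    open ≡-Reasoning
    upper : Fin m → Fin m → ℤ₄
    upper i j = if toℕ i <ᵇ toℕ j then polar v w i j ⊕ polar v w j i else z0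
    D U : ℤ₄
    D = s₄ (λ i → polar v w i i)
    U = s₄ (λ i → s₄ (upper i))
    O : Bits m → ℤ₄
    O x = z2 ⊗ s₄ (λ i → s₄ (off x i))
    rearrange : ∀ a b c d e f → (a ⊕ b ⊕ c) ⊕ (d ⊕ e ⊕ f) ≡ (a ⊕ d) ⊕ (b ⊕ e) ⊕ (c ⊕ f)
    rearrange a b c d e f = trans (⊕-interchange (a ⊕ b) c (d ⊕ e) f) (cong (_⊕ (c ⊕ f)) (⊕-interchange a b d e))

-- Sums over F₂^m

∑B : ∀ {m} → (Bits m → ℤ) → ℤ
∑B {m} = ∑ (allBits m)

∑B-suc : ∀ {m} (f : Bits (suc m) → ℤ) → ∑B f ≡ ∑B (f ∘ (false ∷_)) + ∑B (f ∘ (true ∷_))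
∑B-suc {m} f = begin
  ∑ (concatMap (λ b → List.map (b ∷_) (allBits m)) (false ∷ true ∷ [])) f
    ≡⟨ ∑-concatMap (λ b → List.map (b ∷_) (allBits m)) (false ∷ true ∷ []) f ⟩
  ∑ (List.map (false ∷_) (allBits m)) f + (∑ (List.map (true ∷_) (allBits m)) f + 0ℤ)
    ≡⟨ cong₂ _+_ (∑-map (false ∷_) (allBits m) f)
                 (trans (ℤₚ.+-identityʳ _) (∑-map (true ∷_) (allBits m) f)) ⟩
  ∑B (f ∘ (false ∷_)) + ∑B (f ∘ (true ∷_)) ∎
  where open ≡-Reasoning

∑F-↑ : ∀ a b (f : Fin (a ℕ.+ b) → ℤ) → ∑F f ≡ ∑F (λ i → f (i ↑ˡ b)) + ∑F (λ j → f (a ↑ʳ j))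
∑F-↑ zero    b f = sym (ℤₚ.+-identityˡ _)
∑F-↑ (suc a) b f = begin
  ∑F f                        ≡⟨ ∑F-suc f ⟩
  f zero + ∑F (f ∘ suc)       ≡⟨ cong (_+_ (f zero)) (∑F-↑ a b (f ∘ suc)) ⟩
  f zero + (X + Y)            ≡⟨ sym (ℤₚ.+-assoc (f zero) X Y) ⟩
  f zero + X + Y              ≡⟨ cong (_+ Y) (sym (∑F-suc (λ i → f (i ↑ˡ b)))) ⟩
  ∑F (λ i → f (i ↑ˡ b)) + Y   ∎
  where
  open ≡-Reasoning
  X = ∑F (λ i → f (suc (i ↑ˡ b)))
  Y = ∑F (λ j → f (suc (a ↑ʳ j)))

-- `2 ^ suc m` unfolds to `2 ^ m + (2 ^ m + 0)`; the empty last block accounts for the extra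
-- injections here and in `toBits-true`.
toBits-false : ∀ m j → toBits (suc m) (j ↑ˡ (2 ^ m ℕ.+ 0)) ≡ false ∷ toBits m j
toBits-false m j rewrite Finₚ.splitAt-↑ˡ (2 ^ m) j (2 ^ m ℕ.+ 0) = refl

toBits-true : ∀ m j → toBits (suc m) (2 ^ m ↑ʳ (j ↑ˡ 0)) ≡ true ∷ toBits m j
toBits-true m j rewrite Finₚ.splitAt-↑ʳ (2 ^ m) (2 ^ m ℕ.+ 0) (j ↑ˡ 0) | Finₚ.splitAt-↑ˡ (2 ^ m) j 0 = refl

∑F-toBits : ∀ m (f : Bits m → ℤ) → ∑F (f ∘ toBits m) ≡ ∑B f
∑F-toBits zero    f = refl
∑F-toBits (suc m) f = begin
  ∑F (f ∘ toBits (suc m))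
    ≡⟨ ∑F-↑ (2 ^ m) (2 ^ m ℕ.+ 0) (f ∘ toBits (suc m)) ⟩
  ∑F {2 ^ m} (λ i → f (toBits (suc m) (i ↑ˡ (2 ^ m ℕ.+ 0)))) + ∑F (λ j → f (toBits (suc m) (2 ^ m ↑ʳ j)))
    ≡⟨ cong₂ _+_ (∑-cong (allFin (2 ^ m)) λ i → cong f (toBits-false m i))
                 (∑F-↑ (2 ^ m) 0 (λ j → f (toBits (suc m) (2 ^ m ↑ʳ j)))) ⟩
  ∑F (λ i → f (false ∷ toBits m i)) + (∑F (λ j → f (toBits (suc m) (2 ^ m ↑ʳ (j ↑ˡ 0)))) + 0ℤ)
    ≡⟨ cong₂ _+_ (∑F-toBits m (f ∘ (false ∷_)))
         (trans (ℤₚ.+-identityʳ _) (trans (∑-cong (allFin (2 ^ m)) λ j → cong f (toBits-true m j))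
           (∑F-toBits m (f ∘ (true ∷_))))) ⟩
  ∑B (f ∘ (false ∷_)) + ∑B (f ∘ (true ∷_))
    ≡⟨ sym (∑B-suc f) ⟩
  ∑B f ∎
  where open ≡-Reasoning

toBits-injective : ∀ m {a b} → toBits m a ≡ toBits m b → a ≡ b
toBits-injective zero    {zero} {zero} _ = refl
toBits-injective (suc m) {a} {b} e
  with Fin.splitAt (2 ^ m) a in ea | Fin.splitAt (2 ^ m) b in eb
... | inj₁ x | inj₁ y = trans (sym (Finₚ.splitAt⁻¹-↑ˡ ea))
  (trans (cong (_↑ˡ (2 ^ m ℕ.+ 0)) (toBits-injective m (Vecₚ.∷-injectiveʳ e))) (Finₚ.splitAt⁻¹-↑ˡ eb))
... | inj₁ x | inj₂ y with Fin.splitAt (2 ^ m) {0} y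
...   | inj₁ y′ = contradiction (Vecₚ.∷-injectiveˡ e) λ ()
...   | inj₂ ()
toBits-injective (suc m) {a} {b} e | inj₂ x | inj₁ y with Fin.splitAt (2 ^ m) {0} x
...   | inj₁ x′ = contradiction (Vecₚ.∷-injectiveˡ e) λ ()
...   | inj₂ ()
toBits-injective (suc m) {a} {b} e | inj₂ x | inj₂ y
  with Fin.splitAt (2 ^ m) {0} x in ex | Fin.splitAt (2 ^ m) {0} y in ey
... | inj₁ x′ | inj₁ y′ = trans (sym (Finₚ.splitAt⁻¹-↑ʳ ea)) (trans (cong (2 ^ m ↑ʳ_) x≡y) (Finₚ.splitAt⁻¹-↑ʳ eb))
  where
  x≡y : x ≡ y
  x≡y = trans (sym (Finₚ.splitAt⁻¹-↑ˡ ex))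
    (trans (cong (_↑ˡ 0) (toBits-injective m (Vecₚ.∷-injectiveʳ e))) (Finₚ.splitAt⁻¹-↑ˡ ey))
... | inj₂ () | _
... | inj₁ _ | inj₂ ()

-- A set bit of `w` merely exchanges the two halves of the sum.
∑B-⊞ : ∀ {m} (f : Bits m → ℤ) w → ∑B (λ v → f (v ⊞ w)) ≡ ∑B f
∑B-⊞ f []          = refl
∑B-⊞ f (false ∷ w) = trans (∑B-suc (λ v → f (v ⊞ (false ∷ w))))
  (trans (cong₂ _+_ (∑B-⊞ (f ∘ (false ∷_)) w) (∑B-⊞ (f ∘ (true ∷_)) w)) (sym (∑B-suc f)))
∑B-⊞ f (true ∷ w)  = trans (∑B-suc (λ v → f (v ⊞ (true ∷ w))))
  (trans (cong₂ _+_ (∑B-⊞ (f ∘ (true ∷_)) w) (∑B-⊞ (f ∘ (false ∷_)) w))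
  (trans (ℤₚ.+-comm (∑B (f ∘ (true ∷_))) _) (sym (∑B-suc f))))

∑B-delta : ∀ {m} (f : Bits m → ℤ) → (∀ v → v ≢ 0b → f v ≡ 0ℤ) → ∑B f ≡ f 0b
∑B-delta {zero}  f e = ℤₚ.+-identityʳ _
∑B-delta {suc m} f e = trans (∑B-suc f) (trans
  (cong₂ _+_ (∑B-delta (f ∘ (false ∷_)) λ v ne → e (false ∷ v) (ne ∘ Vecₚ.∷-injectiveʳ))
             (trans (∑-cong (allBits m) λ v → e (true ∷ v) (λ ())) (∑-0 (allBits m))))
  (ℤₚ.+-identityʳ _))

∑B-1 : ∀ m → ∑B {m} (λ _ → 1ℤ) ≡ + 2 ^ m
∑B-1 m = trans (sym (∑F-toBits m (λ _ → 1ℤ))) (∑F-1 (2 ^ m))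

re-z2-⊕ : ∀ a x → re (a ⊕ z2 ⊗ x) ≡ re a * re (z2 ⊗ x)
re-z2-⊕ = from-yes (all₄? λ a → all₄? λ x → re (a ⊕ z2 ⊗ x) ℤ.≟ re a * re (z2 ⊗ x))

-- Orthogonality of a nontrivial character: at the first set bit of `s` the two halves of the sum
-- cancel.
∑B-twoDot : ∀ {m} (s : Bits m) → s ≢ 0b → ∑B (λ v → re (twoDot s v)) ≡ 0ℤ
∑B-twoDot []          ne = contradiction refl ne
∑B-twoDot (false ∷ s) ne = trans (∑B-suc (λ v → re (twoDot (false ∷ s) v)))
  (cong₂ _+_ (∑B-twoDot s (ne ∘ cong (false ∷_))) (∑B-twoDot s (ne ∘ cong (false ∷_))))
∑B-twoDot (true ∷ s)  ne = begin
  ∑B (λ v → re (twoDot (true ∷ s) v))                     ≡⟨ ∑B-suc (λ v → re (twoDot (true ∷ s) v)) ⟩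
  X + ∑B (λ v → re (z2 ⊗ (z1 ⊕ bitDot s v)))                     ≡⟨ cong (_+_ X) (∑-cong (allBits _) λ v → flip (bitDot s v)) ⟩
  X + ∑B (λ v → - re (twoDot s v))                        ≡⟨ cong (_+_ X) (∑-neg (allBits _) (λ v → re (twoDot s v))) ⟩
  X + - X                                                 ≡⟨ ℤₚ.+-inverseʳ X ⟩
  0ℤ ∎
  where
  open ≡-Reasoning
  X = ∑B (λ v → re (twoDot s v))
  flip : ∀ x → re (z2 ⊗ (z1 ⊕ x)) ≡ - re (z2 ⊗ x)
  flip = from-yes (all₄? λ x → re (z2 ⊗ (z1 ⊕ x)) ℤ.≟ - re (z2 ⊗ x))

∑-* : ∀ {A B : Set} (xs : List A) (ys : List B) f g → ∑ xs f * ∑ ys g ≡ ∑ xs (λ x → ∑ ys (λ y → f x * g y))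
∑-* xs ys f g = trans (sym (∑-*ʳ xs (∑ ys g) f)) (∑-cong xs λ x → sym (∑-*ˡ ys (f x) g))

-- The real part of the product of Σ i^c with its conjugate, written out. It serves both for Gauss
-- sums over F₂^m and for the differences e_j - e_k.
∑-norm : ∀ {A : Set} (xs : List A) (c : A → ℤ₄) →
  ∑ xs (λ x → ∑ xs (λ y → re (c x ⊕ neg₄ (c y)))) ≡
  ∑ xs (re ∘ c) * ∑ xs (re ∘ c) + ∑ xs (im ∘ c) * ∑ xs (im ∘ c)
∑-norm xs c = trans
  (∑-cong xs λ x → trans (∑-cong xs λ y → re-⊖ (c x) (c y))
    (∑-+ xs (λ y → re (c x) * re (c y)) (λ y → im (c x) * im (c y))))
  (trans (∑-+ xs _ _) (sym (cong₂ _+_ (∑-* xs xs (re ∘ c) (re ∘ c)) (∑-* xs xs (im ∘ c) (im ∘ c)))))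

x≡-x⇒x≡0 : ∀ x → x ≡ - x → x ≡ 0ℤ
x≡-x⇒x≡0 (+ zero)  _ = refl
x≡-x⇒x≡0 (+ suc n) ()
x≡-x⇒x≡0 -[1+ n ]  ()

-- Gauss sums

module GaussSum {m} (c κ : Bits m → ℤ₄) (M : BinMat m)
  (polar : ∀ v w → c (v ⊞ w) ≡ c v ⊕ (κ w ⊕ twoDot (M ·₂ w) v)) (κ-0 : κ 0b ≡ z0) where

  -- Squaring the sum and substituting u = w + v leaves, for each w, a character sum over v with
  -- parameter M w. It vanishes unless M w = 0, that is w = 0, and the remaining term is 2^m.
  norm : Nonsingular M → ∑B (re ∘ c) * ∑B (re ∘ c) + ∑B (im ∘ c) * ∑B (im ∘ c) ≡ + 2 ^ m
  norm ns = begin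
    ∑B (re ∘ c) * ∑B (re ∘ c) + ∑B (im ∘ c) * ∑B (im ∘ c)
      ≡⟨ sym (∑-norm (allBits m) c) ⟩
    ∑B (λ u → ∑B (λ v → re (c u ⊕ neg₄ (c v))))
      ≡⟨ ∑-swap (allBits m) (allBits m) (λ u v → re (c u ⊕ neg₄ (c v))) ⟩
    ∑B (λ v → ∑B (λ u → re (c u ⊕ neg₄ (c v))))
      ≡⟨ ∑-cong (allBits m) (λ v → sym (∑B-⊞ (λ u → re (c u ⊕ neg₄ (c v))) v)) ⟩
    ∑B (λ v → ∑B (λ w → re (c (w ⊞ v) ⊕ neg₄ (c v))))
      ≡⟨ ∑-cong (allBits m) (λ v → ∑-cong (allBits m) λ w → cong re (diff v w)) ⟩
    ∑B (λ v → ∑B (λ w → re (κ w ⊕ twoDot (M ·₂ w) v)))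
      ≡⟨ ∑-swap (allBits m) (allBits m) (λ v w → re (κ w ⊕ twoDot (M ·₂ w) v)) ⟩
    ∑B (λ w → ∑B (λ v → re (κ w ⊕ twoDot (M ·₂ w) v)))
      ≡⟨ ∑-cong (allBits m) (λ w → trans (∑-cong (allBits m) λ v → re-z2-⊕ (κ w) (bitDot (M ·₂ w) v))
           (∑-*ˡ (allBits m) (re (κ w)) (λ v → re (twoDot (M ·₂ w) v)))) ⟩
    ∑B (λ w → re (κ w) * ∑B (λ v → re (twoDot (M ·₂ w) v)))
      ≡⟨ ∑B-delta (λ w → re (κ w) * ∑B (λ v → re (twoDot (M ·₂ w) v))) (λ w w≢0 →
           trans (cong (_*_ (re (κ w))) (∑B-twoDot (M ·₂ w) (w≢0 ∘ ns w))) (ℤₚ.*-zeroʳ (re (κ w)))) ⟩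
    re (κ 0b) * ∑B (λ v → re (twoDot (M ·₂ 0b) v))
      ≡⟨ cong₂ _*_ (cong re κ-0) (∑-cong (allBits m) λ v → cong re (trans (cong (λ z → twoDot z v) M·0) (twoDot-zeroˡ v))) ⟩
    1ℤ * ∑B {m} (λ _ → 1ℤ)
      ≡⟨ trans (ℤₚ.*-identityˡ _) (∑B-1 m) ⟩
    + 2 ^ m ∎
    where
    open ≡-Reasoning
    cancel : ∀ a b → a ⊕ b ⊕ neg₄ a ≡ b
    cancel = from-yes (all₄? λ a → all₄? λ b → a ⊕ b ⊕ neg₄ a ≈? b)
    diff : ∀ v w → c (w ⊞ v) ⊕ neg₄ (c v) ≡ κ w ⊕ twoDot (M ·₂ w) v
    diff v w = trans (cong (λ z → c z ⊕ neg₄ (c v)) (⊞-comm w v))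
      (trans (cong (_⊕ neg₄ (c v)) (polar v w)) (cancel (c v) _))
    row-0 : ∀ {k} (r : Bits k) → Vec.foldr _ _xor_ false (zipWith _∧_ r 0b) ≡ false
    row-0 []      = refl
    row-0 (b ∷ r) = trans (cong (_xor _) (Boolₚ.∧-zeroʳ b)) (row-0 r)
    M·0 : M ·₂ 0b ≡ 0b
    M·0 = trans (Vecₚ.map-cong row-0 M) (Vecₚ.map-const M false)

  -- The parity of c (v + w) - c v does not depend on v, because the part that varies is even. If it
  -- is odd, translation by w changes the sign of every term (-1)^c(v).
  ∑-double : ∀ v₀ v₁ → c v₀ ≡ z0 → im (c v₁) ≢ 0ℤ → ∑B (λ v → re (c v ⊕ c v)) ≡ 0ℤ
  ∑-double v₀ v₁ c₀ odd = x≡-x⇒x≡0 _ (begin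
    ∑B (λ v → re (c v ⊕ c v))                ≡⟨ sym (∑B-⊞ (λ v → re (c v ⊕ c v)) w) ⟩
    ∑B (λ v → re (c (v ⊞ w) ⊕ c (v ⊞ w)))    ≡⟨ ∑-cong (allBits m) (λ v →
                                                  trans (cong (λ a → re (a ⊕ a)) (polar v w)) (flip (κ w) (bitDot (M ·₂ w) v₀) odd′ (c v) (bitDot (M ·₂ w) v))) ⟩
    ∑B (λ v → - re (c v ⊕ c v))              ≡⟨ ∑-neg (allBits m) (λ v → re (c v ⊕ c v)) ⟩
    - ∑B (λ v → re (c v ⊕ c v)) ∎)
    where
    open ≡-Reasoning
    -- Then v₀ + w = v₁, so the increment of `c` at v₀ is the odd value c v₁ itself, as c v₀ = 0.
    w = v₀ ⊞ v₁
    odd′ : im (κ w ⊕ twoDot (M ·₂ w) v₀) ≢ 0ℤ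
    odd′ e = odd (trans (cong im (trans (cong c (sym (⊞-cancelˡ v₀ v₁)))
      (trans (polar v₀ w) (cong (_⊕ (κ w ⊕ twoDot (M ·₂ w) v₀)) c₀)))) e)
    flip : ∀ k x → im (k ⊕ z2 ⊗ x) ≢ 0ℤ →
           ∀ a y → re ((a ⊕ (k ⊕ z2 ⊗ y)) ⊕ (a ⊕ (k ⊕ z2 ⊗ y))) ≡ - re (a ⊕ a)
    flip = from-yes (all₄? λ k → all₄? λ x → ¬? (im (k ⊕ z2 ⊗ x) ℤ.≟ 0ℤ) →-dec
      all₄? λ a → all₄? λ y → re ((a ⊕ (k ⊕ z2 ⊗ y)) ⊕ (a ⊕ (k ⊕ z2 ⊗ y))) ℤ.≟ - re (a ⊕ a))

-- Sums of two squares

parity : ∀ x → ∃ λ a → (x ≡ 2 ℕ.* a) ⊎ (x ≡ 2 ℕ.* a ℕ.+ 1)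
parity zero = 0 , inj₁ refl
parity (suc x) with parity x
... | a , inj₁ refl = a , inj₂ (ℕₚ.+-comm 1 (2 ℕ.* a))
... | a , inj₂ refl = suc a , inj₁ (lemma a)
  where
  lemma : ∀ a → suc (2 ℕ.* a ℕ.+ 1) ≡ 2 ℕ.* suc a
  lemma = ℕSolver.solve-∀

mod4 : ∀ r A B → r ℕ.+ A ℕ.* 4 ≡ B ℕ.* 4 → r ℕ.% 4 ≡ 0
mod4 r A B e = trans (sym (ℕ.[m+kn]%n≡m%n r A 4)) (trans (cong (ℕ._% 4) e) (ℕ.m*n%n≡0 B 4))

2<n² : ∀ n → 2 ℕ.< suc (suc n) ℕ.* suc (suc n)
2<n² n = ℕₚ.≤-trans (ℕₚ.n≤1+n 3) (ℕₚ.*-mono-≤ {2} {suc (suc n)} {2} (s≤s (s≤s z≤n)) (s≤s (s≤s z≤n)))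

-- For k > 0 the right side is divisible by 4, which forces x and y to be even, since otherwise the
-- left side is 1 or 2 modulo 4. Halving both descends to x² + y² = 2.
two-squares : ∀ k x y → x ℕ.* x ℕ.+ y ℕ.* y ≡ 2 ℕ.* (2 ^ k ℕ.* 2 ^ k) → x ≡ 2 ^ k
two-squares zero zero          (suc (suc y)) e = contradiction (ℕₚ.≤-reflexive e) (ℕₚ.<⇒≱ (2<n² y))
two-squares zero (suc zero)    y             e = refl
two-squares zero (suc (suc x)) y             e = contradiction (ℕₚ.≤-reflexive e)
  (ℕₚ.<⇒≱ (ℕₚ.≤-trans (2<n² x) (ℕₚ.m≤m+n _ (y ℕ.* y))))
two-squares (suc k) x y e with parity x | parity y
... | a , inj₁ refl | b , inj₁ refl = cong (2 ℕ.*_) (two-squares k a b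
  (ℕₚ.*-cancelˡ-≡ _ _ 4 (trans (lhs a b) (trans e (rhs (2 ^ k))))))
  where
  lhs : ∀ a b → 4 ℕ.* (a ℕ.* a ℕ.+ b ℕ.* b) ≡ 2 ℕ.* a ℕ.* (2 ℕ.* a) ℕ.+ 2 ℕ.* b ℕ.* (2 ℕ.* b)
  lhs = ℕSolver.solve-∀
  rhs : ∀ u → 2 ℕ.* (2 ℕ.* u ℕ.* (2 ℕ.* u)) ≡ 4 ℕ.* (2 ℕ.* (u ℕ.* u))
  rhs = ℕSolver.solve-∀
... | a , inj₁ refl | b , inj₂ refl = contradiction
  (mod4 1 (a ℕ.* a ℕ.+ b ℕ.* b ℕ.+ b) (2 ℕ.* (2 ^ k ℕ.* 2 ^ k)) (trans (lhs a b) (trans e (rhs (2 ^ k))))) λ ()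
  where
  lhs : ∀ a b → 1 ℕ.+ (a ℕ.* a ℕ.+ b ℕ.* b ℕ.+ b) ℕ.* 4 ≡ 2 ℕ.* a ℕ.* (2 ℕ.* a) ℕ.+ (2 ℕ.* b ℕ.+ 1) ℕ.* (2 ℕ.* b ℕ.+ 1)
  lhs = ℕSolver.solve-∀
  rhs : ∀ u → 2 ℕ.* (2 ℕ.* u ℕ.* (2 ℕ.* u)) ≡ 2 ℕ.* (u ℕ.* u) ℕ.* 4
  rhs = ℕSolver.solve-∀
... | a , inj₂ refl | b , inj₁ refl = contradiction
  (mod4 1 (a ℕ.* a ℕ.+ b ℕ.* b ℕ.+ a) (2 ℕ.* (2 ^ k ℕ.* 2 ^ k)) (trans (lhs a b) (trans e (rhs (2 ^ k))))) λ ()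
  where
  lhs : ∀ a b → 1 ℕ.+ (a ℕ.* a ℕ.+ b ℕ.* b ℕ.+ a) ℕ.* 4 ≡ (2 ℕ.* a ℕ.+ 1) ℕ.* (2 ℕ.* a ℕ.+ 1) ℕ.+ 2 ℕ.* b ℕ.* (2 ℕ.* b)
  lhs = ℕSolver.solve-∀
  rhs : ∀ u → 2 ℕ.* (2 ℕ.* u ℕ.* (2 ℕ.* u)) ≡ 2 ℕ.* (u ℕ.* u) ℕ.* 4
  rhs = ℕSolver.solve-∀
... | a , inj₂ refl | b , inj₂ refl = contradiction
  (mod4 2 (a ℕ.* a ℕ.+ b ℕ.* b ℕ.+ a ℕ.+ b) (2 ℕ.* (2 ^ k ℕ.* 2 ^ k)) (trans (lhs a b) (trans e (rhs (2 ^ k))))) λ ()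
  where
  lhs : ∀ a b → 2 ℕ.+ (a ℕ.* a ℕ.+ b ℕ.* b ℕ.+ a ℕ.+ b) ℕ.* 4 ≡ (2 ℕ.* a ℕ.+ 1) ℕ.* (2 ℕ.* a ℕ.+ 1) ℕ.+ (2 ℕ.* b ℕ.+ 1) ℕ.* (2 ℕ.* b ℕ.+ 1)
  lhs = ℕSolver.solve-∀
  rhs : ∀ u → 2 ℕ.* (2 ℕ.* u ℕ.* (2 ℕ.* u)) ≡ 2 ℕ.* (u ℕ.* u) ℕ.* 4
  rhs = ℕSolver.solve-∀

i*i≡∣i∣*∣i∣ : ∀ i → i * i ≡ + (∣ i ∣ ℕ.* ∣ i ∣)
i*i≡∣i∣*∣i∣ (+ n)    = sym (ℤₚ.pos-* n n)
i*i≡∣i∣*∣i∣ -[1+ n ] = refl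

∣i∣≡n⇒ : ∀ {n} i → ∣ i ∣ ≡ n → i ≡ + n ⊎ i ≡ - (+ n)
∣i∣≡n⇒ (+ n)    refl = inj₁ refl
∣i∣≡n⇒ -[1+ n ] refl = inj₂ refl

two-squaresℤ : ∀ k x y → x * x + y * y ≡ + 2 ^ suc (k ℕ.+ k) → x ≡ + 2 ^ k ⊎ x ≡ - (+ 2 ^ k)
two-squaresℤ k x y e = ∣i∣≡n⇒ x (two-squares k ∣ x ∣ ∣ y ∣ (ℤₚ.+-injective
  (trans (sym (cong₂ _+_ (i*i≡∣i∣*∣i∣ x) (i*i≡∣i∣*∣i∣ y)))
         (trans e (cong (λ z → + (2 ℕ.* z)) (ℕₚ.^-distribˡ-+-* 2 k k))))))

-- Schemes from an orthogonal matrix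

-- Transfers an arithmetic identity from unnormalised fractions, where it is a cross multiplication,
-- so that no gcd in the normal form of `ℚ` has to be handled.
fromℚᵘ-homo : ∀ {p q r} (_∙_ : ℚᵘ.ℚᵘ → ℚᵘ.ℚᵘ → ℚᵘ.ℚᵘ) (_∘′_ : ℚ → ℚ → ℚ) →
  (∀ x y → toℚᵘ (x ∘′ y) ℚᵘ.≃ (toℚᵘ x ∙ toℚᵘ y)) →
  (∀ {x x′ y y′} → x ℚᵘ.≃ x′ → y ℚᵘ.≃ y′ → (x ∙ y) ℚᵘ.≃ (x′ ∙ y′)) →
  r ℚᵘ.≃ (p ∙ q) → fromℚᵘ r ≡ (fromℚᵘ p ∘′ fromℚᵘ q)
fromℚᵘ-homo {p} {q} {r} _∙_ _∘′_ homo ∙-cong e = ℚₚ.toℚᵘ-injective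
  (ℚᵘₚ.≃-trans (ℚₚ.toℚᵘ-fromℚᵘ r) (ℚᵘₚ.≃-trans e (ℚᵘₚ.≃-trans
    (∙-cong (ℚᵘₚ.≃-sym (ℚₚ.toℚᵘ-fromℚᵘ p)) (ℚᵘₚ.≃-sym (ℚₚ.toℚᵘ-fromℚᵘ q)))
    (ℚᵘₚ.≃-sym (homo (fromℚᵘ p) (fromℚᵘ q))))))

ι : ℤ → ℚ
ι = ιℤℚ

ι-+ : ∀ a b → ι (a + b) ≡ ι a ℚ.+ ι b
ι-+ a b = fromℚᵘ-homo {ℚᵘ.mkℚᵘ a 0} {ℚᵘ.mkℚᵘ b 0} {ℚᵘ.mkℚᵘ (a + b) 0} ℚᵘ._+_ ℚ._+_ ℚₚ.toℚᵘ-homo-+ ℚᵘₚ.+-cong (ℚᵘ.*≡* (lemma a b))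
  where
  lemma : ∀ a b → (a + b) * + 1 ≡ (a * + 1 + b * + 1) * + 1
  lemma = solve-∀

ι-* : ∀ a b → ι (a * b) ≡ ι a ℚ.* ι b
ι-* a b = fromℚᵘ-homo {ℚᵘ.mkℚᵘ a 0} {ℚᵘ.mkℚᵘ b 0} {ℚᵘ.mkℚᵘ (a * b) 0} ℚᵘ._*_ ℚ._*_ ℚₚ.toℚᵘ-homo-* ℚᵘₚ.*-cong (ℚᵘ.*≡* refl)

ι-injective : ∀ {a b} → ι a ≡ ι b → a ≡ b
ι-injective {a} {b} e with ℚₚ.fromℚᵘ-injective {ℚᵘ.mkℚᵘ a 0} {ℚᵘ.mkℚᵘ b 0} e
... | ℚᵘ.*≡* eq = trans (sym (ℤₚ.*-identityʳ a)) (trans eq (ℤₚ.*-identityʳ b))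

ι-inverse : ∀ n .{{_ : NonZero n}} → ι (+ n) ℚ.* (+ 1 ℚ./ n) ≡ 1ℚ
ι-inverse (suc n) = sym (fromℚᵘ-homo {ℚᵘ.mkℚᵘ (+ suc n) 0} {ℚᵘ.mkℚᵘ (+ 1) n} {ℚᵘ.mkℚᵘ (+ 1) 0}
  ℚᵘ._*_ ℚ._*_ ℚₚ.toℚᵘ-homo-* ℚᵘₚ.*-cong
  (ℚᵘ.*≡* (trans (cong (λ k → + 1 * + k) (ℕₚ.*-identityˡ (suc n))) (lemma (+ suc n)))))
  where
  lemma : ∀ a → + 1 * a ≡ a * + 1 * + 1
  lemma = solve-∀

ι-÷ : ∀ n .{{_ : NonZero n}} a → ι (+ n * a) ÷ n ≡ ι a
ι-÷ n a = begin
  ι (+ n * a) ℚ.* r            ≡⟨ cong (λ z → ι z ℚ.* r) (ℤₚ.*-comm (+ n) a) ⟩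
  ι (a * + n) ℚ.* r            ≡⟨ cong (ℚ._* r) (ι-* a (+ n)) ⟩
  ι a ℚ.* ι (+ n) ℚ.* r        ≡⟨ ℚₚ.*-assoc (ι a) (ι (+ n)) r ⟩
  ι a ℚ.* (ι (+ n) ℚ.* r)      ≡⟨ cong (ι a ℚ.*_) (ι-inverse n) ⟩
  ι a ℚ.* 1ℚ                   ≡⟨ ℚₚ.*-identityʳ (ι a) ⟩
  ι a ∎
  where
  open ≡-Reasoning
  r = + 1 ℚ./ n

Σℚ-cong : ∀ {n} {f g : Fin n → ℚ} → (∀ i → f i ≡ g i) → Σℚ f ≡ Σℚ g
Σℚ-cong {zero}  e = refl
Σℚ-cong {suc n} e = cong₂ ℚ._+_ (e zero) (Σℚ-cong (e ∘ suc))

Σℚ-*ʳ : ∀ {n} (f : Fin n → ℚ) r → Σℚ (λ i → f i ℚ.* r) ≡ Σℚ f ℚ.* r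
Σℚ-*ʳ {zero}  f r = sym (ℚₚ.*-zeroˡ r)
Σℚ-*ʳ {suc n} f r = trans (cong (f zero ℚ.* r ℚ.+_) (Σℚ-*ʳ (f ∘ suc) r)) (sym (ℚₚ.*-distribʳ-+ r (f zero) _))

Σℚ-ι : ∀ {n} (f : Fin n → ℤ) → Σℚ (ι ∘ f) ≡ ι (∑F f)
Σℚ-ι {zero}  f = refl
Σℚ-ι {suc n} f = trans (cong (ι (f zero) ℚ.+_) (Σℚ-ι (f ∘ suc)))
  (trans (sym (ι-+ (f zero) (∑F (f ∘ suc)))) (cong ι (sym (∑F-suc f))))

δ≡ι : ∀ {k} (a b : Fin k) → δ a b ≡ ι ⟦ a == b ⟧
δ≡ι a b with a Fin.≟ b
... | yes _ = refl
... | no  _ = refl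

adjacency≡ι : ∀ {n d} (R : Rels n d) j x y → adjacency R j x y ≡ ι ⟦ R j x y ⟧
adjacency≡ι R j x y with R j x y
... | true  = refl
... | false = refl

count≡∑ : ∀ {n} (p : Fin n → Bool) → + count p ≡ ∑F (⟦_⟧ ∘ p)
count≡∑ {zero}  p = refl
count≡∑ {suc n} p = trans (cong₂ _+_ (head (p zero)) (count≡∑ (p ∘ suc))) (sym (∑F-suc (⟦_⟧ ∘ p)))
  where
  head : ∀ b → + (if b then 1 else 0) ≡ ⟦ b ⟧
  head true  = refl
  head false = refl

-- An invertible matrix has distinct rows. This recovers a class from its row of character sums,
-- both for the symmetry of the relations and for the converse half of duality.
rows-distinct : ∀ n .{{_ : NonZero n}} (P Q : Fin 4 → Fin 4 → ℤ) →
  (∀ c k → ∑F (λ j → Q c j * P j k) ≡ + n * ⟦ c == k ⟧) →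
  ∀ c c′ → (∀ j → Q c j ≡ Q c′ j) → c ≡ c′
rows-distinct n P Q QP c c′ e = ==⇒≡ (⟦⟧-injective (ℤₚ.*-cancelˡ-≡ (+ n) _ _ (begin
  + n * ⟦ c == c′ ⟧              ≡⟨ sym (QP c c′) ⟩
  ∑F (λ j → Q c j * P j c′)      ≡⟨ ∑-cong (allFin 4) (λ j → cong (_* P j c′) (e j)) ⟩
  ∑F (λ j → Q c′ j * P j c′)     ≡⟨ QP c′ c′ ⟩
  + n * ⟦ c′ == c′ ⟧             ≡⟨ cong (λ b → + n * ⟦ b ⟧) (==-refl c′) ⟩
  + n * ⟦ true ⟧ ∎)))
  where open ≡-Reasoning

-- The class function `cls` and the matrix H are the only data, with no group structure on the
-- points. The same module can thus be applied to `Kshort` with H and to the cosets with the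
-- transpose of H and with P and Q exchanged.
module Spectral {n n′ : ℕ} .{{_ : NonZero n}}
  (R : Rels n 3) (cls : Fin n → Fin n → Fin 4)
  (R-cls : ∀ j x y → R j x y ≡ (cls x y == j))
  (cls-diag : ∀ x → cls x x ≡ zero) (cls-zero : ∀ x y → cls x y ≡ zero → x ≡ y)
  (H : Fin n → Fin n′ → ℤ) (dual-cls : Fin n′ → Fin 4)
  (P Q : Fin 4 → Fin 4 → ℤ)
  (orthogonal : ∀ t u → ∑F (λ x → H x t * H x u) ≡ + n * ⟦ t == u ⟧)
  (B≡Q : ∀ j x y → ∑F (λ t → ⟦ dual-cls t == j ⟧ * (H x t * H y t)) ≡ Q (cls x y) j)
  (QP : ∀ c k → ∑F (λ j → Q c j * P j k) ≡ + n * ⟦ c == k ⟧)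
  (P-col₀ : ∀ j → P j zero ≡ 1ℤ) (Q-col₀ : ∀ j → Q j zero ≡ 1ℤ)
  (P-row₀≢0 : ∀ j → P zero j ≢ 0ℤ) (x₀ : Fin n)
  where

  open ≡-Reasoning

  -- The integral matrix n E_j = H Δ_j Hᵀ; the division by n is postponed to `eigenmatrices`.
  B : Fin 4 → Fin n → Fin n → ℤ
  B j x y = ∑F (λ t → ⟦ dual-cls t == j ⟧ * (H x t * H y t))

  -- In H Δ_i Hᵀ H Δ_k Hᵀ the inner product Hᵀ H is n times the identity, and Δ_i Δ_k vanishes for i
  -- ≠ k.
  BB : ∀ i k x y → ∑F (λ z → B i x z * B k z y) ≡ + n * (⟦ i == k ⟧ * B i x y)
  BB i k x y = begin
    ∑F (λ z → B i x z * B k z y)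
      ≡⟨ ∑-cong (allFin n) (λ z → trans (cong₂ _*_
           (∑-cong (allFin n′) λ t → regroup ⟦ dual-cls t == i ⟧ (H x t) (H z t))
           (∑-cong (allFin n′) λ u → regroup′ ⟦ dual-cls u == k ⟧ (H z u) (H y u)))
           (∑-* (allFin n′) (allFin n′) (λ t → a t * H z t) (λ u → b u * H z u))) ⟩
    ∑F (λ z → ∑F (λ t → ∑F (λ u → a t * H z t * (b u * H z u))))
      ≡⟨ ∑-swap (allFin n) (allFin n′) (λ z t → ∑F (λ u → a t * H z t * (b u * H z u))) ⟩
    ∑F (λ t → ∑F (λ z → ∑F (λ u → a t * H z t * (b u * H z u))))
      ≡⟨ ∑-cong (allFin n′) (λ t → ∑-swap (allFin n) (allFin n′) (λ z u → a t * H z t * (b u * H z u))) ⟩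
    ∑F (λ t → ∑F (λ u → ∑F (λ z → a t * H z t * (b u * H z u))))
      ≡⟨ ∑-cong (allFin n′) (λ t → trans (∑-cong (allFin n′) (collapse t)) (∑F-== (λ u → + n * (a t * b u)) t)) ⟩
    ∑F (λ t → + n * (a t * b t))
      ≡⟨ ∑-*ˡ (allFin n′) (+ n) (λ t → a t * b t) ⟩
    + n * ∑F (λ t → a t * b t)
      ≡⟨ cong (_*_ (+ n)) (trans (∑-cong (allFin n′) disjoint)
           (∑-*ˡ (allFin n′) ⟦ i == k ⟧ (λ t → ⟦ dual-cls t == i ⟧ * (H x t * H y t)))) ⟩
    + n * (⟦ i == k ⟧ * B i x y) ∎
    where
    a b : Fin n′ → ℤ
    a t = ⟦ dual-cls t == i ⟧ * H x t
    b u = ⟦ dual-cls u == k ⟧ * H y u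
    regroup : ∀ p q r → p * (q * r) ≡ p * q * r
    regroup = solve-∀
    regroup′ : ∀ p q r → p * (q * r) ≡ p * r * q
    regroup′ = solve-∀
    collapse : ∀ t u → ∑F (λ z → a t * H z t * (b u * H z u)) ≡ ⟦ t == u ⟧ * (+ n * (a t * b u))
    collapse t u = begin
      ∑F (λ z → a t * H z t * (b u * H z u))   ≡⟨ ∑-cong (allFin n) (λ z → lemma₁ (a t) (H z t) (b u) (H z u)) ⟩
      ∑F (λ z → a t * b u * (H z t * H z u))   ≡⟨ ∑-*ˡ (allFin n) (a t * b u) (λ z → H z t * H z u) ⟩
      a t * b u * ∑F (λ z → H z t * H z u)     ≡⟨ cong (_*_ (a t * b u)) (orthogonal t u) ⟩
      a t * b u * (+ n * ⟦ t == u ⟧)           ≡⟨ lemma₂ (a t) (b u) (+ n) ⟦ t == u ⟧ ⟩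
      ⟦ t == u ⟧ * (+ n * (a t * b u)) ∎
      where
      lemma₁ : ∀ p q r s → p * q * (r * s) ≡ p * r * (q * s)
      lemma₁ = solve-∀
      lemma₂ : ∀ p q r s → p * q * (r * s) ≡ s * (r * (p * q))
      lemma₂ = solve-∀
    disjoint : ∀ t → a t * b t ≡ ⟦ i == k ⟧ * (⟦ dual-cls t == i ⟧ * (H x t * H y t))
    disjoint t with dual-cls t Fin.≟ i
    ... | yes refl = lemma (H x t) ⟦ dual-cls t == k ⟧ (H y t)
      where
      lemma : ∀ p q r → 1ℤ * p * (q * r) ≡ q * (1ℤ * (p * r))
      lemma = solve-∀
    ... | no _ = lemma (H x t) (⟦ dual-cls t == k ⟧ * H y t) ⟦ i == k ⟧ (H x t * H y t)
      where
      lemma : ∀ p q r s → 0ℤ * p * q ≡ r * (0ℤ * s)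
      lemma = solve-∀

  B-sym : ∀ j x y → B j x y ≡ B j y x
  B-sym j x y = ∑-cong (allFin n′) λ t → cong (_*_ ⟦ dual-cls t == j ⟧) (ℤₚ.*-comm (H x t) (H y t))

  BP : ∀ k x y → ∑F (λ j → B j x y * P j k) ≡ + n * ⟦ R k x y ⟧
  BP k x y = begin
    ∑F (λ j → B j x y * P j k)           ≡⟨ ∑-cong (allFin 4) (λ j → cong (_* P j k) (B≡Q j x y)) ⟩
    ∑F (λ j → Q (cls x y) j * P j k)     ≡⟨ QP (cls x y) k ⟩
    + n * ⟦ cls x y == k ⟧               ≡⟨ cong (λ b → + n * ⟦ b ⟧) (sym (R-cls k x y)) ⟩
    + n * ⟦ R k x y ⟧ ∎

  -- The matrices `B j` are symmetric, and their entries at (x, y) form the row of Q that determines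
  -- the class.
  cls-sym : ∀ x y → cls x y ≡ cls y x
  cls-sym x y = rows-distinct n P Q QP _ _ λ j → trans (sym (B≡Q j x y)) (trans (B-sym j x y) (B≡Q j y x))

  -- This is n² times the intersection number, from n A_i = Σ_a P_ai B_a. It is left as a double
  -- sum, since only its dependence on the class c matters.
  structure : Fin 4 → Fin 4 → Fin 4 → ℤ
  structure i j c = ∑F (λ a → ∑F (λ b → P a i * P b j * (+ n * (⟦ a == b ⟧ * Q c a))))

  A*A : ∀ i j x y → + n * + n * + count (λ z → R i x z ∧ R j z y) ≡ structure i j (cls x y)
  A*A i j x y = begin
    + n * + n * + count (λ z → R i x z ∧ R j z y)
      ≡⟨ cong (_*_ (+ n * + n)) (trans (count≡∑ (λ z → R i x z ∧ R j z y))
           (∑-cong (allFin n) λ z → ⟦⟧-∧ (R i x z) (R j z y))) ⟩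
    + n * + n * ∑F (λ z → ⟦ R i x z ⟧ * ⟦ R j z y ⟧)
      ≡⟨ sym (∑-*ˡ (allFin n) (+ n * + n) (λ z → ⟦ R i x z ⟧ * ⟦ R j z y ⟧)) ⟩
    ∑F (λ z → + n * + n * (⟦ R i x z ⟧ * ⟦ R j z y ⟧))
      ≡⟨ ∑-cong (allFin n) (λ z → trans (lemma₁ (+ n) ⟦ R i x z ⟧ ⟦ R j z y ⟧)
           (trans (sym (cong₂ _*_ (BP i x z) (BP j z y)))
             (∑-* (allFin 4) (allFin 4) (λ a → B a x z * P a i) (λ b → B b z y * P b j)))) ⟩
    ∑F (λ z → ∑F (λ a → ∑F (λ b → B a x z * P a i * (B b z y * P b j))))
      ≡⟨ ∑-swap (allFin n) (allFin 4) (λ z a → ∑F (λ b → B a x z * P a i * (B b z y * P b j))) ⟩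
    ∑F (λ a → ∑F (λ z → ∑F (λ b → B a x z * P a i * (B b z y * P b j))))
      ≡⟨ ∑-cong (allFin 4) (λ a → ∑-swap (allFin n) (allFin 4) (λ z b → B a x z * P a i * (B b z y * P b j))) ⟩
    ∑F (λ a → ∑F (λ b → ∑F (λ z → B a x z * P a i * (B b z y * P b j))))
      ≡⟨ ∑-cong (allFin 4) (λ a → ∑-cong (allFin 4) λ b → trans
           (∑-cong (allFin n) λ z → lemma₂ (B a x z) (P a i) (B b z y) (P b j))
           (trans (∑-*ˡ (allFin n) (P a i * P b j) (λ z → B a x z * B b z y))
           (cong (_*_ (P a i * P b j)) (trans (BB a b x y)
             (cong (λ q → + n * (⟦ a == b ⟧ * q)) (B≡Q a x y)))))) ⟩
    structure i j (cls x y) ∎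
    where
    lemma₁ : ∀ p q r → p * p * (q * r) ≡ p * q * (p * r)
    lemma₁ = solve-∀
    lemma₂ : ∀ p q r s → p * q * (r * s) ≡ q * s * (p * r)
    lemma₂ = solve-∀

  -- All row sums of B_a vanish except for a = 0, so summing n A_j = Σ_a P_aj B_a along a row leaves
  -- n P_0j.
  valency : ∀ j x → ∑F (λ z → ⟦ R j x z ⟧) ≡ P zero j
  valency j x = ℤₚ.*-cancelˡ-≡ (+ n) _ _ (begin
    + n * ∑F (λ z → ⟦ R j x z ⟧)
      ≡⟨ sym (∑-*ˡ (allFin n) (+ n) (λ z → ⟦ R j x z ⟧)) ⟩
    ∑F (λ z → + n * ⟦ R j x z ⟧)
      ≡⟨ ∑-cong (allFin n) (λ z → sym (BP j x z)) ⟩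
    ∑F (λ z → ∑F (λ a → B a x z * P a j))
      ≡⟨ ∑-swap (allFin n) (allFin 4) (λ z a → B a x z * P a j) ⟩
    ∑F (λ a → ∑F (λ z → B a x z * P a j))
      ≡⟨ ∑-cong (allFin 4) (λ a → trans (∑-*ʳ (allFin n) (P a j) (B a x))
           (trans (cong (_* P a j) (row-sum a)) (regroup (+ n) ⟦ zero == a ⟧ (P a j)))) ⟩
    ∑F (λ a → ⟦ zero == a ⟧ * (+ n * P a j))
      ≡⟨ ∑F-== (λ a → + n * P a j) zero ⟩
    + n * P zero j ∎)
    where
    regroup : ∀ p q r → p * q * r ≡ q * (p * r)
    regroup = solve-∀
    B₀ : ∀ x y → B zero x y ≡ 1ℤ
    B₀ x y = trans (B≡Q zero x y) (Q-col₀ (cls x y))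
    row-sum : ∀ a → ∑F (B a x) ≡ + n * ⟦ zero == a ⟧
    row-sum a = begin
      -- As column 0 of Q is constant 1, B₀ is the all-one matrix, and this row sum is a diagonal
      -- entry of B₀ B_a.
      ∑F (B a x)                              ≡⟨ ∑-cong (allFin n) (λ z → trans (B-sym a x z)
                                                   (trans (sym (ℤₚ.*-identityˡ _)) (cong (_* B a z x) (sym (B₀ x z))))) ⟩
      ∑F (λ z → B zero x z * B a z x)         ≡⟨ BB zero a x x ⟩
      + n * (⟦ zero == a ⟧ * B zero x x)      ≡⟨ cong (λ q → + n * (⟦ zero == a ⟧ * q)) (B₀ x x) ⟩
      + n * (⟦ zero == a ⟧ * 1ℤ)              ≡⟨ cong (_*_ (+ n)) (ℤₚ.*-identityʳ _) ⟩
      + n * ⟦ zero == a ⟧ ∎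

  related : ∀ j x → ∃ λ z → R j x z ≡ true
  related j x = proj₁ nonzero , true! (R j x (proj₁ nonzero)) (proj₂ (proj₂ nonzero))
    where
    nonzero = ∑≢0⇒∃ (allFin n) {λ z → ⟦ R j x z ⟧} (λ e → P-row₀≢0 j (trans (sym (valency j x)) e))
    true! : ∀ b → ⟦ b ⟧ ≢ 0ℤ → b ≡ true
    true! true  _  = refl
    true! false ne = contradiction refl ne

  scheme : IsAssocScheme R
  scheme = record
    { partition    = λ x y → ℤₚ.+-injective (begin
        + count (λ j → R j x y)                ≡⟨ count≡∑ (λ j → R j x y) ⟩
        ∑F (λ j → ⟦ R j x y ⟧)                 ≡⟨ ∑-cong (allFin 4) (λ j → trans (cong ⟦_⟧ (R-cls j x y)) (sym (ℤₚ.*-identityʳ _))) ⟩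
        ∑F (λ j → ⟦ cls x y == j ⟧ * 1ℤ)       ≡⟨ ∑F-== (λ _ → 1ℤ) (cls x y) ⟩
        1ℤ ∎)
    ; diagonal     = λ x y e → cls-zero x y (==⇒≡ (trans (sym (R-cls zero x y)) e))
    ; diagonal′    = λ x → trans (R-cls zero x x) (cong (_== zero) (cls-diag x))
    ; symmetric    = λ j x y → trans (R-cls j x y) (trans (cong (_== j) (cls-sym x y)) (sym (R-cls j y x)))
    ; nonempty     = λ j → x₀ , related j x₀
    -- The number is read off at one fixed pair of class k; `A*A` shows, after cancelling n twice,
    -- that every other pair of the class gives the same count.
    ; intersection = (λ i j k → count (λ z → R i x₀ z ∧ R j z (proj₁ (related k x₀)))) , λ i j k x y e →
        ℤₚ.+-injective (ℤₚ.*-cancelˡ-≡ (+ n) _ _ (ℤₚ.*-cancelˡ-≡ (+ n) _ _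
          (trans (sym (ℤₚ.*-assoc (+ n) (+ n) _)) (trans
            (trans (A*A i j x y) (trans (cong (structure i j) (trans (class k x y e) (sym (class k _ _ (proj₂ (related k x₀))))))
              (sym (A*A i j x₀ (proj₁ (related k x₀))))))
            (ℤₚ.*-assoc (+ n) (+ n) _)))))
    }
    where
    class : ∀ k x y → R k x y ≡ true → cls x y ≡ k
    class k x y e = ==⇒≡ (trans (sym (R-cls k x y)) e)

  eigenmatrices : HasEigenmatrices R (λ i j → ι (P i j)) (λ i j → ι (Q i j))
  eigenmatrices = E , idempotent , resolution , A≡PE , nE≡QA
    where
    r : ℚ
    r = + 1 ℚ./ n
    E : Fin 4 → Mat n
    E j x y = ι (B j x y) ÷ n

    ÷-distrib : ∀ {d} (f : Fin d → ℤ) → Σℚ (λ i → ι (f i) ÷ n) ≡ ι (∑F f) ÷ n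
    ÷-distrib f = trans (Σℚ-*ʳ (ι ∘ f) r) (cong (ℚ._* r) (Σℚ-ι f))

    idempotent : ∀ i k x y → (E i ⊙ E k) x y ≡ δ i k ℚ.* E i x y
    idempotent i k x y = begin
      Σℚ (λ z → ι (B i x z) ℚ.* r ℚ.* (ι (B k z y) ℚ.* r))
        ≡⟨ Σℚ-cong (λ z → trans (interchange (ι (B i x z)) r (ι (B k z y)) r)
             (cong (ℚ._* (r ℚ.* r)) (sym (ι-* (B i x z) (B k z y))))) ⟩
      Σℚ (λ z → ι (B i x z * B k z y) ℚ.* (r ℚ.* r))
        ≡⟨ trans (Σℚ-*ʳ (λ z → ι (B i x z * B k z y)) (r ℚ.* r))
             (cong (ℚ._* (r ℚ.* r)) (trans (Σℚ-ι (λ z → B i x z * B k z y)) (cong ι (BB i k x y)))) ⟩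
      ι (+ n * (⟦ i == k ⟧ * B i x y)) ℚ.* (r ℚ.* r)
        ≡⟨ sym (ℚₚ.*-assoc (ι (+ n * (⟦ i == k ⟧ * B i x y))) r r) ⟩
      (ι (+ n * (⟦ i == k ⟧ * B i x y)) ÷ n) ℚ.* r
        ≡⟨ cong (ℚ._* r) (trans (ι-÷ n (⟦ i == k ⟧ * B i x y)) (ι-* ⟦ i == k ⟧ (B i x y))) ⟩
      ι ⟦ i == k ⟧ ℚ.* ι (B i x y) ℚ.* r
        ≡⟨ ℚₚ.*-assoc (ι ⟦ i == k ⟧) (ι (B i x y)) r ⟩
      ι ⟦ i == k ⟧ ℚ.* E i x y
        ≡⟨ cong (ℚ._* E i x y) (sym (δ≡ι i k)) ⟩
      δ i k ℚ.* E i x y ∎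
      where
      interchange : ∀ a b c d → a ℚ.* b ℚ.* (c ℚ.* d) ≡ a ℚ.* c ℚ.* (b ℚ.* d)
      interchange a b c d = trans (ℚₚ.*-assoc a b (c ℚ.* d)) (trans (cong (a ℚ.*_)
        (trans (sym (ℚₚ.*-assoc b c d)) (trans (cong (ℚ._* d) (ℚₚ.*-comm b c)) (ℚₚ.*-assoc c b d))))
        (sym (ℚₚ.*-assoc a c (b ℚ.* d))))

    A≡PE : ∀ j x y → adjacency R j x y ≡ Σℚ (λ i → ι (P i j) ℚ.* E i x y)
    A≡PE j x y = sym (begin
      Σℚ (λ i → ι (P i j) ℚ.* E i x y)
        ≡⟨ Σℚ-cong (λ i → trans (sym (ℚₚ.*-assoc (ι (P i j)) (ι (B i x y)) r))
             (cong (ℚ._* r) (trans (ℚₚ.*-comm (ι (P i j)) (ι (B i x y))) (sym (ι-* (B i x y) (P i j)))))) ⟩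
      Σℚ (λ i → ι (B i x y * P i j) ÷ n)
        ≡⟨ ÷-distrib (λ i → B i x y * P i j) ⟩
      ι (∑F (λ i → B i x y * P i j)) ÷ n
        ≡⟨ cong (λ a → ι a ÷ n) (BP j x y) ⟩
      ι (+ n * ⟦ R j x y ⟧) ÷ n
        ≡⟨ trans (ι-÷ n ⟦ R j x y ⟧) (sym (adjacency≡ι R j x y)) ⟩
      adjacency R j x y ∎)

    -- Column 0 of P is constant 1, so Σ E_i is the expansion of A₀, the identity matrix.
    resolution : ∀ x y → Σℚ (λ i → E i x y) ≡ δ x y
    resolution x y = begin
      Σℚ (λ i → E i x y)                           ≡⟨ ÷-distrib (λ i → B i x y) ⟩
      ι (∑F (λ i → B i x y)) ÷ n                   ≡⟨ cong (λ a → ι a ÷ n) (∑-cong (allFin 4) {λ i → B i x y} λ i →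
                                                        trans (sym (ℤₚ.*-identityʳ (B i x y))) (cong (_*_ (B i x y)) (sym (P-col₀ i)))) ⟩
      ι (∑F (λ i → B i x y * P i zero)) ÷ n        ≡⟨ cong (λ a → ι a ÷ n) (BP zero x y) ⟩
      ι (+ n * ⟦ R zero x y ⟧) ÷ n                 ≡⟨ ι-÷ n ⟦ R zero x y ⟧ ⟩
      ι ⟦ R zero x y ⟧                             ≡⟨ cong (λ b → ι ⟦ b ⟧) (trans (R-cls zero x y) diag) ⟩
      ι ⟦ x == y ⟧                                 ≡⟨ sym (δ≡ι x y) ⟩
      δ x y ∎
      where
      diag : (cls x y == zero) ≡ (x == y)
      diag with x Fin.≟ y | cls x y in eq
      ... | yes refl | c     = cong (_== zero) (trans (sym eq) (cls-diag x))
      ... | no x≢y   | zero  = contradiction (cls-zero x y eq) x≢y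
      ... | no x≢y   | suc c = refl

    nE≡QA : ∀ j x y → ιℚ n ℚ.* E j x y ≡ Σℚ (λ i → ι (Q i j) ℚ.* adjacency R i x y)
    nE≡QA j x y = begin
      ι (+ n) ℚ.* (ι (B j x y) ℚ.* r)
        ≡⟨ trans (sym (ℚₚ.*-assoc (ι (+ n)) (ι (B j x y)) r)) (trans (cong (ℚ._* r) (sym (ι-* (+ n) (B j x y)))) (ι-÷ n (B j x y))) ⟩
      ι (B j x y)
        ≡⟨ cong ι (trans (B≡Q j x y) (sym (∑F-== (λ i → Q i j) (cls x y)))) ⟩
      ι (∑F (λ i → ⟦ cls x y == i ⟧ * Q i j))
        ≡⟨ sym (Σℚ-ι (λ i → ⟦ cls x y == i ⟧ * Q i j)) ⟩
      Σℚ (λ i → ι (⟦ cls x y == i ⟧ * Q i j))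
        ≡⟨ Σℚ-cong (λ i → trans (cong ι (ℤₚ.*-comm ⟦ cls x y == i ⟧ (Q i j)))
             (trans (ι-* (Q i j) ⟦ cls x y == i ⟧) (cong (ι (Q i j) ℚ.*_)
             (trans (cong (λ b → ι ⟦ b ⟧) (sym (R-cls i x y))) (sym (adjacency≡ι R i x y)))))) ⟩
      Σℚ (λ i → ι (Q i j) ℚ.* adjacency R i x y) ∎

-- Words and the dot product

dot-+ˡ : ∀ {n} (x y z : Word n) → dot (x +w y) z ≡ dot x z ⊕ dot y z
dot-+ˡ []      []      []      = refl
dot-+ˡ (a ∷ x) (b ∷ y) (c ∷ z) = trans (cong₂ _⊕_ (⊗-distribʳ c a b) (dot-+ˡ x y z))
                                       (⊕-interchange (a ⊗ c) (b ⊗ c) _ _)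

dot-comm : ∀ {n} (x y : Word n) → dot x y ≡ dot y x
dot-comm x y = cong sum₄ (Vecₚ.zipWith-comm ⊗-comm x y)

dot-+ʳ : ∀ {n} (x y z : Word n) → dot x (y +w z) ≡ dot x y ⊕ dot x z
dot-+ʳ x y z = trans (dot-comm x (y +w z)) (trans (dot-+ˡ y z x) (cong₂ _⊕_ (dot-comm y x) (dot-comm z x)))

dot-negˡ : ∀ {n} (x y : Word n) → dot (-w x) y ≡ neg₄ (dot x y)
dot-negˡ []      []      = refl
dot-negˡ (a ∷ x) (b ∷ y) = trans (cong₂ _⊕_ (neg-⊗ˡ a b) (dot-negˡ x y)) (sym (neg-⊕ (a ⊗ b) (dot x y)))

dot-negʳ : ∀ {n} (x y : Word n) → dot x (-w y) ≡ neg₄ (dot x y)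
dot-negʳ x y = trans (dot-comm x (-w y)) (trans (dot-negˡ y x) (cong neg₄ (dot-comm y x)))

dot--ˡ : ∀ {n} (x y z : Word n) → dot (x -w y) z ≡ dot x z ⊕ neg₄ (dot y z)
dot--ˡ x y z = trans (dot-+ˡ x (-w y) z) (cong (dot x z ⊕_) (dot-negˡ y z))

dot--ʳ : ∀ {n} (x y z : Word n) → dot x (y -w z) ≡ dot x y ⊕ neg₄ (dot x z)
dot--ʳ x y z = trans (dot-+ʳ x y (-w z)) (cong (dot x y ⊕_) (dot-negʳ x z))

dot-zeroˡ : ∀ {n} (x : Word n) → dot 0w x ≡ z0
dot-zeroˡ []      = refl
dot-zeroˡ (a ∷ x) = dot-zeroˡ x

dot-zeroʳ : ∀ {n} (x : Word n) → dot x 0w ≡ z0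
dot-zeroʳ x = trans (dot-comm x 0w) (dot-zeroˡ x)

dot-·w : ∀ {n} a (x y : Word n) → dot x (a ·w y) ≡ a ⊗ dot x y
dot-·w a []      []      = sym (⊗-zeroʳ a)
dot-·w a (b ∷ x) (c ∷ y) = trans (cong₂ _⊕_ (⊗-swap b a c) (dot-·w a x y)) (sym (⊗-distribˡ a (b ⊗ c) _))

dot-unit : ∀ {n} (x : Word n) j → dot x (unit j) ≡ lookup x j
dot-unit (a ∷ x) zero    = trans (cong₂ _⊕_ (⊗-comm a z1) (trans (cong (dot x) (tabulate-const _)) (dot-zeroʳ x))) (⊕-identityʳ a)
  where
  tabulate-const : ∀ n → tabulate {n = n} (λ _ → z0) ≡ 0w
  tabulate-const zero    = refl
  tabulate-const (suc n) = cong (z0 ∷_) (tabulate-const n)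
dot-unit (a ∷ x) (suc j) = trans (cong (_⊕ dot x (unit j)) (⊗-zeroʳ a)) (dot-unit x j)

-w-inverse : ∀ {n} (x : Word n) → x -w x ≡ 0w
-w-inverse []      = refl
-w-inverse (a ∷ x) = cong₂ _∷_ (⊕-inverseʳ a) (-w-inverse x)

-w-identityʳ : ∀ {n} (x : Word n) → x -w 0w ≡ x
-w-identityʳ []      = refl
-w-identityʳ (a ∷ x) = cong₂ _∷_ (⊕-identityʳ a) (-w-identityʳ x)

-w≡0⇒≡ : ∀ {n} (x y : Word n) → x -w y ≡ 0w → x ≡ y
-w≡0⇒≡ []      []      _ = refl
-w≡0⇒≡ (a ∷ x) (b ∷ y) e = cong₂ _∷_ (⊖≡0⇒≡ a b (Vecₚ.∷-injectiveˡ e)) (-w≡0⇒≡ x y (Vecₚ.∷-injectiveʳ e))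

+w-cancel : ∀ {n} (x y : Word n) → x +w (y -w x) ≡ y
+w-cancel []      []      = refl
+w-cancel (a ∷ x) (b ∷ y) = cong₂ _∷_ (lemma a b) (+w-cancel x y)
  where
  lemma : ∀ a b → a ⊕ (b ⊕ neg₄ a) ≡ b
  lemma = from-yes (all₄? λ a → all₄? λ b → a ⊕ (b ⊕ neg₄ a) ≈? b)

+w-cancelˡ : ∀ {n} (x y : Word n) → (x +w y) -w x ≡ y
+w-cancelˡ []      []      = refl
+w-cancelˡ (a ∷ x) (b ∷ y) = cong₂ _∷_ (lemma a b) (+w-cancelˡ x y)
  where
  lemma : ∀ a b → (a ⊕ b) ⊕ neg₄ a ≡ b
  lemma = from-yes (all₄? λ a → all₄? λ b → (a ⊕ b) ⊕ neg₄ a ≈? b)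

-- The eigenmatrices over ℤ

-- With u = √N / 2 the entries of both eigenmatrices are integral polynomials in u.
private
  uₚ : Polynomial 1
  uₚ = var zero

Ppoly : Fin 4 → Fin 4 → Polynomial 1
Ppoly zero zero = con 1ℤ
Ppoly zero (suc zero) = (uₚ :* uₚ :- uₚ) :* (con (+ 2) :* (uₚ :* uₚ) :- con 1ℤ)
Ppoly zero (suc (suc zero)) = (uₚ :* uₚ :+ uₚ) :* (con (+ 2) :* (uₚ :* uₚ) :- con 1ℤ)
Ppoly zero (suc (suc (suc zero))) = con (+ 2) :* (uₚ :* uₚ) :- con 1ℤ
Ppoly (suc zero) zero = con 1ℤ
Ppoly (suc zero) (suc zero) = :- (uₚ :* uₚ :* uₚ :- uₚ)
Ppoly (suc zero) (suc (suc zero)) = uₚ :* uₚ :* uₚ :- uₚ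
Ppoly (suc zero) (suc (suc (suc zero))) = :- con 1ℤ
Ppoly (suc (suc zero)) zero = con 1ℤ
Ppoly (suc (suc zero)) (suc zero) = uₚ
Ppoly (suc (suc zero)) (suc (suc zero)) = :- uₚ
Ppoly (suc (suc zero)) (suc (suc (suc zero))) = :- con 1ℤ
Ppoly (suc (suc (suc zero))) zero = con 1ℤ
Ppoly (suc (suc (suc zero))) (suc zero) = :- (uₚ :* uₚ :- uₚ)
Ppoly (suc (suc (suc zero))) (suc (suc zero)) = :- (uₚ :* uₚ :+ uₚ)
Ppoly (suc (suc (suc zero))) (suc (suc (suc zero))) = con (+ 2) :* (uₚ :* uₚ) :- con 1ℤ

Qpoly : Fin 4 → Fin 4 → Polynomial 1
Qpoly zero zero = con 1ℤ
Qpoly zero (suc zero) = con (+ 4) :* (uₚ :* uₚ) :- con (+ 2)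
Qpoly zero (suc (suc zero)) = (con (+ 2) :* (uₚ :* uₚ) :- con 1ℤ) :* (con (+ 2) :* (uₚ :* uₚ) :- con (+ 2))
Qpoly zero (suc (suc (suc zero))) = con (+ 2) :* (uₚ :* uₚ) :- con 1ℤ
Qpoly (suc zero) zero = con 1ℤ
Qpoly (suc zero) (suc zero) = :- (con (+ 2) :* uₚ) :- con (+ 2)
Qpoly (suc zero) (suc (suc zero)) = con (+ 2) :* uₚ :+ con (+ 2)
Qpoly (suc zero) (suc (suc (suc zero))) = :- con 1ℤ
Qpoly (suc (suc zero)) zero = con 1ℤ
Qpoly (suc (suc zero)) (suc zero) = con (+ 2) :* uₚ :- con (+ 2)
Qpoly (suc (suc zero)) (suc (suc zero)) = :- (con (+ 2) :* uₚ) :+ con (+ 2)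
Qpoly (suc (suc zero)) (suc (suc (suc zero))) = :- con 1ℤ
Qpoly (suc (suc (suc zero))) zero = con 1ℤ
Qpoly (suc (suc (suc zero))) (suc zero) = :- con (+ 2)
Qpoly (suc (suc (suc zero))) (suc (suc zero)) = :- (con (+ 2) :* (uₚ :* uₚ)) :+ con (+ 2)
Qpoly (suc (suc (suc zero))) (suc (suc (suc zero))) = con (+ 2) :* (uₚ :* uₚ) :- con 1ℤ

-- q² = 4u⁴, the common order of `Kshort` and A/C.
sizePoly : Polynomial 1
sizePoly = con (+ 4) :* (uₚ :* uₚ :* (uₚ :* uₚ))

-- Outside the blocks that unfold them, the entries are atoms, so later proofs do not normalise
-- polynomials.
opaque
  Pz Qz : ℤ → Fin 4 → Fin 4 → ℤ
  Pz u i j = ⟦ Ppoly i j ⟧ₚ (u ∷ [])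
  Qz u i j = ⟦ Qpoly i j ⟧ₚ (u ∷ [])

  size : ℤ → ℤ
  size u = ⟦ sizePoly ⟧ₚ (u ∷ [])

-- Written in exactly the shape to which `∑F` over four indices unfolds, trailing zero included, so
-- that the solver's conclusion is literally the required equation.
_·ₚ_ : (M M′ : Fin 4 → Fin 4 → Polynomial 1) → Fin 4 → Fin 4 → Polynomial 1
(M ·ₚ M′) c k = M c zero :* M′ zero k :+ (M c (suc zero) :* M′ (suc zero) k :+
  (M c (suc (suc zero)) :* M′ (suc (suc zero)) k :+ (M c (suc (suc (suc zero))) :* M′ (suc (suc (suc zero))) k :+ con 0ℤ)))

scalar : Fin 4 → Fin 4 → Polynomial 1
scalar c k = sizePoly :* con ⟦ c == k ⟧

opaque
  unfolding Pz Qz size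

  -- A polynomial identity in u for each entry; the indices are split because the polynomials
  -- compute only at concrete positions.
  QzPz : ∀ u c k → ∑F (λ j → Qz u c j * Pz u j k) ≡ size u * ⟦ c == k ⟧
  QzPz u c@zero k@zero = prove (u ∷ []) ((Qpoly ·ₚ Ppoly) c k) (scalar c k) refl
  QzPz u c@zero k@(suc zero) = prove (u ∷ []) ((Qpoly ·ₚ Ppoly) c k) (scalar c k) refl
  QzPz u c@zero k@(suc (suc zero)) = prove (u ∷ []) ((Qpoly ·ₚ Ppoly) c k) (scalar c k) refl
  QzPz u c@zero k@(suc (suc (suc zero))) = prove (u ∷ []) ((Qpoly ·ₚ Ppoly) c k) (scalar c k) refl
  QzPz u c@(suc zero) k@zero = prove (u ∷ []) ((Qpoly ·ₚ Ppoly) c k) (scalar c k) refl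
  QzPz u c@(suc zero) k@(suc zero) = prove (u ∷ []) ((Qpoly ·ₚ Ppoly) c k) (scalar c k) refl
  QzPz u c@(suc zero) k@(suc (suc zero)) = prove (u ∷ []) ((Qpoly ·ₚ Ppoly) c k) (scalar c k) refl
  QzPz u c@(suc zero) k@(suc (suc (suc zero))) = prove (u ∷ []) ((Qpoly ·ₚ Ppoly) c k) (scalar c k) refl
  QzPz u c@(suc (suc zero)) k@zero = prove (u ∷ []) ((Qpoly ·ₚ Ppoly) c k) (scalar c k) refl
  QzPz u c@(suc (suc zero)) k@(suc zero) = prove (u ∷ []) ((Qpoly ·ₚ Ppoly) c k) (scalar c k) refl
  QzPz u c@(suc (suc zero)) k@(suc (suc zero)) = prove (u ∷ []) ((Qpoly ·ₚ Ppoly) c k) (scalar c k) refl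
  QzPz u c@(suc (suc zero)) k@(suc (suc (suc zero))) = prove (u ∷ []) ((Qpoly ·ₚ Ppoly) c k) (scalar c k) refl
  QzPz u c@(suc (suc (suc zero))) k@zero = prove (u ∷ []) ((Qpoly ·ₚ Ppoly) c k) (scalar c k) refl
  QzPz u c@(suc (suc (suc zero))) k@(suc zero) = prove (u ∷ []) ((Qpoly ·ₚ Ppoly) c k) (scalar c k) refl
  QzPz u c@(suc (suc (suc zero))) k@(suc (suc zero)) = prove (u ∷ []) ((Qpoly ·ₚ Ppoly) c k) (scalar c k) refl
  QzPz u c@(suc (suc (suc zero))) k@(suc (suc (suc zero))) = prove (u ∷ []) ((Qpoly ·ₚ Ppoly) c k) (scalar c k) refl

  PzQz : ∀ u c k → ∑F (λ j → Pz u c j * Qz u j k) ≡ size u * ⟦ c == k ⟧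
  PzQz u c@zero k@zero = prove (u ∷ []) ((Ppoly ·ₚ Qpoly) c k) (scalar c k) refl
  PzQz u c@zero k@(suc zero) = prove (u ∷ []) ((Ppoly ·ₚ Qpoly) c k) (scalar c k) refl
  PzQz u c@zero k@(suc (suc zero)) = prove (u ∷ []) ((Ppoly ·ₚ Qpoly) c k) (scalar c k) refl
  PzQz u c@zero k@(suc (suc (suc zero))) = prove (u ∷ []) ((Ppoly ·ₚ Qpoly) c k) (scalar c k) refl
  PzQz u c@(suc zero) k@zero = prove (u ∷ []) ((Ppoly ·ₚ Qpoly) c k) (scalar c k) refl
  PzQz u c@(suc zero) k@(suc zero) = prove (u ∷ []) ((Ppoly ·ₚ Qpoly) c k) (scalar c k) refl
  PzQz u c@(suc zero) k@(suc (suc zero)) = prove (u ∷ []) ((Ppoly ·ₚ Qpoly) c k) (scalar c k) refl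
  PzQz u c@(suc zero) k@(suc (suc (suc zero))) = prove (u ∷ []) ((Ppoly ·ₚ Qpoly) c k) (scalar c k) refl
  PzQz u c@(suc (suc zero)) k@zero = prove (u ∷ []) ((Ppoly ·ₚ Qpoly) c k) (scalar c k) refl
  PzQz u c@(suc (suc zero)) k@(suc zero) = prove (u ∷ []) ((Ppoly ·ₚ Qpoly) c k) (scalar c k) refl
  PzQz u c@(suc (suc zero)) k@(suc (suc zero)) = prove (u ∷ []) ((Ppoly ·ₚ Qpoly) c k) (scalar c k) refl
  PzQz u c@(suc (suc zero)) k@(suc (suc (suc zero))) = prove (u ∷ []) ((Ppoly ·ₚ Qpoly) c k) (scalar c k) refl
  PzQz u c@(suc (suc (suc zero))) k@zero = prove (u ∷ []) ((Ppoly ·ₚ Qpoly) c k) (scalar c k) refl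
  PzQz u c@(suc (suc (suc zero))) k@(suc zero) = prove (u ∷ []) ((Ppoly ·ₚ Qpoly) c k) (scalar c k) refl
  PzQz u c@(suc (suc (suc zero))) k@(suc (suc zero)) = prove (u ∷ []) ((Ppoly ·ₚ Qpoly) c k) (scalar c k) refl
  PzQz u c@(suc (suc (suc zero))) k@(suc (suc (suc zero))) = prove (u ∷ []) ((Ppoly ·ₚ Qpoly) c k) (scalar c k) refl

  Pz-col₀ : ∀ u j → Pz u j zero ≡ 1ℤ
  Pz-col₀ u zero = refl
  Pz-col₀ u (suc zero) = refl
  Pz-col₀ u (suc (suc zero)) = refl
  Pz-col₀ u (suc (suc (suc zero))) = refl

  Qz-col₀ : ∀ u j → Qz u j zero ≡ 1ℤ
  Qz-col₀ u zero = refl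
  Qz-col₀ u (suc zero) = refl
  Qz-col₀ u (suc (suc zero)) = refl
  Qz-col₀ u (suc (suc (suc zero))) = refl

-- Character sums and duality

-- W j lists the words in the definition of R′_j.
W : ∀ {n} → Fin 4 → List (Word n)
W zero                   = 0w ∷ []
W (suc zero)             = List.map unit (allFin _) ++ List.map (λ j → -w unit j) (allFin _)
W (suc (suc zero))       = concatMap (λ j → concatMap (λ k →
  if toℕ j ≡ᵇ toℕ k then [] else (unit j -w unit k) ∷ []) (allFin _)) (allFin _)
W (suc (suc (suc zero))) = List.map (λ j → z2 ·w unit j) (allFin _)

-- Extending the summand by 0 to the diagonal turns the sum over j ≠ k into a full double sum, which
-- then factorises.
∑-W₂ : ∀ {n} (f : Word n → ℤ) (g : Fin n → Fin n → ℤ) →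
  (∀ j → g j j ≡ 0ℤ) → (∀ j k → j ≢ k → f (unit j -w unit k) ≡ g j k) →
  ∑ (W (suc (suc zero))) f ≡ ∑F (λ j → ∑F (g j))
∑-W₂ {n} f g diag off = trans (∑-concatMap outer (allFin n) f)
  (∑-cong (allFin n) λ j → trans (∑-concatMap (inner j) (allFin n) f) (∑-cong (allFin n) (entries j)))
  where
  inner : Fin n → Fin n → List (Word n)
  inner j k = if toℕ j ≡ᵇ toℕ k then [] else (unit j -w unit k) ∷ []
  outer : Fin n → List (Word n)
  outer j = concatMap (inner j) (allFin n)
  entries : ∀ j k → ∑ (inner j k) f ≡ g j k
  entries j k with toℕ j ≡ᵇ toℕ k in e
  ... | false = trans (ℤₚ.+-identityʳ _) (off j k λ { refl → contradiction (trans (sym e) (≡ᵇ-refl (toℕ j))) λ () })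
    where
    ≡ᵇ-refl : ∀ a → (a ≡ᵇ a) ≡ true
    ≡ᵇ-refl zero    = refl
    ≡ᵇ-refl (suc a) = ≡ᵇ-refl a
  ... | true with Finₚ.toℕ-injective (ℕₚ.≡ᵇ⇒≡ (toℕ j) (toℕ k) (subst T (sym e) _))
  ...   | refl = sym (diag j)

Sre Sim : ∀ {n} → Word n → ℤ
Sre d = ∑F (λ j → re (lookup d j))
Sim d = ∑F (λ j → im (lookup d j))

Sdouble : ∀ {n} → Word n → ℤ
Sdouble d = ∑F (λ j → re (lookup d j ⊕ lookup d j))

-- Real and imaginary part of the character sum of `d` over the words of `W j`.
Φ Ψ : ∀ {n} → Fin 4 → Word n → ℤ
Φ j d = ∑ (W j) (λ w → re (dot d w))
Ψ j d = ∑ (W j) (λ w → im (dot d w))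

module _ {n} (d : Word n) where

  private
    dot-±unit : ∀ (f : ℤ₄ → ℤ) →
      ∑ (W (suc zero)) (λ w → f (dot d w)) ≡ ∑F (λ j → f (lookup d j)) + ∑F (λ j → f (neg₄ (lookup d j)))
    dot-±unit f = trans (∑-++ (List.map unit (allFin n)) (List.map (λ j → -w unit j) (allFin n)) (λ w → f (dot d w)))
      (cong₂ _+_
        (trans (∑-map unit (allFin n) (λ w → f (dot d w))) (∑-cong (allFin n) λ j → cong f (dot-unit d j)))
        (trans (∑-map (λ j → -w unit j) (allFin n) (λ w → f (dot d w)))
               (∑-cong (allFin n) λ j → cong f (trans (dot-negʳ d (unit j)) (cong neg₄ (dot-unit d j))))))

    dot-difference : ∀ j k → dot d (unit j -w unit k) ≡ lookup d j ⊕ neg₄ (lookup d k)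
    dot-difference j k = trans (dot--ʳ d (unit j) (unit k))
      (cong₂ (λ a b → a ⊕ neg₄ b) (dot-unit d j) (dot-unit d k))

    dot-2unit : ∀ (f : ℤ₄ → ℤ) →
      ∑ (W (suc (suc (suc zero)))) (λ w → f (dot d w)) ≡ ∑F (λ j → f (lookup d j ⊕ lookup d j))
    dot-2unit f = trans (∑-map (λ j → z2 ·w unit j) (allFin n) (λ w → f (dot d w)))
      (∑-cong (allFin n) λ j → cong f (trans (dot-·w z2 d (unit j)) (cong (z2 ⊗_) (dot-unit d j))))

  Φ₀ : Φ zero d ≡ 1ℤ
  Φ₀ = trans (ℤₚ.+-identityʳ _) (cong re (dot-zeroʳ d))

  Φ₁ : Φ (suc zero) d ≡ + 2 * Sre d
  Φ₁ = trans (dot-±unit re) (trans (cong (_+_ (Sre d)) (∑-cong (allFin n) λ j → re-neg (lookup d j))) (double (Sre d)))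
    where
    re-neg : ∀ a → re (neg₄ a) ≡ re a
    re-neg = from-yes (all₄? λ a → re (neg₄ a) ℤ.≟ re a)
    double : ∀ a → a + a ≡ + 2 * a
    double = solve-∀

  -- The full double sum of i^(d_j - d_k) is |S|² for S = Σ i^(d_j); the n diagonal terms are taken
  -- off.
  Φ₂ : Φ (suc (suc zero)) d ≡ Sre d * Sre d + Sim d * Sim d - + n
  Φ₂ = begin
    Φ (suc (suc zero)) d
      ≡⟨ ∑-W₂ (λ w → re (dot d w)) g diag (λ j k j≢k → trans (cong re (dot-difference j k)) (off j k j≢k)) ⟩
    ∑F (λ j → ∑F (g j))
      ≡⟨ ∑-cong (allFin n) (λ j → trans (∑-+ (allFin n) (h j) (λ k → - ⟦ j == k ⟧))
           (cong (_+_ (∑F (h j))) (trans (∑-neg (allFin n) (λ k → ⟦ j == k ⟧)) (cong -_ (one j))))) ⟩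
    ∑F (λ j → ∑F (h j) + - 1ℤ)
      ≡⟨ ∑-+ (allFin n) (λ j → ∑F (h j)) (λ _ → - 1ℤ) ⟩
    ∑F (λ j → ∑F (h j)) + ∑F {n} (λ _ → - 1ℤ)
      ≡⟨ cong₂ _+_ (∑-norm (allFin n) (lookup d)) (trans (∑-neg (allFin n) (λ _ → 1ℤ)) (cong -_ (∑F-1 n))) ⟩
    Sre d * Sre d + Sim d * Sim d - + n ∎
    where
    open ≡-Reasoning
    h g : Fin n → Fin n → ℤ
    h j k = re (lookup d j ⊕ neg₄ (lookup d k))
    g j k = h j k - ⟦ j == k ⟧
    one : ∀ j → ∑F (λ k → ⟦ j == k ⟧) ≡ 1ℤ
    one j = trans (∑-cong (allFin n) λ k → sym (ℤₚ.*-identityʳ ⟦ j == k ⟧)) (∑F-== (λ _ → 1ℤ) j)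
    diag : ∀ j → g j j ≡ 0ℤ
    diag j = cong₂ _-_ (cong re (⊕-inverseʳ (lookup d j))) (cong ⟦_⟧ (==-refl j))
    off : ∀ j k → j ≢ k → h j k ≡ g j k
    off j k j≢k with j Fin.≟ k
    ... | yes j≡k = contradiction j≡k j≢k
    ... | no  _   = sym (ℤₚ.+-identityʳ (h j k))

  Φ₃ : Φ (suc (suc (suc zero))) d ≡ Sdouble d
  Φ₃ = dot-2unit re

  -- Each `W j` is closed under negation: e_j - e_k is exchanged with e_k - e_j, and 2 e_j is its
  -- own negative. No condition on `d` enters, so the lemma also applies to sums of words.
  Ψ≡0 : ∀ j → Ψ j d ≡ 0ℤ
  Ψ≡0 zero = trans (ℤₚ.+-identityʳ _) (cong im (dot-zeroʳ d))
  Ψ≡0 (suc zero) = trans (dot-±unit im) (trans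
    (cong (_+_ (Sim d)) (trans (∑-cong (allFin n) λ j → im-neg (lookup d j)) (∑-neg (allFin n) (λ j → im (lookup d j)))))
    (ℤₚ.+-inverseʳ (Sim d)))
    where
    im-neg : ∀ a → im (neg₄ a) ≡ - im a
    im-neg = from-yes (all₄? λ a → im (neg₄ a) ℤ.≟ - im a)
  Ψ≡0 (suc (suc zero)) = begin
    Ψ (suc (suc zero)) d
      ≡⟨ ∑-W₂ (λ w → im (dot d w)) g (λ j → cong im (⊕-inverseʳ (lookup d j))) (λ j k _ → cong im (dot-difference j k)) ⟩
    ∑F (λ j → ∑F (g j))
      ≡⟨ ∑-cong (allFin n) (λ j → trans (∑-cong (allFin n) λ k → im-⊖ (lookup d j) (lookup d k))
           (∑-+ (allFin n) (λ k → im (lookup d j) * re (lookup d k)) (λ k → - (re (lookup d j) * im (lookup d k))))) ⟩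
    ∑F (λ j → ∑F (λ k → im (lookup d j) * re (lookup d k)) + ∑F (λ k → - (re (lookup d j) * im (lookup d k))))
      ≡⟨ ∑-+ (allFin n) (λ j → ∑F (λ k → im (lookup d j) * re (lookup d k))) (λ j → ∑F (λ k → - (re (lookup d j) * im (lookup d k)))) ⟩
    ∑F (λ j → ∑F (λ k → im (lookup d j) * re (lookup d k))) + ∑F (λ j → ∑F (λ k → - (re (lookup d j) * im (lookup d k))))
      ≡⟨ cong₂ _+_ (sym (∑-* (allFin n) (allFin n) (λ j → im (lookup d j)) (λ k → re (lookup d k))))
           (trans (∑-cong (allFin n) λ j → ∑-neg (allFin n) (λ k → re (lookup d j) * im (lookup d k)))
           (trans (∑-neg (allFin n) (λ j → ∑F (λ k → re (lookup d j) * im (lookup d k))))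
             (cong -_ (sym (∑-* (allFin n) (allFin n) (λ j → re (lookup d j)) (λ k → im (lookup d k))))))) ⟩
    Sim d * Sre d - Sre d * Sim d
      ≡⟨ commute (Sim d) (Sre d) ⟩
    0ℤ ∎
    where
    open ≡-Reasoning
    g : Fin n → Fin n → ℤ
    g j k = im (lookup d j ⊕ neg₄ (lookup d k))
    commute : ∀ a b → a * b - b * a ≡ 0ℤ
    commute = solve-∀
  Ψ≡0 (suc (suc (suc zero))) = trans (dot-2unit im)
    (trans (∑-cong (allFin n) λ j → im-double (lookup d j)) (∑-0 (allFin n)))
    where
    im-double : ∀ a → im (a ⊕ a) ≡ 0ℤ
    im-double = from-yes (all₄? λ a → im (a ⊕ a) ℤ.≟ 0ℤ)

∑-delta-list : ∀ {A : Set} (xs : List A) → (∀ a b → List.lookup xs a ≡ List.lookup xs b → a ≡ b) →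
  (p : A → Bool) (f : A → ℤ) {x : A} → x ∈ xs → p x ≡ true → (∀ y → p y ≡ true → y ≡ x) →
  ∑ xs (λ y → ⟦ p y ⟧ * f y) ≡ f x
∑-delta-list xs inj p f {x} x∈ px uniq = trans (sym (∑F-lookup xs (λ y → ⟦ p y ⟧ * f y)))
  (trans (∑F-delta (p ∘ List.lookup xs) (f ∘ List.lookup xs) (Any.index x∈)
    (trans (cong p (sym x≡)) px) (λ b pb → inj b (Any.index x∈) (trans (uniq _ pb) x≡)))
    (cong f (sym x≡)))
  where
  x≡ : x ≡ List.lookup xs (Any.index x∈)
  x≡ = Anyₚ.lookup-index x∈

-- Pick an index c where b holds. Then ⟦ b j ⟧ - ⟦ c == j ⟧ is nonnegative with total 0, hence zero
-- throughout.
indicator-class : (b : Fin 4 → Bool) → ∑F (⟦_⟧ ∘ b) ≡ 1ℤ → ∃ λ c → ∀ j → b j ≡ (c == j)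
indicator-class b e with ∑≢0⇒∃ (allFin 4) {⟦_⟧ ∘ b} (λ z → contradiction (trans (sym e) z) λ ())
... | c , _ , bc≢0 = c , λ j → sym (agree j)
  where
  bc : b c ≡ true
  bc with b c
  ... | true  = refl
  ... | false = contradiction refl bc≢0
  excess : Fin 4 → ℤ
  excess j = ⟦ b j ⟧ - ⟦ c == j ⟧
  excess-nonNeg : ∀ j → 0ℤ ℤ.≤ excess j
  excess-nonNeg j with c Fin.≟ j
  ... | yes refl = subst (λ b → 0ℤ ℤ.≤ ⟦ b ⟧ - 1ℤ) (sym bc) ℤₚ.≤-refl
  ... | no  _    = subst (0ℤ ℤ.≤_) (sym (ℤₚ.+-identityʳ ⟦ b j ⟧)) (⟦⟧-nonNeg (b j))
  total : ∑F excess ≡ 0ℤ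
  total = trans (∑-+ (allFin 4) (⟦_⟧ ∘ b) (λ j → - ⟦ c == j ⟧))
    (cong₂ _+_ e (trans (∑-neg (allFin 4) (λ j → ⟦ c == j ⟧)) (cong -_
      (trans (∑-cong (allFin 4) λ j → sym (ℤₚ.*-identityʳ ⟦ c == j ⟧)) (∑F-== (λ _ → 1ℤ) c)))))
  agree : ∀ j → (c == j) ≡ b j
  agree j = ⟦⟧-injective (sym (ℤₚ.i-j≡0⇒i≡j ⟦ b j ⟧ ⟦ c == j ⟧ (ℤₚ.≤-antisym
    (subst (excess j ℤ.≤_) total (∑-term≤ excess-nonNeg (∈ₚ.∈-allFin j))) (excess-nonNeg j))))

-- Through Φ₁, Φ₂, Φ₃ this says that the character sums of d over the lists W j form row c of Q.
record Type (u : ℤ) {n} (c : Fin 4) (d : Word n) : Set where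
  field
    single : + 2 * Sre d ≡ Qz u c (suc zero)
    pairs  : Sre d * Sre d + Sim d * Sim d - + n ≡ Qz u c (suc (suc zero))
    double : Sdouble d ≡ Qz u c (suc (suc (suc zero)))

Φ≡Q : ∀ {u n c} {d : Word n} → Type u c d → ∀ j → Φ j d ≡ Qz u c j
Φ≡Q {u} {c = c} {d} t zero          = trans (Φ₀ d) (sym (Qz-col₀ u c))
Φ≡Q {d = d} t (suc zero)             = trans (Φ₁ d) (Type.single t)
Φ≡Q {d = d} t (suc (suc zero))       = trans (Φ₂ d) (Type.pairs t)
Φ≡Q {d = d} t (suc (suc (suc zero))) = trans (Φ₃ d) (Type.double t)

-- The coding theory enters through three facts: the type of every word of `Ks`, the bound `large`,
-- and `inC` as the annihilator of `Ks`. The rest of the hypotheses describe enumerations and class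
-- predicates.
module Duality
  (n : ℕ) (u : ℤ) (size>0 : 0ℤ ℤ.< size u)
  (P-row₀≢0 : ∀ j → Pz u zero j ≢ 0ℤ) (Q-row₀≢0 : ∀ j → Qz u zero j ≢ 0ℤ)
  (Ks : List (Word n)) (Ks-injective : ∀ a b → List.lookup Ks a ≡ List.lookup Ks b → a ≡ b)
  (0∈Ks : 0w ∈ Ks)
  (+∈Ks : ∀ {x y} → x ∈ Ks → y ∈ Ks → (x +w y) ∈ Ks)
  (-∈Ks : ∀ {x y} → x ∈ Ks → y ∈ Ks → (x -w y) ∈ Ks)
  (types : ∀ {x} → x ∈ Ks → ∃ λ c → Type u c x)
  (type-zero : ∀ {c} {x : Word n} → Type u c x → (c ≡ zero → x ≡ 0w) × (x ≡ 0w → c ≡ zero))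
  (large : size u ℤ.≤ + List.length Ks)
  (inC : Word n → Bool)
  (inC⇒⊥ : ∀ {w} → inC w ≡ true → ∀ {x} → x ∈ Ks → dot x w ≡ z0)
  (⊥⇒inC : ∀ {w} → (∀ {x} → x ∈ Ks → dot x w ≡ z0) → inC w ≡ true)
  (reps : List (Word n))
  (reps-injective : ∀ a b → inC (List.lookup reps a -w List.lookup reps b) ≡ true → a ≡ b)
  (reps-cover : ∀ w → ∃ λ a → inC (List.lookup reps a -w w) ≡ true)
  (classK classA : Fin 4 → Word n → Bool)
  (classK-type : ∀ {c d} → Type u c d → ∀ j → classK j d ≡ (c == j))
  (classA⇒ : ∀ j {d} → classA j d ≡ true → ∃ λ w → w ∈ W j × inC (d -w w) ≡ true)
  (⇒classA : ∀ j {d w} → w ∈ W j → inC (d -w w) ≡ true → classA j d ≡ true)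
  where

  open ≡-Reasoning

  nK nA : ℕ
  nK = List.length Ks
  nA = List.length reps

  X : Fin nK → Word n
  X = List.lookup Ks

  Y : Fin nA → Word n
  Y = List.lookup reps

  P Q : Fin 4 → Fin 4 → ℤ
  P = Pz u
  Q = Qz u

  X∈ : ∀ a → X a ∈ Ks
  X∈ a = ∈ₚ.∈-lookup a

  tp : Fin nK → Fin 4
  tp a = proj₁ (types (X∈ a))

  tp-type : ∀ a → Type u (tp a) (X a)
  tp-type a = proj₂ (types (X∈ a))

  -- Translation permutes `Ks`. The sums run over a list, so the permutation appears as double
  -- counting of the pairs with x₀ + x = z.
  translate : ∀ {x₀} → x₀ ∈ Ks → (f : Word n → ℤ) → ∑ Ks (λ x → f (x₀ +w x)) ≡ ∑ Ks f
  translate {x₀} x₀∈ f = begin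
    ∑ Ks (λ x → f (x₀ +w x))
      ≡⟨ ∑-cong-∈ Ks (λ x x∈ → sym (∑-delta-list Ks Ks-injective (p x) f (+∈Ks x₀∈ x∈)
           (true! (x₀ +w x) _ refl) λ z e → sym (sound (x₀ +w x) z e))) ⟩
    ∑ Ks (λ x → ∑ Ks (λ z → ⟦ p x z ⟧ * f z))
      ≡⟨ ∑-swap Ks Ks (λ x z → ⟦ p x z ⟧ * f z) ⟩
    ∑ Ks (λ z → ∑ Ks (λ x → ⟦ p x z ⟧ * f z))
      ≡⟨ ∑-cong-∈ Ks (λ z z∈ → ∑-delta-list Ks Ks-injective (λ x → p x z) (λ _ → f z) (-∈Ks z∈ x₀∈)
           (true! (x₀ +w (z -w x₀)) z (+w-cancel x₀ z))
           λ x e → trans (sym (+w-cancelˡ x₀ x)) (cong (_-w x₀) (sound (x₀ +w x) z e))) ⟩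
    ∑ Ks f ∎
    where
    p : Word n → Word n → Bool
    p x z = does ((x₀ +w x) ≟w z)
    true! : ∀ x z → x ≡ z → does (x ≟w z) ≡ true
    true! x z e with x ≟w z
    ... | yes _  = refl
    ... | no x≢z = contradiction e x≢z
    sound : ∀ x z → does (x ≟w z) ≡ true → x ≡ z
    sound x z e with x ≟w z
    ... | yes p = p

  module _ {w x₀} (x₀∈ : x₀ ∈ Ks) (e : dot x₀ w ≡ z2) where

    -- Translation by x₀ adds 2 to every inner product and so changes the sign of the sum.
    ∑-antisymmetric : (f : ℤ₄ → ℤ) → (∀ a → f (z2 ⊕ a) ≡ - f a) → ∑ Ks (λ x → f (dot x w)) ≡ 0ℤ
    ∑-antisymmetric f anti = x≡-x⇒x≡0 _ (begin
      ∑ Ks (λ x → f (dot x w))            ≡⟨ sym (translate x₀∈ (λ x → f (dot x w))) ⟩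
      ∑ Ks (λ x → f (dot (x₀ +w x) w))    ≡⟨ ∑-cong Ks (λ x → trans
                                               (cong f (trans (dot-+ˡ x₀ x w) (cong (_⊕ dot x w) e))) (anti (dot x w))) ⟩
      ∑ Ks (λ x → - f (dot x w))          ≡⟨ ∑-neg Ks (λ x → f (dot x w)) ⟩
      - ∑ Ks (λ x → f (dot x w)) ∎)

  -- An odd inner product becomes 2 on doubling x, so a single sign change serves for real and
  -- imaginary parts alike.
  non-orthogonal : ∀ w → inC w ≡ false → ∃ λ x → x ∈ Ks × dot x w ≡ z2
  non-orthogonal w e with All.all? (λ x → dot x w ≈? z0) Ks
  ... | yes all = contradiction (trans (sym e) (⊥⇒inC (All.lookup all))) λ ()
  ... | no ¬all with find (Allₚ.¬All⇒Any¬ (λ x → dot x w ≈? z0) Ks ¬all)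
  ...   | x , x∈ , ne with dot x w in eq
  ...     | z0 = contradiction refl ne
  ...     | z1 = x +w x , +∈Ks x∈ x∈ , trans (dot-+ˡ x x w) (cong₂ _⊕_ eq eq)
  ...     | z2 = x , x∈ , eq
  ...     | z3 = x +w x , +∈Ks x∈ x∈ , trans (dot-+ˡ x x w) (cong₂ _⊕_ eq eq)

  ∑-re : ∀ w → ∑ Ks (λ x → re (dot x w)) ≡ + nK * ⟦ inC w ⟧
  ∑-re w with inC w in e
  ... | true  = trans (∑-cong-∈ Ks λ x x∈ → cong re (inC⇒⊥ e x∈)) (trans (∑-1 Ks) (sym (ℤₚ.*-identityʳ (+ nK))))
  ... | false with non-orthogonal w e
  ...   | x₀ , x₀∈ , e₀ = trans (∑-antisymmetric x₀∈ e₀ re anti) (sym (ℤₚ.*-zeroʳ (+ nK)))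
    where
    anti : ∀ a → re (z2 ⊕ a) ≡ - re a
    anti = from-yes (all₄? λ a → re (z2 ⊕ a) ℤ.≟ - re a)

  ∑-im : ∀ w → ∑ Ks (λ x → im (dot x w)) ≡ 0ℤ
  ∑-im w with inC w in e
  ... | true  = trans (∑-cong-∈ Ks λ x x∈ → cong im (inC⇒⊥ e x∈)) (∑-0 Ks)
  ... | false with non-orthogonal w e
  ...   | x₀ , x₀∈ , e₀ = ∑-antisymmetric x₀∈ e₀ im anti
    where
    anti : ∀ a → im (z2 ⊕ a) ≡ - im a
    anti = from-yes (all₄? λ a → im (z2 ⊕ a) ℤ.≟ - im a)

  -- How many words of `W j` lie in the coset of `y`.
  multiplicity : Fin 4 → Word n → ℤ
  multiplicity j y = ∑ (W j) (λ w → ⟦ inC (y -w w) ⟧)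

  -- Row `tp a` of Q is the character sum of X a over `W j`. Interchanging the sums leaves, for each
  -- word w, the character sum of y - w over `Ks`, which detects membership in C.
  fourier-re : ∀ j y → ∑F (λ a → re (dot (X a) y) * Q (tp a) j) ≡ + nK * multiplicity j y
  fourier-re j y = begin
    ∑F (λ a → re (dot (X a) y) * Q (tp a) j)
      ≡⟨ ∑-cong (allFin nK) (λ a → expand a) ⟩
    ∑F (λ a → ∑ (W j) (λ w → re (dot (X a) (y -w w))))
      ≡⟨ ∑-swap (allFin nK) (W j) (λ a w → re (dot (X a) (y -w w))) ⟩
    ∑ (W j) (λ w → ∑F (λ a → re (dot (X a) (y -w w))))
      ≡⟨ ∑-cong (W j) (λ w → trans (∑F-lookup Ks (λ x → re (dot x (y -w w)))) (∑-re (y -w w))) ⟩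
    ∑ (W j) (λ w → + nK * ⟦ inC (y -w w) ⟧)
      ≡⟨ ∑-*ˡ (W j) (+ nK) (λ w → ⟦ inC (y -w w) ⟧) ⟩
    + nK * multiplicity j y ∎
    where
    expand : ∀ a → re (dot (X a) y) * Q (tp a) j ≡ ∑ (W j) (λ w → re (dot (X a) (y -w w)))
    expand a = sym (begin
      ∑ (W j) (λ w → re (dot (X a) (y -w w)))
        ≡⟨ ∑-cong (W j) (λ w → trans (cong re (dot--ʳ (X a) y w)) (re-⊖ (dot (X a) y) (dot (X a) w))) ⟩
      ∑ (W j) (λ w → c * re (dot (X a) w) + s * im (dot (X a) w))
        ≡⟨ trans (∑-+ (W j) (λ w → c * re (dot (X a) w)) (λ w → s * im (dot (X a) w)))
             (cong₂ _+_ (∑-*ˡ (W j) c (λ w → re (dot (X a) w))) (∑-*ˡ (W j) s (λ w → im (dot (X a) w)))) ⟩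
      c * Φ j (X a) + s * Ψ j (X a)
        ≡⟨ cong₂ (λ p q → c * p + s * q) (Φ≡Q (tp-type a) j) (Ψ≡0 (X a) j) ⟩
      c * Q (tp a) j + s * 0ℤ
        ≡⟨ trans (cong (_+_ (c * Q (tp a) j)) (ℤₚ.*-zeroʳ s)) (ℤₚ.+-identityʳ _) ⟩
      c * Q (tp a) j ∎)
      where
      c s : ℤ
      c = re (dot (X a) y)
      s = im (dot (X a) y)

  fourier-im : ∀ j y → ∑F (λ a → im (dot (X a) y) * Q (tp a) j) ≡ 0ℤ
  fourier-im j y = begin
    ∑F (λ a → im (dot (X a) y) * Q (tp a) j)
      ≡⟨ ∑-cong (allFin nK) (λ a → expand a) ⟩
    ∑F (λ a → ∑ (W j) (λ w → im (dot (X a) (y -w w))))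
      ≡⟨ ∑-swap (allFin nK) (W j) (λ a w → im (dot (X a) (y -w w))) ⟩
    ∑ (W j) (λ w → ∑F (λ a → im (dot (X a) (y -w w))))
      ≡⟨ ∑-cong (W j) (λ w → trans (∑F-lookup Ks (λ x → im (dot x (y -w w)))) (∑-im (y -w w))) ⟩
    ∑ (W j) (λ _ → 0ℤ)
      ≡⟨ ∑-0 (W j) ⟩
    0ℤ ∎
    where
    expand : ∀ a → im (dot (X a) y) * Q (tp a) j ≡ ∑ (W j) (λ w → im (dot (X a) (y -w w)))
    expand a = sym (begin
      ∑ (W j) (λ w → im (dot (X a) (y -w w)))
        ≡⟨ ∑-cong (W j) (λ w → trans (cong im (dot--ʳ (X a) y w)) (trans (im-⊖ (dot (X a) y) (dot (X a) w))
             (cong (_+_ (s * re (dot (X a) w))) (ℤₚ.neg-distribˡ-* c (im (dot (X a) w)))))) ⟩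
      ∑ (W j) (λ w → s * re (dot (X a) w) + - c * im (dot (X a) w))
        ≡⟨ trans (∑-+ (W j) (λ w → s * re (dot (X a) w)) (λ w → - c * im (dot (X a) w)))
             (cong₂ _+_ (∑-*ˡ (W j) s (λ w → re (dot (X a) w))) (∑-*ˡ (W j) (- c) (λ w → im (dot (X a) w)))) ⟩
      s * Φ j (X a) + - c * Ψ j (X a)
        ≡⟨ cong₂ (λ p q → s * p + - c * q) (Φ≡Q (tp-type a) j) (Ψ≡0 (X a) j) ⟩
      s * Q (tp a) j + - c * 0ℤ
        ≡⟨ trans (cong (_+_ (s * Q (tp a) j)) (ℤₚ.*-zeroʳ (- c))) (ℤₚ.+-identityʳ _) ⟩
      s * Q (tp a) j ∎)
      where
      c s : ℤ
      c = re (dot (X a) y)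
      s = im (dot (X a) y)

  Q-row-sum : ∀ c → ∑F (Q c) ≡ size u * ⟦ c == zero ⟧
  Q-row-sum c = trans (∑-cong (allFin 4) {Q c} λ j → trans (sym (ℤₚ.*-identityʳ (Q c j))) (cong (_*_ (Q c j)) (sym (Pz-col₀ u j))))
    (QzPz u c zero)

  total : Word n → ℤ
  total y = ∑F (λ j → multiplicity j y)

  -- Summing the Fourier formula over j brings in the row sums of Q, which vanish for every type but
  -- `zero`; only x = 0 contributes, whatever y is.
  nK*total : ∀ y → + nK * total y ≡ size u
  nK*total y = begin
    + nK * total y
      ≡⟨ sym (∑-*ˡ (allFin 4) (+ nK) (λ j → multiplicity j y)) ⟩
    ∑F (λ j → + nK * multiplicity j y)
      ≡⟨ ∑-cong (allFin 4) (λ j → sym (fourier-re j y)) ⟩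
    ∑F (λ j → ∑F (λ a → re (dot (X a) y) * Q (tp a) j))
      ≡⟨ ∑-swap (allFin 4) (allFin nK) (λ j a → re (dot (X a) y) * Q (tp a) j) ⟩
    ∑F (λ a → ∑F (λ j → re (dot (X a) y) * Q (tp a) j))
      ≡⟨ ∑-cong (allFin nK) (λ a → trans (∑-*ˡ (allFin 4) (re (dot (X a) y)) (Q (tp a)))
           (trans (cong (_*_ (re (dot (X a) y))) (Q-row-sum (tp a)))
             (regroup (re (dot (X a) y)) (size u) ⟦ tp a == zero ⟧))) ⟩
    ∑F (λ a → ⟦ tp a == zero ⟧ * (re (dot (X a) y) * size u))
      ≡⟨ ∑F-delta (λ a → tp a == zero) (λ a → re (dot (X a) y) * size u) a₀
           (subst (λ c → (c == zero) ≡ true) (sym (proj₂ (type-zero (tp-type a₀)) X₀)) refl)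
           (λ b e → Ks-injective b a₀ (trans (proj₁ (type-zero (tp-type b)) (==⇒≡ e)) (sym X₀))) ⟩
    re (dot (X a₀) y) * size u
      ≡⟨ cong (λ x → re x * size u) (trans (cong (λ x → dot x y) X₀) (dot-zeroˡ y)) ⟩
    1ℤ * size u
      ≡⟨ ℤₚ.*-identityˡ (size u) ⟩
    size u ∎
    where
    a₀ : Fin nK
    a₀ = Any.index 0∈Ks
    X₀ : X a₀ ≡ 0w
    X₀ = sym (Anyₚ.lookup-index 0∈Ks)
    regroup : ∀ p q r → p * (q * r) ≡ r * (p * q)
    regroup = solve-∀

  multiplicity-nonNeg : ∀ j y → 0ℤ ℤ.≤ multiplicity j y
  multiplicity-nonNeg j y = ∑-nonNeg (W j) λ w → ⟦⟧-nonNeg (inC (y -w w))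

  inC-0 : inC 0w ≡ true
  inC-0 = ⊥⇒inC λ {x} _ → dot-zeroʳ x

  -- The zero word represents the coset C, so the total multiplicity there is at least 1 and
  -- |K_short| ≤ q²; `large` is the other inequality.
  nK≡size : + nK ≡ size u
  nK≡size = ℤₚ.≤-antisym (subst₂ ℤ._≤_ (ℤₚ.*-identityʳ (+ nK)) (nK*total 0w) (ℤₚ.*-monoˡ-≤-nonNeg (+ nK) 1≤total)) large
    where
    mult₀ : multiplicity zero 0w ≡ 1ℤ
    mult₀ = trans (ℤₚ.+-identityʳ _) (cong ⟦_⟧ (trans (cong inC (-w-identityʳ 0w)) inC-0))
    1≤total : 1ℤ ℤ.≤ total 0w
    1≤total = subst (ℤ._≤ total 0w) mult₀
      (∑-term≤ {xs = allFin 4} {λ j → multiplicity j 0w} (λ j → multiplicity-nonNeg j 0w) (∈ₚ.∈-allFin zero))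

  instance
    nK-nonZero : NonZero nK
    nK-nonZero = ℕ.>-nonZero (ℤₚ.drop‿+<+ (subst (0ℤ ℤ.<_) (sym nK≡size) size>0))

  -- The words 0, ± e_j, e_j - e_k, 2 e_j form a transversal of C in A.
  total≡1 : ∀ y → total y ≡ 1ℤ
  total≡1 y = ℤₚ.*-cancelˡ-≡ (+ nK) _ _ (trans (nK*total y) (trans (sym nK≡size) (sym (ℤₚ.*-identityʳ (+ nK)))))

  -- A total of 1 bounds each multiplicity by 1, so distinct positions in `W j` carry words of
  -- distinct cosets and the count is an indicator.
  multiplicity≡ : ∀ j y → multiplicity j y ≡ ⟦ classA j y ⟧
  multiplicity≡ j y with classA j y in e
  ... | true = ℤₚ.≤-antisym
    (subst (multiplicity j y ℤ.≤_) (total≡1 y) (∑-term≤ {xs = allFin 4} {λ j → multiplicity j y} (λ j → multiplicity-nonNeg j y) (∈ₚ.∈-allFin j)))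
    (let w , w∈ , iw = classA⇒ j e in
     subst (ℤ._≤ multiplicity j y) (cong ⟦_⟧ iw) (∑-term≤ {xs = W j} {λ w → ⟦ inC (y -w w) ⟧} (λ w → ⟦⟧-nonNeg (inC (y -w w))) w∈))
  ... | false = trans (∑-cong-∈ (W j) λ w w∈ → cong ⟦_⟧ (false! w w∈)) (∑-0 (W j))
    where
    false! : ∀ w → w ∈ W j → inC (y -w w) ≡ false
    false! w w∈ with inC (y -w w) in i
    ... | false = refl
    ... | true  = contradiction (trans (sym e) (⇒classA j w∈ i)) λ ()

  opaque
    A-partition : ∀ y → ∃ λ c → ∀ j → classA j y ≡ (c == j)
    A-partition y = indicator-class (λ j → classA j y)
      (trans (∑-cong (allFin 4) λ j → sym (multiplicity≡ j y)) (total≡1 y))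

  cA : Word n → Fin 4
  cA y = proj₁ (A-partition y)

  cA-class : ∀ j y → classA j y ≡ (cA y == j)
  cA-class j y = proj₂ (A-partition y) j

  cA-zero⇒ : ∀ y → cA y ≡ zero → inC y ≡ true
  cA-zero⇒ y e = from-W₀ (classA⇒ zero {y} (trans (cA-class zero y) (cong (_== zero) e)))
    where
    from-W₀ : (∃ λ w → w ∈ W zero × inC (y -w w) ≡ true) → inC y ≡ true
    from-W₀ (_ , here refl , iw) = trans (cong inC (sym (-w-identityʳ y))) iw

  ⇒cA-zero : ∀ y → inC y ≡ true → cA y ≡ zero
  ⇒cA-zero y i = ==⇒≡ (trans (sym (cA-class zero y)) (⇒classA zero (here refl) (trans (cong inC (-w-identityʳ y)) i)))

  -- Every word of `W j` has exactly one representative among the Y b, and every coset of class j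
  -- meets `W j` exactly once.
  ∑-cosets : ∀ (g : Word n → ℤ) → (∀ t w → inC (t -w w) ≡ true → g t ≡ g w) →
             ∀ j → ∑F (λ b → ⟦ cA (Y b) == j ⟧ * g (Y b)) ≡ ∑ (W j) g
  ∑-cosets g inv j = begin
    ∑F (λ b → ⟦ cA (Y b) == j ⟧ * g (Y b))
      ≡⟨ ∑-cong (allFin nA) (λ b → trans (cong (_* g (Y b)) (trans (cong ⟦_⟧ (sym (cA-class j (Y b)))) (sym (multiplicity≡ j (Y b)))))
           (sym (∑-*ʳ (W j) (g (Y b)) (λ w → ⟦ inC (Y b -w w) ⟧)))) ⟩
    ∑F (λ b → ∑ (W j) (λ w → ⟦ inC (Y b -w w) ⟧ * g (Y b)))
      ≡⟨ ∑-swap (allFin nA) (W j) (λ b w → ⟦ inC (Y b -w w) ⟧ * g (Y b)) ⟩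
    ∑ (W j) (λ w → ∑F (λ b → ⟦ inC (Y b -w w) ⟧ * g (Y b)))
      ≡⟨ ∑-cong (W j) (λ w → let b , ib = reps-cover w in
           trans (∑F-delta (λ b → inC (Y b -w w)) (g ∘ Y) b ib λ b′ ib′ → reps-injective b′ b (same b b′ w ib ib′)) (inv (Y b) w ib)) ⟩
    ∑ (W j) g ∎
    where
    cancel : ∀ p q r → p ⊕ neg₄ r ≡ z0 → q ⊕ neg₄ r ≡ z0 → q ⊕ neg₄ p ≡ z0
    cancel = from-yes (all₄? λ p → all₄? λ q → all₄? λ r →
      (p ⊕ neg₄ r ≈? z0) →-dec ((q ⊕ neg₄ r ≈? z0) →-dec (q ⊕ neg₄ p ≈? z0)))
    same : ∀ b b′ w → inC (Y b -w w) ≡ true → inC (Y b′ -w w) ≡ true → inC (Y b′ -w Y b) ≡ true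
    same b b′ w ib ib′ = ⊥⇒inC λ {x} x∈ → trans (dot--ʳ x (Y b′) (Y b)) (cancel (dot x (Y b)) (dot x (Y b′)) (dot x w)
      (trans (sym (dot--ʳ x (Y b) w)) (inC⇒⊥ ib x∈)) (trans (sym (dot--ʳ x (Y b′) w)) (inC⇒⊥ ib′ x∈)))

  H : Fin nK → Fin nA → ℤ
  H a b = cas (dot (X a) (Y b))

  clsK : Fin nK → Fin nK → Fin 4
  clsK a a′ = proj₁ (types (-∈Ks (X∈ a) (X∈ a′)))

  clsK-type : ∀ a a′ → Type u (clsK a a′) (X a -w X a′)
  clsK-type a a′ = proj₂ (types (-∈Ks (X∈ a) (X∈ a′)))

  clsK-diag : ∀ a → clsK a a ≡ zero
  clsK-diag a = proj₂ (type-zero (clsK-type a a)) (-w-inverse (X a))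

  clsK-zero : ∀ a a′ → clsK a a′ ≡ zero → a ≡ a′
  clsK-zero a a′ e = Ks-injective a a′ (-w≡0⇒≡ (X a) (X a′) (proj₁ (type-zero (clsK-type a a′)) e))

  dot-invariant : ∀ {x} → x ∈ Ks → ∀ t w → inC (t -w w) ≡ true → dot x t ≡ dot x w
  dot-invariant {x} x∈ t w i = ⊖≡0⇒≡ (dot x t) (dot x w) (trans (sym (dot--ʳ x t w)) (inC⇒⊥ i x∈))

  -- The product of two values of `cas` splits into a character sum of x - x′, which is a row of Q,
  -- and an imaginary sum of x + x′, which `Ψ≡0` removes.
  BK : ∀ j a a′ → ∑F (λ b → ⟦ cA (Y b) == j ⟧ * (H a b * H a′ b)) ≡ Q (clsK a a′) j
  BK j a a′ = begin
    ∑F (λ b → ⟦ cA (Y b) == j ⟧ * (H a b * H a′ b))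
      ≡⟨ ∑-cosets (λ t → cas (dot x t) * cas (dot x′ t))
           (λ t w i → cong₂ (λ p q → cas p * cas q) (dot-invariant (X∈ a) t w i) (dot-invariant (X∈ a′) t w i)) j ⟩
    ∑ (W j) (λ w → cas (dot x w) * cas (dot x′ w))
      ≡⟨ ∑-cong (W j) (λ w → trans (cas-* (dot x w) (dot x′ w))
           (sym (cong₂ (λ p q → re p + im q) (dot--ˡ x x′ w) (dot-+ˡ x x′ w)))) ⟩
    ∑ (W j) (λ w → re (dot (x -w x′) w) + im (dot (x +w x′) w))
      ≡⟨ ∑-+ (W j) (λ w → re (dot (x -w x′) w)) (λ w → im (dot (x +w x′) w)) ⟩
    Φ j (x -w x′) + Ψ j (x +w x′)
      ≡⟨ cong₂ _+_ (Φ≡Q (clsK-type a a′) j) (Ψ≡0 (x +w x′) j) ⟩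
    Q (clsK a a′) j + 0ℤ
      ≡⟨ ℤₚ.+-identityʳ _ ⟩
    Q (clsK a a′) j ∎
    where
    x x′ : Word n
    x  = X a
    x′ = X a′

  orthogonalA : ∀ b b′ → ∑F (λ a → H a b * H a b′) ≡ + nK * ⟦ b == b′ ⟧
  orthogonalA b b′ = begin
    ∑F (λ a → H a b * H a b′)
      ≡⟨ ∑-cong (allFin nK) (λ a → trans (cas-* (dot (X a) (Y b)) (dot (X a) (Y b′)))
           (sym (cong₂ (λ p q → re p + im q) (dot--ʳ (X a) (Y b) (Y b′)) (dot-+ʳ (X a) (Y b) (Y b′))))) ⟩
    ∑F (λ a → re (dot (X a) (Y b -w Y b′)) + im (dot (X a) (Y b +w Y b′)))
      ≡⟨ ∑-+ (allFin nK) (λ a → re (dot (X a) (Y b -w Y b′))) (λ a → im (dot (X a) (Y b +w Y b′))) ⟩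
    ∑F (λ a → re (dot (X a) (Y b -w Y b′))) + ∑F (λ a → im (dot (X a) (Y b +w Y b′)))
      ≡⟨ cong₂ _+_ (trans (∑F-lookup Ks (λ x → re (dot x (Y b -w Y b′)))) (∑-re (Y b -w Y b′)))
                   (trans (∑F-lookup Ks (λ x → im (dot x (Y b +w Y b′)))) (∑-im (Y b +w Y b′))) ⟩
    + nK * ⟦ inC (Y b -w Y b′) ⟧ + 0ℤ
      ≡⟨ ℤₚ.+-identityʳ _ ⟩
    + nK * ⟦ inC (Y b -w Y b′) ⟧
      ≡⟨ cong (λ z → + nK * ⟦ z ⟧) equal ⟩
    + nK * ⟦ b == b′ ⟧ ∎
    where
    equal : inC (Y b -w Y b′) ≡ (b == b′)
    equal with b Fin.≟ b′ | inC (Y b -w Y b′) in i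
    ... | yes refl | true  = refl
    ... | yes refl | false = contradiction (trans (sym i) (trans (cong inC (-w-inverse (Y b))) inC-0)) λ ()
    ... | no b≢b′  | true  = contradiction (reps-injective b b′ i) b≢b′
    ... | no _     | false = refl

  -- Sum `BK` over the four classes; the row sums of Q vanish off the diagonal.
  HHᵀ : ∀ a a′ → ∑F (λ b → H a b * H a′ b) ≡ size u * ⟦ a == a′ ⟧
  HHᵀ a a′ = begin
    ∑F (λ b → H a b * H a′ b)
      ≡⟨ ∑-cong (allFin nA) (λ b → sym (∑F-== (λ _ → H a b * H a′ b) (cA (Y b)))) ⟩
    ∑F (λ b → ∑F (λ j → ⟦ cA (Y b) == j ⟧ * (H a b * H a′ b)))
      ≡⟨ ∑-swap (allFin nA) (allFin 4) (λ b j → ⟦ cA (Y b) == j ⟧ * (H a b * H a′ b)) ⟩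
    ∑F (λ j → ∑F (λ b → ⟦ cA (Y b) == j ⟧ * (H a b * H a′ b)))
      ≡⟨ ∑-cong (allFin 4) (λ j → BK j a a′) ⟩
    ∑F (Q (clsK a a′))
      ≡⟨ Q-row-sum (clsK a a′) ⟩
    size u * ⟦ clsK a a′ == zero ⟧
      ≡⟨ cong (λ z → size u * ⟦ z ⟧) equal ⟩
    size u * ⟦ a == a′ ⟧ ∎
    where
    equal : (clsK a a′ == zero) ≡ (a == a′)
    equal with a Fin.≟ a′ | clsK a a′ in e
    ... | yes refl | c     = cong (_== zero) (trans (sym e) (clsK-diag a))
    ... | no a≢a′  | zero  = contradiction (clsK-zero a a′ e) a≢a′
    ... | no _     | suc _ = refl

  a₀ : Fin nK
  a₀ = Any.index 0∈Ks

  -- The squares of the entries of H are 1, so a diagonal entry of H Hᵀ counts the cosets.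
  nA≡size : + nA ≡ size u
  nA≡size = begin
    + nA                           ≡⟨ sym (∑F-1 nA) ⟩
    ∑F {nA} (λ _ → 1ℤ)             ≡⟨ ∑-cong (allFin nA) (λ b → sym (cas-square (dot (X a₀) (Y b)))) ⟩
    ∑F (λ b → H a₀ b * H a₀ b)     ≡⟨ HHᵀ a₀ a₀ ⟩
    size u * ⟦ a₀ == a₀ ⟧          ≡⟨ cong (λ z → size u * ⟦ z ⟧) (==-refl a₀) ⟩
    size u * 1ℤ                    ≡⟨ ℤₚ.*-identityʳ (size u) ⟩
    size u ∎

  instance
    nA-nonZero : NonZero nA
    nA-nonZero = ℕ.>-nonZero (ℤₚ.drop‿+<+ (subst (0ℤ ℤ.<_) (sym nA≡size) size>0))

  -- Inversion by QP = q² I: the indicator of type j is a combination of the columns of Q, which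
  -- turns a sum over one class into Fourier sums.
  Dsum : ∀ (f : Fin nK → ℤ) j → size u * ∑F (λ a → ⟦ tp a == j ⟧ * f a) ≡ ∑F (λ i → P i j * ∑F (λ a → f a * Q (tp a) i))
  Dsum f j = begin
    size u * ∑F (λ a → ⟦ tp a == j ⟧ * f a)
      ≡⟨ sym (∑-*ˡ (allFin nK) (size u) (λ a → ⟦ tp a == j ⟧ * f a)) ⟩
    ∑F (λ a → size u * (⟦ tp a == j ⟧ * f a))
      ≡⟨ ∑-cong (allFin nK) (λ a → trans (sym (ℤₚ.*-assoc (size u) ⟦ tp a == j ⟧ (f a)))
           (trans (cong (_* f a) (sym (QzPz u (tp a) j))) (sym (∑-*ʳ (allFin 4) (f a) (λ i → Q (tp a) i * P i j))))) ⟩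
    ∑F (λ a → ∑F (λ i → Q (tp a) i * P i j * f a))
      ≡⟨ ∑-swap (allFin nK) (allFin 4) (λ a i → Q (tp a) i * P i j * f a) ⟩
    ∑F (λ i → ∑F (λ a → Q (tp a) i * P i j * f a))
      ≡⟨ ∑-cong (allFin 4) (λ i → trans (∑-cong (allFin nK) λ a → regroup (Q (tp a) i) (P i j) (f a))
           (∑-*ˡ (allFin nK) (P i j) (λ a → f a * Q (tp a) i))) ⟩
    ∑F (λ i → P i j * ∑F (λ a → f a * Q (tp a) i)) ∎
    where
    regroup : ∀ p q r → p * q * r ≡ q * (r * p)
    regroup = solve-∀

  instance
    size-nonZero : ℤ.NonZero (size u)
    size-nonZero = subst ℤ.NonZero nK≡size nK-nonZero

  -- By `fourier-re` the i-th Fourier sum is |K_short| times the indicator of i = cA y, so one row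
  -- of P survives.
  character-re : ∀ j y → ∑F (λ a → ⟦ tp a == j ⟧ * re (dot (X a) y)) ≡ P (cA y) j
  character-re j y = ℤₚ.*-cancelˡ-≡ (size u) _ _ (begin
    size u * ∑F (λ a → ⟦ tp a == j ⟧ * re (dot (X a) y))
      ≡⟨ Dsum (λ a → re (dot (X a) y)) j ⟩
    ∑F (λ i → P i j * ∑F (λ a → re (dot (X a) y) * Q (tp a) i))
      ≡⟨ ∑-cong (allFin 4) (λ i → trans (cong (_*_ (P i j)) (trans (fourier-re i y) (cong (_*_ (+ nK))
           (trans (multiplicity≡ i y) (cong ⟦_⟧ (cA-class i y)))))) (regroup (P i j) (+ nK) ⟦ cA y == i ⟧)) ⟩
    ∑F (λ i → ⟦ cA y == i ⟧ * (+ nK * P i j))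
      ≡⟨ ∑F-== (λ i → + nK * P i j) (cA y) ⟩
    + nK * P (cA y) j
      ≡⟨ cong (_* P (cA y) j) nK≡size ⟩
    size u * P (cA y) j ∎)
    where
    regroup : ∀ p q r → p * (q * r) ≡ r * (q * p)
    regroup = solve-∀

  character-im : ∀ j y → ∑F (λ a → ⟦ tp a == j ⟧ * im (dot (X a) y)) ≡ 0ℤ
  character-im j y = ℤₚ.*-cancelˡ-≡ (size u) _ _ (begin
    size u * ∑F (λ a → ⟦ tp a == j ⟧ * im (dot (X a) y))
      ≡⟨ Dsum (λ a → im (dot (X a) y)) j ⟩
    ∑F (λ i → P i j * ∑F (λ a → im (dot (X a) y) * Q (tp a) i))
      ≡⟨ ∑-cong (allFin 4) (λ i → trans (cong (_*_ (P i j)) (fourier-im i y)) (ℤₚ.*-zeroʳ (P i j))) ⟩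
    ∑F {4} (λ _ → 0ℤ)
      ≡⟨ sym (ℤₚ.*-zeroʳ (size u)) ⟩
    size u * 0ℤ ∎)

  BA : ∀ j b b′ → ∑F (λ a → ⟦ tp a == j ⟧ * (H a b * H a b′)) ≡ P (cA (Y b -w Y b′)) j
  BA j b b′ = begin
    ∑F (λ a → ⟦ tp a == j ⟧ * (H a b * H a b′))
      ≡⟨ ∑-cong (allFin nK) (λ a → trans (cong (_*_ ⟦ tp a == j ⟧) (trans (cas-* (dot (X a) (Y b)) (dot (X a) (Y b′)))
           (sym (cong₂ (λ p q → re p + im q) (dot--ʳ (X a) (Y b) (Y b′)) (dot-+ʳ (X a) (Y b) (Y b′))))))
           (ℤₚ.*-distribˡ-+ ⟦ tp a == j ⟧ (re (dot (X a) (Y b -w Y b′))) (im (dot (X a) (Y b +w Y b′))))) ⟩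
    ∑F (λ a → ⟦ tp a == j ⟧ * re (dot (X a) (Y b -w Y b′)) + ⟦ tp a == j ⟧ * im (dot (X a) (Y b +w Y b′)))
      ≡⟨ ∑-+ (allFin nK) (λ a → ⟦ tp a == j ⟧ * re (dot (X a) (Y b -w Y b′))) (λ a → ⟦ tp a == j ⟧ * im (dot (X a) (Y b +w Y b′))) ⟩
    ∑F (λ a → ⟦ tp a == j ⟧ * re (dot (X a) (Y b -w Y b′))) + ∑F (λ a → ⟦ tp a == j ⟧ * im (dot (X a) (Y b +w Y b′)))
      ≡⟨ cong₂ _+_ (character-re j (Y b -w Y b′)) (character-im j (Y b +w Y b′)) ⟩
    P (cA (Y b -w Y b′)) j + 0ℤ
      ≡⟨ ℤₚ.+-identityʳ _ ⟩
    P (cA (Y b -w Y b′)) j ∎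

  relK : Rels nK 3
  relK j a a′ = classK j (X a -w X a′)

  relA : Rels nA 3
  relA j b b′ = classA j (Y b -w Y b′)

  module SK = Spectral {nK} {nA} relK clsK (λ j a a′ → classK-type (clsK-type a a′) j) clsK-diag clsK-zero
    H (cA ∘ Y) P Q orthogonalA BK
    (λ c k → trans (QzPz u c k) (cong (_* ⟦ c == k ⟧) (sym nK≡size)))
    (Pz-col₀ u) (Qz-col₀ u) P-row₀≢0 a₀

  module SA = Spectral {nA} {nK} relA (λ b b′ → cA (Y b -w Y b′)) (λ j b b′ → cA-class j (Y b -w Y b′))
    (λ b → ⇒cA-zero (Y b -w Y b) (trans (cong inC (-w-inverse (Y b))) inC-0))
    (λ b b′ e → reps-injective b b′ (cA-zero⇒ (Y b -w Y b′) e))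
    (λ b a → H a b) tp Q P
    (λ a a′ → trans (HHᵀ a a′) (cong (_* ⟦ a == a′ ⟧) (sym nA≡size))) BA
    (λ c k → trans (PzQz u c k) (cong (_* ⟦ c == k ⟧) (sym nA≡size)))
    (Qz-col₀ u) (Pz-col₀ u) Q-row₀≢0 (proj₁ (reps-cover 0w))

-- Differences of Kerdock codewords

∑-removeAt : ∀ {n} (f : ℤ₄ → ℤ) (w : Word (suc n)) p →
  ∑F (λ j → f (lookup w j)) ≡ f (lookup w p) + ∑F (λ j → f (lookup (removeAt w p) j))
∑-removeAt f (a ∷ w) zero = ∑F-suc (λ j → f (lookup (a ∷ w) j))
∑-removeAt f (a ∷ w@(b ∷ w′)) (suc p) = begin
  ∑F (λ j → f (lookup (a ∷ w) j))          ≡⟨ ∑F-suc (λ j → f (lookup (a ∷ w) j)) ⟩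
  f a + ∑F (λ j → f (lookup w j))          ≡⟨ cong (_+_ (f a)) (∑-removeAt f w p) ⟩
  f a + (f (lookup w p) + Z)               ≡⟨ swap (f a) (f (lookup w p)) Z ⟩
  f (lookup w p) + (f a + Z)               ≡⟨ cong (_+_ (f (lookup w p))) (sym (∑F-suc (λ j → f (lookup (a ∷ removeAt w p) j)))) ⟩
  f (lookup w p) + ∑F (λ j → f (lookup (a ∷ removeAt w p) j)) ∎
  where
  open ≡-Reasoning
  Z = ∑F (λ j → f (lookup (removeAt w p) j))
  swap : ∀ a b c → a + (b + c) ≡ b + (a + c)
  swap = solve-∀

removeAt-zipWith : ∀ {n} (f : ℤ₄ → ℤ₄ → ℤ₄) (x y : Word (suc n)) p →
  removeAt (zipWith f x y) p ≡ zipWith f (removeAt x p) (removeAt y p)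
removeAt-zipWith f (a ∷ x)     (b ∷ y)     zero    = refl
removeAt-zipWith f (a ∷ x@(_ ∷ _)) (b ∷ y@(_ ∷ _)) (suc p) = cong (f a b ∷_) (removeAt-zipWith f x y p)

removeAt-map : ∀ {n} (f : ℤ₄ → ℤ₄) (x : Word (suc n)) p → removeAt (Vec.map f x) p ≡ Vec.map f (removeAt x p)
removeAt-map f (a ∷ x)         zero    = refl
removeAt-map f (a ∷ x@(_ ∷ _)) (suc p) = cong (f a ∷_) (removeAt-map f x p)

dot-insertAt : ∀ {n} (x : Word (suc n)) (y : Word n) p a →
  dot x (insertAt y p a) ≡ lookup x p ⊗ a ⊕ dot (removeAt x p) y
dot-insertAt (b ∷ x)         y       zero    a = refl
dot-insertAt (b ∷ x@(_ ∷ _)) (c ∷ y) (suc p) a =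
  trans (cong (b ⊗ c ⊕_) (dot-insertAt x y p a)) (swap (b ⊗ c) (lookup x p ⊗ a) (dot (removeAt x p) y))
  where
  swap : ∀ a b c → a ⊕ (b ⊕ c) ≡ b ⊕ (a ⊕ c)
  swap = from-yes (all₄? λ a → all₄? λ b → all₄? λ c → a ⊕ (b ⊕ c) ≈? b ⊕ (a ⊕ c))

leeWeight-Sre : ∀ {n} (w : Word n) → + leeWeight w ≡ + n - Sre w
leeWeight-Sre []      = refl
leeWeight-Sre {suc n} (a ∷ w) = begin
  + leeWt a + + leeWeight w              ≡⟨ cong₂ _+_ (letter a) (leeWeight-Sre w) ⟩
  (1ℤ - re a) + (+ n - Sre w)            ≡⟨ regroup (re a) (+ n) (Sre w) ⟩
  (1ℤ + + n) - (re a + Sre w)            ≡⟨ cong (_-_ (+ suc n)) (sym (∑F-suc (λ j → re (lookup (a ∷ w) j)))) ⟩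
  + suc n - Sre (a ∷ w) ∎
  where
  open ≡-Reasoning
  letter : ∀ a → + leeWt a ≡ 1ℤ - re a
  letter = from-yes (all₄? λ a → + leeWt a ℤ.≟ 1ℤ - re a)
  regroup : ∀ p q r → (1ℤ - p) + (q - r) ≡ (1ℤ + q) - (p + r)
  regroup = solve-∀

leeWeight≡0⇒≡0w : ∀ {n} (w : Word n) → leeWeight w ≡ 0 → w ≡ 0w
leeWeight≡0⇒≡0w []       _ = refl
leeWeight≡0⇒≡0w (z0 ∷ w) e = cong (z0 ∷_) (leeWeight≡0⇒≡0w w e)

leeWeight-0w : ∀ n → leeWeight (0w {n}) ≡ 0
leeWeight-0w zero    = refl
leeWeight-0w (suc n) = leeWeight-0w n

-- The letter sums of a word of full length, before the coordinate carrying a 0 is deleted.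
record FullType (u : ℤ) (c : Fin 4) (Re Im D : ℤ) : Set where
  field
    single : + 2 * (Re - 1ℤ) ≡ Qz u c (suc zero)
    pairs  : (Re - 1ℤ) * (Re - 1ℤ) + Im * Im - (+ 2 * (u * u) - 1ℤ) ≡ Qz u c (suc (suc zero))
    double : D - 1ℤ ≡ Qz u c (suc (suc (suc zero)))

FullType-resp : ∀ {u c Re Im D Re′ Im′ D′} → Re ≡ Re′ → Im ≡ Im′ → D ≡ D′ →
                FullType u c Re′ Im′ D′ → FullType u c Re Im D
FullType-resp refl refl refl t = t

opaque
  unfolding Qz

  constant-type : ∀ u → FullType u zero (+ 2 * (u * u)) 0ℤ (+ 2 * (u * u))
  constant-type u = record { single = single u ; pairs = pairs u ; double = refl }
    where
    single : ∀ u → + 2 * (+ 2 * (u * u) - 1ℤ) ≡ + 4 * (u * u) - + 2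
    single = solve-∀
    pairs : ∀ u → (+ 2 * (u * u) - 1ℤ) * (+ 2 * (u * u) - 1ℤ) + 0ℤ * 0ℤ - (+ 2 * (u * u) - 1ℤ) ≡ (+ 2 * (u * u) - 1ℤ) * (+ 2 * (u * u) - + 2)
    pairs = solve-∀

  linear-type : ∀ u → FullType u (suc (suc (suc zero))) 0ℤ 0ℤ (+ 2 * (u * u))
  linear-type u = record { single = refl ; pairs = pairs u ; double = refl }
    where
    pairs : ∀ u → (0ℤ - 1ℤ) * (0ℤ - 1ℤ) + 0ℤ * 0ℤ - (+ 2 * (u * u) - 1ℤ) ≡ - (+ 2 * (u * u)) + + 2
    pairs = solve-∀

  -- The norm equation eliminates Im, so the sign of the imaginary part does not affect the class.
  quadratic-pairs : ∀ u Re Im → Re * Re + Im * Im ≡ + 2 * (u * u) →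
    (Re - 1ℤ) * (Re - 1ℤ) + Im * Im - (+ 2 * (u * u) - 1ℤ) ≡ + 2 - + 2 * Re
  quadratic-pairs u Re Im e = trans (expand Re Im (+ 2 * (u * u))) (trans (cong (λ z → z - + 2 * (u * u) + (+ 2 - + 2 * Re)) e) (cancel (+ 2 * (u * u)) Re))
    where
    expand : ∀ Re Im Q → (Re - 1ℤ) * (Re - 1ℤ) + Im * Im - (Q - 1ℤ) ≡ Re * Re + Im * Im - Q + (+ 2 - + 2 * Re)
    expand = solve-∀
    cancel : ∀ Q Re → Q - Q + (+ 2 - + 2 * Re) ≡ + 2 - + 2 * Re
    cancel = solve-∀

  -- The Lee weight of the word is q - Re, so Re = u gives the class of weight q - u and Re = - u
  -- that of weight q + u.
  quadratic-type : ∀ u Re Im → Re * Re + Im * Im ≡ + 2 * (u * u) → Re ≡ u ⊎ Re ≡ - u →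
    ∃ λ c → c ≢ zero × FullType u c Re Im 0ℤ
  quadratic-type u Re Im e (inj₁ refl) = suc (suc zero) , (λ ()) , record
    { single = single u ; pairs = trans (quadratic-pairs u u Im e) (pairs u) ; double = refl }
    where
    single : ∀ u → + 2 * (u - 1ℤ) ≡ + 2 * u - + 2
    single = solve-∀
    pairs : ∀ u → + 2 - + 2 * u ≡ - (+ 2 * u) + + 2
    pairs = solve-∀
  quadratic-type u Re Im e (inj₂ refl) = suc zero , (λ ()) , record
    { single = single u ; pairs = trans (quadratic-pairs u (- u) Im e) (pairs u) ; double = refl }
    where
    single : ∀ u → + 2 * (- u - 1ℤ) ≡ - (+ 2 * u) - + 2
    single = solve-∀
    pairs : ∀ u → + 2 - + 2 * - u ≡ + 2 * u + + 2
    pairs = solve-∀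

-- Spelled out for k rows, because `_·₂_` and `_+₂_` are typed for square matrices and the induction
-- removes one row at a time.
·₂-+₂ : ∀ {k m} (R R′ : Vec (Vec Bool m) k) (w : Bits m) →
  Vec.map (λ row → Vec.foldr _ _xor_ false (zipWith _∧_ row w)) (zipWith (zipWith _xor_) R R′) ≡
  Vec.map (λ row → Vec.foldr _ _xor_ false (zipWith _∧_ row w)) R ⊞
  Vec.map (λ row → Vec.foldr _ _xor_ false (zipWith _∧_ row w)) R′
·₂-+₂ []      []        w = refl
·₂-+₂ (r ∷ R) (r′ ∷ R′) w = cong₂ _∷_ (row r r′ w) (·₂-+₂ R R′ w)
  where
  row : ∀ {m} (r r′ w : Bits m) → Vec.foldr _ _xor_ false (zipWith _∧_ (zipWith _xor_ r r′) w) ≡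
    (Vec.foldr _ _xor_ false (zipWith _∧_ r w) xor Vec.foldr _ _xor_ false (zipWith _∧_ r′ w))
  row []      []        []      = refl
  row (a ∷ r) (a′ ∷ r′) (b ∷ w) = trans (cong (((a xor a′) ∧ b) xor_) (row r r′ w))
    (bit a a′ b (Vec.foldr _ _xor_ false (zipWith _∧_ r w)) (Vec.foldr _ _xor_ false (zipWith _∧_ r′ w)))
    where
    bit : ∀ a a′ b c d → (((a xor a′) ∧ b) xor (c xor d)) ≡ (((a ∧ b) xor c) xor ((a′ ∧ b) xor d))
    bit = from-yes (allB? λ a → allB? λ a′ → allB? λ b → allB? λ c → allB? λ d →
      (((a xor a′) ∧ b) xor (c xor d)) Bool.≟ (((a ∧ b) xor c) xor ((a′ ∧ b) xor d)))

twoDot-zeroʳ : ∀ {m} (s : Bits m) → twoDot s 0b ≡ z0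
twoDot-zeroʳ s = trans (twoDot-comm s 0b) (twoDot-zeroˡ s)

T-form-0 : ∀ {m} (R : BinMat m) → Symmetric R → T-form R 0b ≡ z0
T-form-0 R R-sym = idem (T-form R 0b) (trans (cong (T-form R) (sym (⊞-self 0b)))
  (trans (T-form-⊞ R R-sym 0b 0b) (trans (cong (T-form R 0b ⊕ T-form R 0b ⊕_) (twoDot-zeroʳ (R ·₂ 0b))) (⊕-identityʳ _))))
  where
  idem : ∀ a → a ≡ a ⊕ a → a ≡ z0
  idem = from-yes (all₄? λ a → (a ≈? a ⊕ a) →-dec (a ≈? z0))

value : ∀ {m} → BinMat m → Bits m → ℤ₄ → Bits m → ℤ₄
value R s ε v = T-form R v ⊕ twoDot s v ⊕ ε

q≡2u² : ∀ k → + 2 ^ suc (k ℕ.+ k) ≡ + 2 * (+ 2 ^ k * + 2 ^ k)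
q≡2u² k = trans (cong (λ z → + (2 ℕ.* z)) (ℕₚ.^-distribˡ-+-* 2 k k))
  (trans (ℤₚ.pos-* 2 (2 ^ k ℕ.* 2 ^ k)) (cong (_*_ (+ 2)) (ℤₚ.pos-* (2 ^ k) (2 ^ k))))

module Difference (k : ℕ) (R R′ : BinMat (suc (k ℕ.+ k))) (s s′ : Bits (suc (k ℕ.+ k))) (ε ε′ : ℤ₄)
  (v₀ : Bits (suc (k ℕ.+ k))) where

  m : ℕ
  m = suc (k ℕ.+ k)

  u : ℤ
  u = + 2 ^ k

  c : Bits m → ℤ₄
  c v = value R s ε v ⊕ neg₄ (value R′ s′ ε′ v)

  ∑B-const : ∀ {f : Bits m → ℤ} → (∀ v → f v ≡ 1ℤ) → ∑B f ≡ + 2 * (u * u)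
  ∑B-const e = trans (∑-cong (allBits m) e) (trans (∑B-1 m) (q≡2u² k))

  linear : R ≡ R′ → ∀ v → c v ≡ twoDot (s ⊞ s′) v ⊕ (ε ⊕ neg₄ ε′)
  linear refl v = trans (cancel (T-form R v) ε ε′ (bitDot s v) (bitDot s′ v)) (cong (_⊕ (ε ⊕ neg₄ ε′)) (sym (twoDot-⊞ˡ s s′ v)))
    where
    cancel : ∀ t e e′ x y → (t ⊕ z2 ⊗ x ⊕ e) ⊕ neg₄ (t ⊕ z2 ⊗ y ⊕ e′) ≡ z2 ⊗ x ⊕ z2 ⊗ y ⊕ (e ⊕ neg₄ e′)
    cancel = from-yes (all₄? λ t → all₄? λ e → all₄? λ e′ → all₄? λ x → all₄? λ y →
      (t ⊕ z2 ⊗ x ⊕ e) ⊕ neg₄ (t ⊕ z2 ⊗ y ⊕ e′) ≈? z2 ⊗ x ⊕ z2 ⊗ y ⊕ (e ⊕ neg₄ e′))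

  κ : Bits m → ℤ₄
  κ w = (T-form R w ⊕ twoDot s w) ⊕ neg₄ (T-form R′ w ⊕ twoDot s′ w)

  module _ (R-sym : Symmetric R) (R′-sym : Symmetric R′) where

    -- The polar forms of both codewords are even, hence equal to their negatives; their difference
    -- is therefore the form of R + R′ over F₂, to which the Kerdock condition applies.
    polar : ∀ v w → c (v ⊞ w) ≡ c v ⊕ (κ w ⊕ twoDot ((R +₂ R′) ·₂ w) v)
    polar v w = begin
      c (v ⊞ w)
        ≡⟨ cong₂ (λ a b → a ⊕ neg₄ b) (expand R R-sym s ε) (expand R′ R′-sym s′ ε′) ⟩
      (A ⊕ (B ⊕ z2 ⊗ x)) ⊕ neg₄ (A′ ⊕ (B′ ⊕ z2 ⊗ x′))
        ≡⟨ trans (cong (A ⊕ (B ⊕ z2 ⊗ x) ⊕_) (trans (neg-⊕ A′ (B′ ⊕ z2 ⊗ x′)) (cong (neg₄ A′ ⊕_) (neg-⊕ B′ (z2 ⊗ x′)))))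
                 (trans (⊕-interchange A (B ⊕ z2 ⊗ x) (neg₄ A′) (neg₄ B′ ⊕ neg₄ (z2 ⊗ x′)))
                   (cong (A ⊕ neg₄ A′ ⊕_) (trans (⊕-interchange B (z2 ⊗ x) (neg₄ B′) (neg₄ (z2 ⊗ x′)))
                     (cong (λ z → B ⊕ neg₄ B′ ⊕ (z2 ⊗ x ⊕ z)) (neg-even x′))))) ⟩
      c v ⊕ (κ w ⊕ (twoDot (R ·₂ w) v ⊕ twoDot (R′ ·₂ w) v))
        ≡⟨ cong (λ z → c v ⊕ (κ w ⊕ z)) (sym (trans (cong (λ z → twoDot z v) (·₂-+₂ R R′ w)) (twoDot-⊞ˡ (R ·₂ w) (R′ ·₂ w) v))) ⟩
      c v ⊕ (κ w ⊕ twoDot ((R +₂ R′) ·₂ w) v) ∎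
      where
      open ≡-Reasoning
      A A′ B B′ x x′ : ℤ₄
      A  = value R s ε v
      A′ = value R′ s′ ε′ v
      B  = T-form R w ⊕ twoDot s w
      B′ = T-form R′ w ⊕ twoDot s′ w
      x  = bitDot (R ·₂ w) v
      x′ = bitDot (R′ ·₂ w) v
      neg-even : ∀ a → neg₄ (z2 ⊗ a) ≡ z2 ⊗ a
      neg-even = from-yes (all₄? λ a → neg₄ (z2 ⊗ a) ≈? z2 ⊗ a)
      expand : ∀ R → Symmetric R → ∀ s ε →
        value R s ε (v ⊞ w) ≡ value R s ε v ⊕ ((T-form R w ⊕ twoDot s w) ⊕ twoDot (R ·₂ w) v)
      expand R R-sym s ε = trans (cong₂ (λ a b → a ⊕ b ⊕ ε) (T-form-⊞ R R-sym v w) (twoDot-⊞ʳ s v w))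
        (trans (cong (_⊕ ε) (step₁ (T-form R v) (T-form R w) (twoDot (R ·₂ w) v) (twoDot s v) (twoDot s w)))
               (step₂ (T-form R v ⊕ twoDot s v) ((T-form R w ⊕ twoDot s w) ⊕ twoDot (R ·₂ w) v) ε))
        where
        step₁ : ∀ a b d e f → (a ⊕ b ⊕ d) ⊕ (e ⊕ f) ≡ (a ⊕ e) ⊕ (b ⊕ f ⊕ d)
        step₁ = from-yes (all₄? λ a → all₄? λ b → all₄? λ d → all₄? λ e → all₄? λ f →
          (a ⊕ b ⊕ d) ⊕ (e ⊕ f) ≈? (a ⊕ e) ⊕ (b ⊕ f ⊕ d))
        step₂ : ∀ a b d → a ⊕ b ⊕ d ≡ a ⊕ d ⊕ b
        step₂ = from-yes (all₄? λ a → all₄? λ b → all₄? λ d → a ⊕ b ⊕ d ≈? a ⊕ d ⊕ b)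

    κ-0 : κ 0b ≡ z0
    κ-0 = cong₂ (λ a b → a ⊕ neg₄ b)
      (cong₂ _⊕_ (T-form-0 R R-sym) (twoDot-zeroʳ s)) (cong₂ _⊕_ (T-form-0 R′ R′-sym) (twoDot-zeroʳ s′))

  FullType-c : Fin 4 → Set
  FullType-c t = FullType u t (∑B (re ∘ c)) (∑B (im ∘ c)) (∑B (λ v → re (c v ⊕ c v)))

  quadratic : Symmetric R → Symmetric R′ → Nonsingular (R +₂ R′) → c v₀ ≡ z0 → ∃ λ t → t ≢ zero × FullType-c t
  quadratic R-sym R′-sym ns c₀ =
    let t , t≢0 , ty = quadratic-type u Re Im (trans norm-c (q≡2u² k)) (two-squaresℤ k Re Im norm-c)
    in  t , t≢0 , FullType-resp refl refl D≡0 ty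
    where
    open GaussSum c κ (R +₂ R′) (polar R-sym R′-sym) (κ-0 R-sym R′-sym)
    Re Im : ℤ
    Re = ∑B (re ∘ c)
    Im = ∑B (im ∘ c)
    norm-c : Re * Re + Im * Im ≡ + 2 ^ m
    norm-c = norm ns
    pow≢0 : + 2 ^ k ≢ 0ℤ
    pow≢0 e = contradiction (ℤₚ.+-injective e) (ℕ.≢-nonZero⁻¹ (2 ^ k) {{ℕₚ.m^n≢0 2 k}})
    nonzero : ∀ {x} → x ≡ + 2 ^ k ⊎ x ≡ - (+ 2 ^ k) → x ≢ 0ℤ
    nonzero (inj₁ x≡)  e = pow≢0 (trans (sym x≡) e)
    nonzero (inj₂ x≡-) e = pow≢0 (ℤₚ.neg-injective (trans (sym x≡-) e))
    -- Hence c takes an odd value; this replaces the fact that alternating matrices of odd size are singular.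
    Im≢0 : Im ≢ 0ℤ
    Im≢0 = nonzero (two-squaresℤ k Im Re (trans (ℤₚ.+-comm (Im * Im) (Re * Re)) norm-c))
    D≡0 : ∑B (λ v → re (c v ⊕ c v)) ≡ 0ℤ
    -- A nonzero imaginary sum must contain a nonzero term, which supplies the point with odd value
    -- for `∑-double`.
    D≡0 = let v₁ , _ , odd = ∑≢0⇒∃ (allBits m) {im ∘ c} Im≢0 in ∑-double v₀ v₁ c₀ odd

  -- Vanishing at v₀ makes the constant ε - ε′ even, so c takes only the values 0 and 2: the
  -- imaginary sum is 0 and every doubled value is 0. The real sum is a nontrivial character sum up
  -- to a factor.
  affine : R ≡ R′ → s ≢ s′ → c v₀ ≡ z0 → FullType-c (suc (suc (suc zero)))
  affine R≡R′ s≢s′ c₀ = FullType-resp re≡0 im≡0 (∑B-const double) (linear-type u)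
    where
    e : ℤ₄
    e = ε ⊕ neg₄ ε′
    x : Bits m → ℤ₄
    x = bitDot (s ⊞ s′)
    e-even : z2 ⊗ x v₀ ⊕ e ≡ z0
    e-even = trans (sym (linear R≡R′ v₀)) c₀
    factor : ∀ a b → re (z2 ⊗ a ⊕ b) ≡ re b * re (z2 ⊗ a)
    factor a b = trans (cong re (⊕-comm (z2 ⊗ a) b)) (re-z2-⊕ b a)
    re≡0 : ∑B (re ∘ c) ≡ 0ℤ
    re≡0 = trans (∑-cong (allBits m) λ v → trans (cong re (linear R≡R′ v)) (factor (x v) e))
      (trans (∑-*ˡ (allBits m) (re e) (λ v → re (twoDot (s ⊞ s′) v)))
      (trans (cong (_*_ (re e)) (∑B-twoDot (s ⊞ s′) (s≢s′ ∘ ⊞≡0⇒≡ s s′))) (ℤₚ.*-zeroʳ (re e))))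
    even-im : ∀ x y e → z2 ⊗ x ⊕ e ≡ z0 → im (z2 ⊗ y ⊕ e) ≡ 0ℤ
    even-im = from-yes (all₄? λ x → all₄? λ y → all₄? λ e → (z2 ⊗ x ⊕ e ≈? z0) →-dec (im (z2 ⊗ y ⊕ e) ℤ.≟ 0ℤ))
    even-double : ∀ x y e → z2 ⊗ x ⊕ e ≡ z0 → re ((z2 ⊗ y ⊕ e) ⊕ (z2 ⊗ y ⊕ e)) ≡ 1ℤ
    even-double = from-yes (all₄? λ x → all₄? λ y → all₄? λ e → (z2 ⊗ x ⊕ e ≈? z0) →-dec (re ((z2 ⊗ y ⊕ e) ⊕ (z2 ⊗ y ⊕ e)) ℤ.≟ 1ℤ))
    im≡0 : ∑B (im ∘ c) ≡ 0ℤ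
    im≡0 = trans (∑-cong (allBits m) λ v → trans (cong im (linear R≡R′ v)) (even-im (x v₀) (x v) e e-even)) (∑-0 (allBits m))
    double : ∀ v → re (c v ⊕ c v) ≡ 1ℤ
    double v = trans (cong (λ z → re (z ⊕ z)) (linear R≡R′ v)) (even-double (x v₀) (x v) e e-even)

  constant : R ≡ R′ → s ≡ s′ → c v₀ ≡ z0 → FullType-c zero
  constant R≡R′ s≡s′ c₀ = FullType-resp (∑B-const λ v → cong re (c≡0 v))
    (trans (∑-cong (allBits m) λ v → cong im (c≡0 v)) (∑-0 (allBits m)))
    (∑B-const λ v → cong (λ z → re (z ⊕ z)) (c≡0 v)) (constant-type u)
    where
    c≡e : ∀ v → c v ≡ ε ⊕ neg₄ ε′
    c≡e v = trans (linear R≡R′ v) (cong (_⊕ (ε ⊕ neg₄ ε′))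
      (trans (cong (λ z → twoDot z v) (trans (cong (s ⊞_) (sym s≡s′)) (⊞-self s))) (twoDot-zeroˡ v)))
    c≡0 : ∀ v → c v ≡ z0
    c≡0 v = trans (c≡e v) (trans (sym (c≡e v₀)) c₀)

-- The shortened Kerdock code and the punctured Preparata code

T⇒≡ : ∀ {b} → T b → b ≡ true
T⇒≡ {true} _ = refl

≡⇒T : ∀ {b} → b ≡ true → T b
≡⇒T refl = tt

any⇒ : ∀ {A : Set} (p : A → Bool) xs → BL.any p xs ≡ true → ∃ λ x → x ∈ xs × p x ≡ true
any⇒ p xs e = let x , x∈ , px = find (Anyₚ.any⁻ p xs (≡⇒T e)) in x , x∈ , T⇒≡ px

⇒any : ∀ {A : Set} (p : A → Bool) {xs x} → x ∈ xs → p x ≡ true → BL.any p xs ≡ true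
⇒any p x∈ px = T⇒≡ (Anyₚ.any⁺ p (Any.map (λ { refl → ≡⇒T px }) x∈))

∈-allBits : ∀ {m} (s : Bits m) → s ∈ allBits m
∈-allBits []          = here refl
∈-allBits (false ∷ s) = ∈ₚ.∈-++⁺ˡ (∈ₚ.∈-map⁺ (false ∷_) (∈-allBits s))
∈-allBits {suc m} (true ∷ s) = ∈ₚ.∈-++⁺ʳ (List.map (false ∷_) (allBits m)) (∈ₚ.∈-++⁺ˡ (∈ₚ.∈-map⁺ (true ∷_) (∈-allBits s)))

∈-allℤ₄ : ∀ a → a ∈ allℤ₄
∈-allℤ₄ z0 = here refl
∈-allℤ₄ z1 = there (here refl)
∈-allℤ₄ z2 = there (there (here refl))
∈-allℤ₄ z3 = there (there (there (here refl)))

∈-allWords : ∀ {n} (w : Word n) → w ∈ allWords n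
∈-allWords []      = here refl
∈-allWords {suc n} (a ∷ w) = ∈ₚ.∈-concatMap⁺ (λ a → List.map (a ∷_) (allWords n))
  (Any.map (λ { refl → ∈ₚ.∈-map⁺ (a ∷_) (∈-allWords w) }) (∈-allℤ₄ a))

AllPairs-lookup-injective : ∀ {A : Set} {_~_ : A → A → Set} {xs} → (∀ {x y} → x ~ y → y ~ x) →
  AllPairs (λ x y → ¬ x ~ y) xs → ∀ a b → List.lookup xs a ~ List.lookup xs b → a ≡ b
AllPairs-lookup-injective s (p AllPairs.∷ ps) zero    zero    _ = refl
AllPairs-lookup-injective s (p AllPairs.∷ ps) zero    (suc b) e = contradiction e (All.lookup p (∈ₚ.∈-lookup b))
AllPairs-lookup-injective s (p AllPairs.∷ ps) (suc a) zero    e = contradiction (s e) (All.lookup p (∈ₚ.∈-lookup a))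
AllPairs-lookup-injective s (p AllPairs.∷ ps) (suc a) (suc b) e = cong suc (AllPairs-lookup-injective s ps a b e)

≡ᵇ-complete : ∀ {a b} → a ≡ b → (a ≡ᵇ b) ≡ true
≡ᵇ-complete {a} {b} e = T⇒≡ (ℕₚ.≡⇒≡ᵇ a b e)

≡ᵇ-sound : ∀ {a b} → (a ≡ᵇ b) ≡ true → a ≡ b
≡ᵇ-sound {a} {b} e = ℕₚ.≡ᵇ⇒≡ a b (≡⇒T e)

∑-cast : ∀ {a b} (eq : a ≡ b) (f : ℤ₄ → ℤ) (w : Word a) →
  ∑F (λ j → f (lookup (Vec.cast eq w) j)) ≡ ∑F (λ j → f (lookup w j))
∑-cast refl f w = cong (λ w → ∑F (λ j → f (lookup w j))) (Vecₚ.cast-is-id refl w)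

cast-zipWith : ∀ {a b} (eq : a ≡ b) (f : ℤ₄ → ℤ₄ → ℤ₄) (x y : Word a) →
  Vec.cast eq (zipWith f x y) ≡ zipWith f (Vec.cast eq x) (Vec.cast eq y)
cast-zipWith refl f x y = trans (Vecₚ.cast-is-id refl _)
  (sym (cong₂ (zipWith f) (Vecₚ.cast-is-id refl x) (Vecₚ.cast-is-id refl y)))

lookup-kerdockWord : ∀ {m} R s ε i → lookup (kerdockWord {m} R s ε) i ≡ value R s ε (toBits m i)
lookup-kerdockWord R s ε i = Vecₚ.lookup∘tabulate _ i

dot-replicate : ∀ {n} a (w : Word n) → dot (Vec.replicate n a) w ≡ a ⊗ sum₄ w
dot-replicate a []      = sym (⊗-zeroʳ a)
dot-replicate a (b ∷ w) = trans (cong (a ⊗ b ⊕_) (dot-replicate a w)) (sym (⊗-distribˡ a b _))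

cast-replicate : ∀ {a b} (eq : a ≡ b) (e : ℤ₄) → Vec.cast eq (Vec.replicate a e) ≡ Vec.replicate b e
cast-replicate refl e = Vecₚ.cast-is-id refl _

removeAt-replicate : ∀ {l} (p : Fin (suc l)) (e : ℤ₄) → removeAt (Vec.replicate (suc l) e) p ≡ Vec.replicate l e
removeAt-replicate {l}     zero    e = refl
removeAt-replicate {suc l} (suc p) e = cong (e ∷_) (removeAt-replicate p e)

-w-w : ∀ {n} (x : Word n) → -w (-w x) ≡ x
-w-w []      = refl
-w-w (a ∷ x) = cong₂ _∷_ (lemma a) (-w-w x)
  where
  lemma : ∀ a → neg₄ (neg₄ a) ≡ a
  lemma = from-yes (all₄? λ a → neg₄ (neg₄ a) ≈? a)

-- Over an arbitrary predicate `inC`, since matching the Boolean searches with the lists `W j` is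
-- independent of the code.
module CosetClasses {n} (inC : Word n → Bool) where

  anyFin : ∀ {l} → (Fin l → Bool) → Bool
  anyFin f = BL.any f (allFin _)

  unit-class : Word n → Fin n → Bool
  unit-class d j = inC (d -w unit j) ∨ inC (d +w unit j)

  pair-class : Word n → Fin n → Fin n → Bool
  pair-class d j k = not (toℕ j ≡ᵇ toℕ k) ∧ inC (d -w (unit j -w unit k))

  classA : Fin 4 → Word n → Bool
  classA zero d = inC d
  classA (suc zero) d = anyFin (unit-class d)
  classA (suc (suc zero)) d = anyFin λ j → anyFin (pair-class d j)
  classA (suc (suc (suc zero))) d = anyFin λ j → inC (d -w (z2 ·w unit j))

  private
    anyFin⇒ : ∀ {l} (f : Fin l → Bool) → anyFin f ≡ true → ∃ λ j → f j ≡ true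
    anyFin⇒ f e = let j , _ , fj = any⇒ f (allFin _) e in j , fj

    ⇒anyFin : ∀ {l} (f : Fin l → Bool) j → f j ≡ true → anyFin f ≡ true
    ⇒anyFin f j = ⇒any f (∈ₚ.∈-allFin j)

    inner : Fin n → Fin n → List (Word n)
    inner j k = if toℕ j ≡ᵇ toℕ k then [] else (unit j -w unit k) ∷ []

  classA⇒ : ∀ j {d} → classA j d ≡ true → ∃ λ w → w ∈ W j × inC (d -w w) ≡ true
  classA⇒ zero {d} e = 0w , here refl , trans (cong inC (-w-identityʳ d)) e
  classA⇒ (suc zero) {d} e with anyFin⇒ (unit-class d) e
  ... | j , ej with inC (d -w unit j) in e₁
  ...   | true  = unit j , ∈ₚ.∈-++⁺ˡ (∈ₚ.∈-map⁺ unit (∈ₚ.∈-allFin j)) , e₁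
  ...   | false = -w unit j , ∈ₚ.∈-++⁺ʳ (List.map unit (allFin n)) (∈ₚ.∈-map⁺ (λ j → -w unit j) (∈ₚ.∈-allFin j)) ,
                  trans (cong (λ z → inC (d +w z)) (-w-w (unit j))) ej
  classA⇒ (suc (suc zero)) {d} e
    with anyFin⇒ (λ j → anyFin (pair-class d j)) e
  ... | j , ej with anyFin⇒ (pair-class d j) ej
  ...   | k , ek with toℕ j ≡ᵇ toℕ k in jk
  ...     | false = unit j -w unit k ,
    ∈ₚ.∈-concatMap⁺ (λ j → concatMap (inner j) (allFin n)) (Any.map (λ { refl →
      ∈ₚ.∈-concatMap⁺ (inner j) (Any.map (λ { refl → subst (λ b → (unit j -w unit k) ∈ (if b then [] else (unit j -w unit k) ∷ [])) (sym jk) (here refl) })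
        (∈ₚ.∈-allFin k)) }) (∈ₚ.∈-allFin j)) , ek
  classA⇒ (suc (suc (suc zero))) {d} e with anyFin⇒ (λ j → inC (d -w (z2 ·w unit j))) e
  ... | j , ej = z2 ·w unit j , ∈ₚ.∈-map⁺ (λ j → z2 ·w unit j) (∈ₚ.∈-allFin j) , ej

  ⇒classA : ∀ j {d w} → w ∈ W j → inC (d -w w) ≡ true → classA j d ≡ true
  ⇒classA zero {d} (here refl) e = trans (cong inC (sym (-w-identityʳ d))) e
  ⇒classA (suc zero) {d} {w} w∈ e with ∈ₚ.∈-++⁻ (List.map unit (allFin n)) w∈
  ... | inj₁ w∈₁ with ∈ₚ.∈-map⁻ unit w∈₁
  ...   | j , _ , refl = ⇒anyFin (unit-class d) j (cong (_∨ inC (d +w unit j)) e)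
  ⇒classA (suc zero) {d} {w} w∈ e | inj₂ w∈₂ with ∈ₚ.∈-map⁻ (λ j → -w unit j) w∈₂
  ...   | j , _ , refl = ⇒anyFin (unit-class d) j
    (trans (cong (inC (d -w unit j) ∨_) (trans (cong (λ z → inC (d +w z)) (sym (-w-w (unit j)))) e)) (Boolₚ.∨-zeroʳ _))
  ⇒classA (suc (suc zero)) {d} {w} w∈ e
    with find (∈ₚ.∈-concatMap⁻ (λ j → concatMap (inner j) (allFin n)) {allFin n} w∈)
  ... | j , _ , w∈j with find (∈ₚ.∈-concatMap⁻ (inner j) {allFin n} w∈j)
  ...   | k , _ , w∈jk = ⇒anyFin (λ j → anyFin (pair-class d j)) j
                           (⇒anyFin (pair-class d j) k both)
    where
    select : ∀ b → w ∈ (if b then [] else (unit j -w unit k) ∷ []) → (not b ∧ inC (d -w (unit j -w unit k))) ≡ true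
    select false (here refl) = e
    both : pair-class d j k ≡ true
    both = select (toℕ j ≡ᵇ toℕ k) w∈jk
  ⇒classA (suc (suc (suc zero))) {d} {w} w∈ e with ∈ₚ.∈-map⁻ (λ j → z2 ·w unit j) w∈
  ... | j , _ , refl = ⇒anyFin (λ j → inC (d -w (z2 ·w unit j))) j e

module KerdockCode (k : ℕ) (S : List (BinMat (suc (k ℕ.+ k)))) (kerdock : IsKerdockSet (suc (k ℕ.+ k)) S)
  (z4linear : IsZ4Linear (kerdockCode S)) (i : Fin (2 ^ suc (k ℕ.+ k))) where

  m : ℕ
  m = suc (k ℕ.+ k)

  open Setting m S i
  open IsKerdockSet kerdock using (symmetric; nonsing)
  open IsZ4Linear z4linear

  u : ℤ
  u = + 2 ^ k

  v₀ : Bits m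
  v₀ = toBits m i

  short : Word (2 ^ m) → Word n
  short w = removeAt (Vec.cast (q≡ m) w) pos

  short-zipWith : ∀ f x y → short (zipWith f x y) ≡ zipWith f (short x) (short y)
  short-zipWith f x y = trans (cong (λ w → removeAt w pos) (cast-zipWith (q≡ m) f x y)) (removeAt-zipWith f (Vec.cast (q≡ m) x) (Vec.cast (q≡ m) y) pos)

  short-neg : ∀ x → short (-w x) ≡ -w short x
  short-neg x = trans (cong (λ w → removeAt w pos) (sym (Vecₚ.map-cast neg₄ (q≡ m) x))) (removeAt-map neg₄ (Vec.cast (q≡ m) x) pos)

  short-- : ∀ x y → short (x -w y) ≡ short x -w short y
  short-- x y = trans (short-zipWith _⊕_ x (-w y)) (cong (short x +w_) (short-neg y))

  ∑-short : ∀ f w → lookup w i ≡ z0 → ∑F (λ j → f (lookup (short w) j)) ≡ ∑F (λ j → f (lookup w j)) - f z0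
  ∑-short f w e = begin
    Z                                      ≡⟨ cancel (f z0) Z ⟩
    (f z0 + Z) - f z0                      ≡⟨ cong (λ a → f a + Z - f z0) (sym (trans (Vecₚ.lookup-cast (q≡ m) w i) e)) ⟩
    (f (lookup w′ pos) + Z) - f z0         ≡⟨ cong (_- f z0) (sym (∑-removeAt f w′ pos)) ⟩
    ∑F (λ j → f (lookup w′ j)) - f z0      ≡⟨ cong (_- f z0) (∑-cast (q≡ m) f w) ⟩
    ∑F (λ j → f (lookup w j)) - f z0 ∎
    where
    open ≡-Reasoning
    w′ = Vec.cast (q≡ m) w
    Z = ∑F (λ j → f (lookup (short w) j))
    cancel : ∀ a b → b ≡ (a + b) - a
    cancel = solve-∀

  code⁻ : ∀ {w} → w ∈ kerdockCode S → ∃ λ a → ∃ λ s → ∃ λ ε → w ≡ kerdockWord (List.lookup S a) s ε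
  code⁻ {w} w∈ = a , s , ε , w≡
    where
    words : BinMat m → Bits m → List (Word (2 ^ m))
    words R s = List.map (kerdockWord R s) allℤ₄
    inS = ∈ₚ.∈-concatMap⁻ (λ R → concatMap (words R) (allBits m)) {S} w∈
    a = Any.index inS
    inBits = find (∈ₚ.∈-concatMap⁻ (words (List.lookup S a)) {allBits m} (Anyₚ.lookup-index inS))
    s = proj₁ inBits
    inℤ₄ = ∈ₚ.∈-map⁻ (kerdockWord (List.lookup S a) s) (proj₂ (proj₂ inBits))
    ε = proj₁ inℤ₄
    w≡ = proj₂ (proj₂ inℤ₄)

  code⁺ : ∀ a s ε → kerdockWord (List.lookup S a) s ε ∈ kerdockCode S
  code⁺ a s ε = ∈ₚ.∈-concatMap⁺ (λ R → concatMap (words R) (allBits m)) {S} {w} (Any.map in-row (∈ₚ.∈-lookup a))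
    where
    words : BinMat m → Bits m → List (Word (2 ^ m))
    words R s = List.map (kerdockWord R s) allℤ₄
    w : Word (2 ^ m)
    w = kerdockWord (List.lookup S a) s ε
    in-words : ∀ {t} → s ≡ t → w ∈ words (List.lookup S a) t
    in-words refl = ∈ₚ.∈-map⁺ (kerdockWord (List.lookup S a) s) (∈-allℤ₄ ε)
    in-row : ∀ {R} → List.lookup S a ≡ R → w ∈ concatMap (words R) (allBits m)
    in-row refl = ∈ₚ.∈-concatMap⁺ (words (List.lookup S a)) {allBits m} {w} (Any.map in-words (∈-allBits s))

  Kshort⁻ : ∀ {x} → x ∈ Kshort → ∃ λ w → w ∈ kerdockCode S × lookup w i ≡ z0 × x ≡ short w
  Kshort⁻ {x} x∈ with ∈ₚ.∈-map⁻ (λ w → removeAt w pos) (∈ₚ.∈-deduplicate⁻ _≟w_ _ x∈)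
  ... | w′ , w′∈ , x≡ with ∈ₚ.∈-filter⁻ (λ w → lookup w pos ≟₄ z0) {xs = K} w′∈
  ...   | w′∈K , z with ∈ₚ.∈-map⁻ (Vec.cast (q≡ m)) w′∈K
  ...     | w , w∈ , refl = w , w∈ , trans (sym (Vecₚ.lookup-cast (q≡ m) w i)) z , x≡

  Kshort⁺ : ∀ {w} → w ∈ kerdockCode S → lookup w i ≡ z0 → short w ∈ Kshort
  Kshort⁺ {w} w∈ z = ∈ₚ.∈-deduplicate⁺ _≟w_ (∈ₚ.∈-map⁺ (λ w → removeAt w pos)
    (∈ₚ.∈-filter⁺ (λ w → lookup w pos ≟₄ z0) (∈ₚ.∈-map⁺ (Vec.cast (q≡ m)) w∈) (trans (Vecₚ.lookup-cast (q≡ m) w i) z)))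

  Kshort-injective : ∀ a b → elK a ≡ elK b → a ≡ b
  Kshort-injective = AllPairs-lookup-injective sym (Uniqueₚ.deduplicate-! (≡-decSetoid _≟w_)
    (List.map (λ w → removeAt w pos) (List.filter (λ w → lookup w pos ≟₄ z0) K)))

  short-0w : short 0w ≡ 0w
  short-0w = trans (cong short (sym (-w-inverse 0w))) (trans (short-- 0w 0w) (-w-inverse (short 0w)))

  0∈Kshort : 0w ∈ Kshort
  0∈Kshort = subst (_∈ Kshort) short-0w (Kshort⁺ has-zero (Vecₚ.lookup-replicate i z0))

  +∈Kshort : ∀ {x y} → x ∈ Kshort → y ∈ Kshort → (x +w y) ∈ Kshort
  +∈Kshort x∈ y∈ with Kshort⁻ x∈ | Kshort⁻ y∈
  ... | w , w∈ , z , refl | w′ , w′∈ , z′ , refl = subst (_∈ Kshort) (short-zipWith _⊕_ w w′)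
    (Kshort⁺ (closed-add w w′ w∈ w′∈) (trans (Vecₚ.lookup-zipWith _⊕_ i w w′) (cong₂ _⊕_ z z′)))

  -∈Kshort : ∀ {x y} → x ∈ Kshort → y ∈ Kshort → (x -w y) ∈ Kshort
  -∈Kshort {x} x∈ y∈ with Kshort⁻ y∈
  ... | w , w∈ , z , refl = +∈Kshort x∈ (subst (_∈ Kshort) (short-neg w)
    (Kshort⁺ (closed-neg w w∈) (trans (Vecₚ.lookup-map i neg₄ w) (cong neg₄ z))))

  n≡ : + n ≡ + 2 * (u * u) - 1ℤ
  n≡ = trans (cancel (+ n)) (cong (_- 1ℤ) (trans (cong +_ (sym (q≡ m))) (q≡2u² k)))
    where
    cancel : ∀ a → a ≡ (1ℤ + a) - 1ℤ
    cancel = solve-∀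

  -- Besides classifying the words of `Kshort`, it yields through its last component that a
  -- shortened codeword determines R and s, the injectivity behind the bound |K_short| ≥ q².
  difference-type : ∀ a s ε a′ s′ ε′ →
    let d = kerdockWord (List.lookup S a) s ε -w kerdockWord (List.lookup S a′) s′ ε′ in
    lookup d i ≡ z0 → ∃ λ t → Type u t (short d) × (t ≡ zero → a ≡ a′ × s ≡ s′)
  difference-type a s ε a′ s′ ε′ d₀ = let t , ft , z = classify in t , shorten ft , z
    where
    R R′ : BinMat m
    R  = List.lookup S a
    R′ = List.lookup S a′
    open Difference k R R′ s s′ ε ε′ v₀ using (c; FullType-c; quadratic; affine; constant)
    d : Word (2 ^ m)
    d = kerdockWord R s ε -w kerdockWord R′ s′ ε′
    lookup-d : ∀ j → lookup d j ≡ c (toBits m j)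
    lookup-d j = trans (Vecₚ.lookup-zipWith _⊕_ j (kerdockWord R s ε) _)
      (cong₂ _⊕_ (lookup-kerdockWord R s ε j)
        (trans (Vecₚ.lookup-map j neg₄ (kerdockWord R′ s′ ε′)) (cong neg₄ (lookup-kerdockWord R′ s′ ε′ j))))
    c₀ : c v₀ ≡ z0
    c₀ = trans (sym (lookup-d i)) d₀
    classify : ∃ λ t → FullType-c t × (t ≡ zero → a ≡ a′ × s ≡ s′)
    classify with a Fin.≟ a′
    ... | no a≢a′ = let t , t≢0 , ft = quadratic (symmetric a) (symmetric a′) (nonsing a a′ a≢a′) c₀
                    in t , ft , λ t≡0 → contradiction t≡0 t≢0
    ... | yes a≡a′ with Vecₚ.≡-dec Bool._≟_ s s′
    ...   | yes s≡s′ = zero , constant (cong (List.lookup S) a≡a′) s≡s′ c₀ , λ _ → a≡a′ , s≡s′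
    ...   | no  s≢s′ = suc (suc (suc zero)) , affine (cong (List.lookup S) a≡a′) s≢s′ c₀ , λ ()
    sums : ∀ f → ∑F (λ j → f (lookup (short d) j)) ≡ ∑B (f ∘ c) - f z0
    sums f = trans (∑-short f d d₀) (cong (_- f z0)
      (trans (∑-cong (allFin (2 ^ m)) λ j → cong f (lookup-d j)) (∑F-toBits m (f ∘ c))))
    shorten : ∀ {t} → FullType-c t → Type u t (short d)
    shorten ft = record
      { single = trans (cong (_*_ (+ 2)) (sums re)) (FullType.single ft)
      ; pairs  = trans (cong₂ _-_ (cong₂ (λ a b → a * a + b * b) (sums re)
                   (trans (sums im) (ℤₚ.+-identityʳ (∑B (im ∘ c))))) n≡) (FullType.pairs ft)
      ; double = trans (sums (λ a → re (a ⊕ a))) (FullType.double ft)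
      }

  codeword-type : ∀ {w} → w ∈ kerdockCode S → lookup w i ≡ z0 → ∃ λ t → Type u t (short w)
  codeword-type {w} w∈ z =
    let a , s , ε , w≡ = code⁻ w∈
        -- Only differences are classified, so `w` is read as `w` minus the zero word, in whatever
        -- parametrisation the latter has.
        a′ , s′ , ε′ , 0≡ = code⁻ has-zero
        w≡′ = trans (sym (-w-identityʳ w)) (cong₂ _-w_ w≡ 0≡)
        t , ty , _ = difference-type a s ε a′ s′ ε′ (trans (cong (λ w → lookup w i) (sym w≡′)) z)
    in t , subst (Type u t) (cong short (sym w≡′)) ty

  types : ∀ {x} → x ∈ Kshort → ∃ λ t → Type u t x
  types x∈ =
    let w , w∈ , z , x≡ = Kshort⁻ x∈
        t , ty = codeword-type w∈ z
    in t , subst (Type u t) (sym x≡) ty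

  -- A codeword vanishing at position i does not see the letter inserted there.
  inC⇒⊥ : ∀ {w} → inC w ≡ true → ∀ {x} → x ∈ Kshort → dot x w ≡ z0
  inC⇒⊥ {y} e x∈ = perp (any⇒ (λ a → inP (insertAt y pos a)) allℤ₄ e) (Kshort⁻ x∈)
    where
    open ≡-Reasoning
    isZero₄⇒ : ∀ {a} → T (isZero₄ a) → a ≡ z0
    isZero₄⇒ {z0} _ = refl
    perp : ∀ {x} → (∃ λ a → a ∈ allℤ₄ × inP (insertAt y pos a) ≡ true) →
           (∃ λ w → w ∈ kerdockCode S × lookup w i ≡ z0 × x ≡ short w) → dot x y ≡ z0
    perp (a , _ , inPa) (w , w∈ , z , refl) = begin
      dot (short w) y
        ≡⟨ cong (λ b → b ⊗ a ⊕ dot (short w) y) (sym (trans (Vecₚ.lookup-cast (q≡ m) w i) z)) ⟩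
      lookup (Vec.cast (q≡ m) w) pos ⊗ a ⊕ dot (short w) y
        ≡⟨ sym (dot-insertAt (Vec.cast (q≡ m) w) y pos a) ⟩
      dot (Vec.cast (q≡ m) w) (insertAt y pos a)
        ≡⟨ isZero₄⇒ (All.lookup (Allₚ.all⁺ (λ k → isZero₄ (dot k (insertAt y pos a))) K (≡⇒T inPa))
             (∈ₚ.∈-map⁺ (Vec.cast (q≡ m)) w∈)) ⟩
      z0 ∎

  module _ {y : Word n} (perp : ∀ {x} → x ∈ Kshort → dot x y ≡ z0) where

    private
      module _ (a : Fin (List.length S)) (s : Bits m) (ε : ℤ₄) where
        R : BinMat m
        R = List.lookup S a
        w w₁ : Word (2 ^ m)
        w = kerdockWord R s ε
        e ε₁ : ℤ₄
        e = lookup w i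
        -- Subtracting the constant word e from w yields a codeword that vanishes at i.
        ε₁ = ε ⊕ neg₄ e
        w₁ = kerdockWord R s ε₁

        shift : ∀ j → lookup w₁ j ≡ lookup w j ⊕ neg₄ e
        shift j = trans (lookup-kerdockWord R s ε₁ j)
          (trans (sym (⊕-assoc (T-form R (toBits m j) ⊕ twoDot s (toBits m j)) ε (neg₄ e)))
            (cong (_⊕ neg₄ e) (sym (lookup-kerdockWord R s ε j))))

        w₁≡ : w₁ ≡ w -w Vec.replicate (2 ^ m) e
        w₁≡ = trans (sym (Vecₚ.tabulate∘lookup w₁)) (trans (Vecₚ.tabulate-cong λ j → trans (shift j)
          (sym (trans (Vecₚ.lookup-zipWith _⊕_ j w (-w Vec.replicate (2 ^ m) e))
            (cong (lookup w j ⊕_) (trans (Vecₚ.lookup-map j neg₄ (Vec.replicate (2 ^ m) e)) (cong neg₄ (Vecₚ.lookup-replicate j e)))))))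
          (Vecₚ.tabulate∘lookup (w -w Vec.replicate (2 ^ m) e)))

        short-constant : short (Vec.replicate (2 ^ m) e) ≡ Vec.replicate n e
        short-constant = trans (cong (λ w → removeAt w pos) (cast-replicate (q≡ m) e)) (removeAt-replicate pos e)

        dot-short : dot (short w) y ⊕ neg₄ (e ⊗ sum₄ y) ≡ z0
        dot-short = begin
          dot (short w) y ⊕ neg₄ (e ⊗ sum₄ y)
            ≡⟨ cong (λ z → dot (short w) y ⊕ neg₄ z) (sym (dot-replicate e y)) ⟩
          dot (short w) y ⊕ neg₄ (dot (Vec.replicate n e) y)
            ≡⟨ sym (dot--ˡ (short w) (Vec.replicate n e) y) ⟩
          dot (short w -w Vec.replicate n e) y
            ≡⟨ cong (λ z → dot (short w -w z) y) (sym short-constant) ⟩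
          dot (short w -w short (Vec.replicate (2 ^ m) e)) y
            ≡⟨ cong (λ z → dot z y) (trans (sym (short-- w (Vec.replicate (2 ^ m) e))) (cong short (sym w₁≡))) ⟩
          dot (short w₁) y
            ≡⟨ perp (Kshort⁺ (code⁺ a s ε₁) (trans (shift i) (⊕-inverseʳ e))) ⟩
          z0 ∎
          where open ≡-Reasoning

        -- The letter - Σ y is forced: changing ε by 1 changes a codeword by the all-one word, to
        -- which the extension of y must be orthogonal.
        dot-extended : dot (Vec.cast (q≡ m) w) (insertAt y pos (neg₄ (sum₄ y))) ≡ z0
        dot-extended = begin
          dot (Vec.cast (q≡ m) w) (insertAt y pos (neg₄ (sum₄ y)))
            ≡⟨ dot-insertAt (Vec.cast (q≡ m) w) y pos (neg₄ (sum₄ y)) ⟩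
          lookup (Vec.cast (q≡ m) w) pos ⊗ neg₄ (sum₄ y) ⊕ dot (short w) y
            ≡⟨ cong (_⊕ dot (short w) y) (trans (cong (_⊗ neg₄ (sum₄ y)) (Vecₚ.lookup-cast (q≡ m) w i)) (neg-⊗ʳ e (sum₄ y))) ⟩
          neg₄ (e ⊗ sum₄ y) ⊕ dot (short w) y
            ≡⟨ trans (⊕-comm (neg₄ (e ⊗ sum₄ y)) (dot (short w) y)) dot-short ⟩
          z0 ∎
          where open ≡-Reasoning

    ⊥⇒inC : inC y ≡ true
    ⊥⇒inC = ⇒any (λ a → inP (insertAt y pos a)) (∈-allℤ₄ (neg₄ (sum₄ y)))
      (T⇒≡ (Allₚ.all⁻ (λ k → isZero₄ (dot k (insertAt y pos (neg₄ (sum₄ y))))) (All.tabulate λ w∈ →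
        subst (T ∘ isZero₄) (sym (zeros (∈ₚ.∈-map⁻ (Vec.cast (q≡ m)) w∈))) tt)))
      where
      zeros : ∀ {w′} → (∃ λ w → w ∈ kerdockCode S × w′ ≡ Vec.cast (q≡ m) w) →
              dot w′ (insertAt y pos (neg₄ (sum₄ y))) ≡ z0
      zeros (w , w∈ , refl) = let a , s , ε , w≡ = code⁻ w∈ in
        trans (cong (λ w → dot (Vec.cast (q≡ m) w) (insertAt y pos (neg₄ (sum₄ y)))) w≡) (dot-extended a s ε)

  inC-combine : ∀ {x y w} (f : ℤ₄ → ℤ₄ → ℤ₄) → f z0 z0 ≡ z0 →
    (∀ z → dot z w ≡ f (dot z x) (dot z y)) → inC x ≡ true → inC y ≡ true → inC w ≡ true
  inC-combine f f0 e ix iy = ⊥⇒inC λ {z} z∈ → trans (e z) (trans (cong₂ f (inC⇒⊥ ix z∈) (inC⇒⊥ iy z∈)) f0)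

  cosetSetoid : DecSetoid _ _
  cosetSetoid = record
    { Carrier = Word n ; _≈_ = λ x y → T (inC (x -w y))
    ; isDecEquivalence = record
      { isEquivalence = record
        { refl  = λ {x} → ≡⇒T (⊥⇒inC λ {z} _ → trans (dot--ʳ z x x) (⊕-inverseʳ (dot z x)))
        ; sym   = λ {x} {y} e → ≡⇒T (inC-combine (λ a _ → neg₄ a) refl (λ z →
                    trans (dot--ʳ z y x) (trans (flip (dot z x) (dot z y)) (cong neg₄ (sym (dot--ʳ z x y))))) (T⇒≡ e) (T⇒≡ e))
        ; trans = λ {x} {y} {w} e f → ≡⇒T (inC-combine _⊕_ refl (λ z → trans (dot--ʳ z x w)
                    (trans (chain (dot z x) (dot z y) (dot z w)) (sym (cong₂ _⊕_ (dot--ʳ z x y) (dot--ʳ z y w))))) (T⇒≡ e) (T⇒≡ f))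
        }
      ; _≟_ = λ x y → T? (inC (x -w y))
      }
    }
    where
    flip : ∀ a b → b ⊕ neg₄ a ≡ neg₄ (a ⊕ neg₄ b)
    flip = from-yes (all₄? λ a → all₄? λ b → b ⊕ neg₄ a ≈? neg₄ (a ⊕ neg₄ b))
    chain : ∀ a b c → a ⊕ neg₄ c ≡ (a ⊕ neg₄ b) ⊕ (b ⊕ neg₄ c)
    chain = from-yes (all₄? λ a → all₄? λ b → all₄? λ c → a ⊕ neg₄ c ≈? (a ⊕ neg₄ b) ⊕ (b ⊕ neg₄ c))

  module CosetSetoid = DecSetoid cosetSetoid

  reps-injective : ∀ a b → inC (elA a -w elA b) ≡ true → a ≡ b
  reps-injective a b e = AllPairs-lookup-injective {_~_ = λ x y → T (inC (x -w y))}
    (λ {x} {y} → CosetSetoid.sym {x} {y}) (Uniqueₚ.deduplicate-! cosetSetoid (allWords n)) a b (≡⇒T e)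

  reps-cover : ∀ w → ∃ λ a → inC (elA a -w w) ≡ true
  reps-cover w = Any.index rep , T⇒≡ (Anyₚ.lookup-index rep)
    where
    rep = Anyₚ.deduplicate⁺ (λ x y → T? (inC (x -w y))) {P = λ x → T (inC (x -w w))}
      (λ {y} {x} x≈y y≈w → CosetSetoid.trans {x} {y} {w} x≈y y≈w)
      (Any.map (λ { refl → CosetSetoid.refl {w} }) (∈-allWords w))

  classA-unfold : ∀ j d → classA j d ≡ CosetClasses.classA inC j d
  classA-unfold zero                   d = refl
  classA-unfold (suc zero)             d = refl
  classA-unfold (suc (suc zero))       d = refl
  classA-unfold (suc (suc (suc zero))) d = refl

  classA⇒ : ∀ j {d} → classA j d ≡ true → ∃ λ w → w ∈ W j × inC (d -w w) ≡ true
  classA⇒ j {d} e = CosetClasses.classA⇒ inC j (trans (sym (classA-unfold j d)) e)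

  ⇒classA : ∀ j {d w} → w ∈ W j → inC (d -w w) ≡ true → classA j d ≡ true
  ⇒classA j {d} w∈ e = trans (classA-unfold j d) (CosetClasses.⇒classA inC j w∈ e)

-- Valencies, Lee weights and eigenmatrix entries

-- `⌈ n /2⌉` is `⌊ suc n /2⌋` by definition.
half : ∀ k → ⌊ suc (k ℕ.+ k) /2⌋ ≡ k
half k = sym (ℕₚ.n≡⌈n+n/2⌉ k)

opaque
  unfolding size

  size≡q² : ∀ k → size (+ 2 ^ k) ≡ + (2 ^ suc (k ℕ.+ k) ℕ.* 2 ^ suc (k ℕ.+ k))
  size≡q² k = sym (trans (ℤₚ.pos-* (2 ^ suc (k ℕ.+ k)) (2 ^ suc (k ℕ.+ k)))
    (trans (cong₂ _*_ (q≡2u² k) (q≡2u² k)) (square (+ 2 ^ k))))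
    where
    square : ∀ u → + 2 * (u * u) * (+ 2 * (u * u)) ≡ + 4 * (u * u * (u * u))
    square = solve-∀

size>0 : ∀ k → 0ℤ ℤ.< size (+ 2 ^ k)
size>0 k = subst (0ℤ ℤ.<_) (sym (size≡q² k))
  (ℤ.+<+ (ℕₚ.*-mono-< (ℕₚ.m^n>0 2 (suc (k ℕ.+ k))) (ℕₚ.m^n>0 2 (suc (k ℕ.+ k)))))

*-≢0 : ∀ {a b} → a ≢ 0ℤ → b ≢ 0ℤ → a * b ≢ 0ℤ
*-≢0 {a} a≢0 b≢0 e with ℤₚ.i*j≡0⇒i≡0∨j≡0 a e
... | inj₁ a≡0 = a≢0 a≡0
... | inj₂ b≡0 = b≢0 b≡0

-- Up to constants, the entries of the two first rows are products of u, u - 1, u + 1 and 2u² - 1.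
-- The form u = v + 2 excludes u = 1, where u - 1 would make some of them zero.
module Row₀ (v : ℕ) where

  private
    u : ℤ
    u = + suc (suc v)

    n-≢0 : + 2 * (u * u) - 1ℤ ≢ 0ℤ
    -- Otherwise 2 would divide 1.
    n-≢0 e = contradiction (ℕₚ.m*n≡1⇒m≡1 2 (suc (suc v) ℕ.* suc (suc v)) (ℤₚ.+-injective
      (trans (trans (ℤₚ.pos-* 2 (suc (suc v) ℕ.* suc (suc v))) (cong (_*_ (+ 2)) (ℤₚ.pos-* (suc (suc v)) (suc (suc v)))))
        (ℤₚ.i-j≡0⇒i≡j (+ 2 * (u * u)) 1ℤ e)))) λ ()

    nonzero : ∀ {a b} → a ≡ b → b ≢ 0ℤ → a ≢ 0ℤ
    nonzero a≡b b≢0 a≡0 = b≢0 (trans (sym a≡b) a≡0)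

    u-1≢0 : u - 1ℤ ≢ 0ℤ
    u-1≢0 ()
    u+1≢0 : u + 1ℤ ≢ 0ℤ
    u+1≢0 ()

  opaque
    unfolding Pz Qz

    Pz-row₀≢0 : ∀ j → Pz u zero j ≢ 0ℤ
    Pz-row₀≢0 zero                   = λ ()
    Pz-row₀≢0 (suc zero)             = *-≢0 {u * u - u} (nonzero (factor u) (*-≢0 {u} {u - 1ℤ} (λ ()) u-1≢0)) n-≢0
      where
      factor : ∀ u → u * u - u ≡ u * (u - 1ℤ)
      factor = solve-∀
    Pz-row₀≢0 (suc (suc zero))       = *-≢0 {u * u + u} (nonzero (factor u) (*-≢0 {u} {u + 1ℤ} (λ ()) u+1≢0)) n-≢0
      where
      factor : ∀ u → u * u + u ≡ u * (u + 1ℤ)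
      factor = solve-∀
    Pz-row₀≢0 (suc (suc (suc zero))) = n-≢0

    Qz-row₀≢0 : ∀ j → Qz u zero j ≢ 0ℤ
    Qz-row₀≢0 zero                   = λ ()
    Qz-row₀≢0 (suc zero)             = nonzero (factor u) (*-≢0 {+ 2} {+ 2 * (u * u) - 1ℤ} (λ ()) n-≢0)
      where
      factor : ∀ u → + 4 * (u * u) - + 2 ≡ + 2 * (+ 2 * (u * u) - 1ℤ)
      factor = solve-∀
    Qz-row₀≢0 (suc (suc zero))       = *-≢0 {+ 2 * (u * u) - 1ℤ} n-≢0
      (nonzero (factor u) (*-≢0 {+ 2} {(u - 1ℤ) * (u + 1ℤ)} (λ ()) (*-≢0 {u - 1ℤ} {u + 1ℤ} u-1≢0 u+1≢0)))
      where
      factor : ∀ u → + 2 * (u * u) - + 2 ≡ + 2 * ((u - 1ℤ) * (u + 1ℤ))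
      factor = solve-∀
    Qz-row₀≢0 (suc (suc (suc zero))) = n-≢0

module LeeWeights (k : ℕ) where

  m q U : ℕ
  m = suc (k ℕ.+ k)
  q = 2 ^ m
  U = 2 ^ ⌊ m /2⌋

  u : ℤ
  u = + 2 ^ k

  weight : Fin 4 → ℕ
  weight zero                   = 0
  weight (suc zero)             = q ℕ.+ U
  weight (suc (suc zero))       = q ∸ U
  weight (suc (suc (suc zero))) = q

  U≡u : + U ≡ u
  U≡u = cong (λ z → + 2 ^ z) (half k)

  U<q : U ℕ.< q
  U<q = ℕₚ.^-monoʳ-< 2 (s≤s (s≤s z≤n)) (subst (ℕ._< m) (sym (half k)) (s≤s (ℕₚ.m≤m+n k k)))

  0<q : 0 ℕ.< q
  0<q = ℕₚ.m^n>0 2 m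

  0<U : 0 ℕ.< U
  0<U = ℕₚ.m^n>0 2 ⌊ m /2⌋

  q-U<q : q ∸ U ℕ.< q
  q-U<q = ℕₚ.∸-monoʳ-< 0<U (ℕₚ.<⇒≤ U<q)

  q<q+U : q ℕ.< q ℕ.+ U
  q<q+U = ℕₚ.m<m+n q 0<U

  opaque
    unfolding Qz

    -- The Lee weight is n - `Sre`, and column 1 of Q is 2 `Sre`; the equation is doubled to stay in
    -- `ℤ`.
    weight≡ : ∀ t → + 2 * + weight t ≡ + 2 * (+ 2 * (u * u) - 1ℤ) - Qz u t (suc zero)
    weight≡ zero = ring u
      where
      ring : ∀ u → + 0 ≡ + 2 * (+ 2 * (u * u) - 1ℤ) - (+ 4 * (u * u) - + 2)
      ring = solve-∀
    weight≡ (suc zero) = trans (cong (_*_ (+ 2)) (cong₂ _+_ (q≡2u² k) U≡u)) (ring u)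
      where
      ring : ∀ u → + 2 * (+ 2 * (u * u) + u) ≡ + 2 * (+ 2 * (u * u) - 1ℤ) - (- (+ 2 * u) - + 2)
      ring = solve-∀
    weight≡ (suc (suc zero)) = trans (cong (_*_ (+ 2)) (trans (sym (trans (ℤₚ.m-n≡m⊖n q U) (ℤₚ.⊖-≥ (ℕₚ.<⇒≤ U<q))))
      (cong₂ _-_ (q≡2u² k) U≡u))) (ring u)
      where
      ring : ∀ u → + 2 * (+ 2 * (u * u) - u) ≡ + 2 * (+ 2 * (u * u) - 1ℤ) - (+ 2 * u - + 2)
      ring = solve-∀
    weight≡ (suc (suc (suc zero))) = trans (cong (_*_ (+ 2)) (q≡2u² k)) (ring u)
      where
      ring : ∀ u → + 2 * (+ 2 * (u * u)) ≡ + 2 * (+ 2 * (u * u) - 1ℤ) - - (+ 2)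
      ring = solve-∀

  leeWeight≡ : ∀ {n t} {d : Word n} → + n ≡ + 2 * (u * u) - 1ℤ → Type u t d → leeWeight d ≡ weight t
  leeWeight≡ {n} {t} {d} n≡ ty = ℤₚ.+-injective (ℤₚ.*-cancelˡ-≡ (+ 2) _ _ (begin
    + 2 * + leeWeight d                                    ≡⟨ cong (_*_ (+ 2)) (leeWeight-Sre d) ⟩
    + 2 * (+ n - Sre d)                                    ≡⟨ ℤₚ.*-distribˡ-+ (+ 2) (+ n) (- Sre d) ⟩
    + 2 * + n + + 2 * - Sre d                              ≡⟨ cong (_+_ (+ 2 * + n)) (sym (ℤₚ.neg-distribʳ-* (+ 2) (Sre d))) ⟩
    + 2 * + n - + 2 * Sre d                                ≡⟨ cong₂ (λ a b → + 2 * a - b) n≡ (Type.single ty) ⟩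
    + 2 * (+ 2 * (u * u) - 1ℤ) - Qz u t (suc zero)         ≡⟨ sym (weight≡ t) ⟩
    + 2 * + weight t ∎))
    where open ≡-Reasoning

  weight-injective : ∀ a b → weight a ≡ weight b → a ≡ b
  weight-injective zero zero _ = refl
  weight-injective zero (suc zero) e = contradiction e (ℕₚ.<⇒≢ (ℕₚ.<-trans 0<q q<q+U))
  weight-injective zero (suc (suc zero)) e = contradiction e (ℕₚ.<⇒≢ (ℕₚ.m<n⇒0<n∸m U<q))
  weight-injective zero (suc (suc (suc zero))) e = contradiction e (ℕₚ.<⇒≢ 0<q)
  weight-injective (suc zero) zero e = contradiction (sym e) (ℕₚ.<⇒≢ (ℕₚ.<-trans 0<q q<q+U))
  weight-injective (suc zero) (suc zero) _ = refl
  weight-injective (suc zero) (suc (suc zero)) e = contradiction (sym e) (ℕₚ.<⇒≢ (ℕₚ.<-trans q-U<q q<q+U))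
  weight-injective (suc zero) (suc (suc (suc zero))) e = contradiction (sym e) (ℕₚ.<⇒≢ q<q+U)
  weight-injective (suc (suc zero)) zero e = contradiction (sym e) (ℕₚ.<⇒≢ (ℕₚ.m<n⇒0<n∸m U<q))
  weight-injective (suc (suc zero)) (suc zero) e = contradiction e (ℕₚ.<⇒≢ (ℕₚ.<-trans q-U<q q<q+U))
  weight-injective (suc (suc zero)) (suc (suc zero)) _ = refl
  weight-injective (suc (suc zero)) (suc (suc (suc zero))) e = contradiction e (ℕₚ.<⇒≢ q-U<q)
  weight-injective (suc (suc (suc zero))) zero e = contradiction (sym e) (ℕₚ.<⇒≢ 0<q)
  weight-injective (suc (suc (suc zero))) (suc zero) e = contradiction e (ℕₚ.<⇒≢ q<q+U)
  weight-injective (suc (suc (suc zero))) (suc (suc zero)) e = contradiction (sym e) (ℕₚ.<⇒≢ q-U<q)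
  weight-injective (suc (suc (suc zero))) (suc (suc (suc zero))) _ = refl

  weight-≡ᵇ : ∀ a b → (weight a ≡ᵇ weight b) ≡ (a == b)
  weight-≡ᵇ a b with a Fin.≟ b
  ... | yes refl = ≡ᵇ-complete {weight a} refl
  ... | no a≢b with weight a ≡ᵇ weight b in e
  ...   | false = refl
  ...   | true  = contradiction (weight-injective a b (≡ᵇ-sound e)) a≢b

-- Passage from the integral to the rational eigenmatrices

ι-neg : ∀ a → ι (- a) ≡ ℚ.- ι a
ι-neg (+ zero)  = refl
ι-neg (+ suc n) = refl
ι-neg -[1+ n ]  = sym (⁻¹-involutive ℚₚ.+-0-group (ι (+ suc n)))

-- A small calculus that follows a rational expression together with its integer value; the
-- divisions by 2, 4 and 8 in the eigenmatrices are exact once N = 4u² and √N = 2u.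
module Integrality where

  infixl 6 _⟨+⟩_ _⟨-⟩_
  infixl 7 _⟨*⟩_

  -- A record rather than the bare equation, so that the integer can be inferred.
  record _Is_ (X : ℚ) (a : ℤ) : Set where
    constructor is
    field eq : X ≡ ι a
  open _Is_

  _⟨+⟩_ : ∀ {X Y a b} → X Is a → Y Is b → (X ℚ.+ Y) Is (a + b)
  _⟨+⟩_ {a = a} {b} (is refl) (is refl) = is (sym (ι-+ a b))

  ⟨-_⟩ : ∀ {X a} → X Is a → (ℚ.- X) Is (- a)
  ⟨-_⟩ {a = a} (is refl) = is (sym (ι-neg a))

  _⟨-⟩_ : ∀ {X Y a b} → X Is a → Y Is b → (X ℚ.- Y) Is (a - b)
  p ⟨-⟩ q = p ⟨+⟩ ⟨- q ⟩

  _⟨*⟩_ : ∀ {X Y a b} → X Is a → Y Is b → (X ℚ.* Y) Is (a * b)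
  _⟨*⟩_ {a = a} {b} (is refl) (is refl) = is (sym (ι-* a b))

  divide : ∀ k .{{_ : NonZero k}} {X a} b → X Is a → a ≡ + k * b → (X ÷ k) Is b
  divide k b (is refl) refl = is (ι-÷ k b)

  module _ (k : ℕ) where

    m : ℕ
    m = suc (k ℕ.+ k)

    u : ℤ
    u = + 2 ^ k

    N : Nℚ m Is (+ 4 * (u * u))
    N = is (cong ι (trans (ℤₚ.pos-* 2 (2 ^ m)) (trans (cong (_*_ (+ 2)) (q≡2u² k)) (quadruple u))))
      where
      quadruple : ∀ u → + 2 * (+ 2 * (u * u)) ≡ + 4 * (u * u)
      quadruple = solve-∀

    s : sqrtNℚ m Is (+ 2 * u)
    s = is (cong ι (trans (ℤₚ.pos-* 2 (2 ^ ⌊ m /2⌋)) (cong (λ z → + 2 * + 2 ^ z) (half k))))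

    #_ : ∀ a → ιℚ a Is (+ a)
    # a = is refl

    N/2-1 : ((Nℚ m ÷ 2) ℚ.- 1ℚ) Is (+ 2 * (u * u) - 1ℤ)
    N/2-1 = divide 2 (+ 2 * (u * u)) N (ring u) ⟨-⟩ # 1
      where
      ring : ∀ u → + 4 * (u * u) ≡ + 2 * (+ 2 * (u * u))
      ring = solve-∀

    opaque
      unfolding Pz Qz

      Pmat≡ : ∀ i j → Pmat m i j ≡ ι (Pz u i j)
      Pmat≡ zero zero = refl
      Pmat≡ zero (suc zero) = eq (divide 8 ((u * u - u) * (+ 2 * (u * u) - 1ℤ)) ((N ⟨-⟩ # 2 ⟨*⟩ s) ⟨*⟩ (N ⟨-⟩ # 2)) (ring u))
        where
        ring : ∀ u → (+ 4 * (u * u) - + 2 * (+ 2 * u)) * (+ 4 * (u * u) - + 2) ≡ + 8 * ((u * u - u) * (+ 2 * (u * u) - 1ℤ))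
        ring = solve-∀
      Pmat≡ zero (suc (suc zero)) = eq (divide 8 ((u * u + u) * (+ 2 * (u * u) - 1ℤ)) ((N ⟨+⟩ # 2 ⟨*⟩ s) ⟨*⟩ (N ⟨-⟩ # 2)) (ring u))
        where
        ring : ∀ u → (+ 4 * (u * u) + + 2 * (+ 2 * u)) * (+ 4 * (u * u) - + 2) ≡ + 8 * ((u * u + u) * (+ 2 * (u * u) - 1ℤ))
        ring = solve-∀
      Pmat≡ zero (suc (suc (suc zero))) = eq (N/2-1)
      Pmat≡ (suc zero) zero = refl
      Pmat≡ (suc zero) (suc zero) = eq (⟨- divide 8 (u * u * u - u) (s ⟨*⟩ (N ⟨-⟩ # 4)) (ring u) ⟩)
        where
        ring : ∀ u → + 2 * u * (+ 4 * (u * u) - + 4) ≡ + 8 * (u * u * u - u)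
        ring = solve-∀
      Pmat≡ (suc zero) (suc (suc zero)) = eq (divide 8 (u * u * u - u) (s ⟨*⟩ (N ⟨-⟩ # 4)) (ring u))
        where
        ring : ∀ u → + 2 * u * (+ 4 * (u * u) - + 4) ≡ + 8 * (u * u * u - u)
        ring = solve-∀
      Pmat≡ (suc zero) (suc (suc (suc zero))) = refl
      Pmat≡ (suc (suc zero)) zero = refl
      Pmat≡ (suc (suc zero)) (suc zero) = eq (divide 2 u s refl)
      Pmat≡ (suc (suc zero)) (suc (suc zero)) = eq (⟨- divide 2 u s refl ⟩)
      Pmat≡ (suc (suc zero)) (suc (suc (suc zero))) = refl
      Pmat≡ (suc (suc (suc zero))) zero = refl
      Pmat≡ (suc (suc (suc zero))) (suc zero) = eq (⟨- divide 4 (u * u - u) (N ⟨-⟩ # 2 ⟨*⟩ s) (ring u) ⟩)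
        where
        ring : ∀ u → + 4 * (u * u) - + 2 * (+ 2 * u) ≡ + 4 * (u * u - u)
        ring = solve-∀
      Pmat≡ (suc (suc (suc zero))) (suc (suc zero)) = eq (⟨- divide 4 (u * u + u) (N ⟨+⟩ # 2 ⟨*⟩ s) (ring u) ⟩)
        where
        ring : ∀ u → + 4 * (u * u) + + 2 * (+ 2 * u) ≡ + 4 * (u * u + u)
        ring = solve-∀
      Pmat≡ (suc (suc (suc zero))) (suc (suc (suc zero))) = eq (N/2-1)

      Qmat≡ : ∀ i j → Qmat m i j ≡ ι (Qz u i j)
      Qmat≡ zero zero = refl
      Qmat≡ zero (suc zero) = eq (N ⟨-⟩ # 2)
      Qmat≡ zero (suc (suc zero)) = eq (divide 4 ((+ 2 * (u * u) - 1ℤ) * (+ 2 * (u * u) - + 2)) ((N ⟨-⟩ # 2) ⟨*⟩ (N ⟨-⟩ # 4)) (ring u))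
        where
        ring : ∀ u → (+ 4 * (u * u) - + 2) * (+ 4 * (u * u) - + 4) ≡ + 4 * ((+ 2 * (u * u) - 1ℤ) * (+ 2 * (u * u) - + 2))
        ring = solve-∀
      Qmat≡ zero (suc (suc (suc zero))) = eq (N/2-1)
      Qmat≡ (suc zero) zero = refl
      Qmat≡ (suc zero) (suc zero) = eq (⟨- s ⟩ ⟨-⟩ # 2)
      Qmat≡ (suc zero) (suc (suc zero)) = eq (s ⟨+⟩ # 2)
      Qmat≡ (suc zero) (suc (suc (suc zero))) = refl
      Qmat≡ (suc (suc zero)) zero = refl
      Qmat≡ (suc (suc zero)) (suc zero) = eq (s ⟨-⟩ # 2)
      Qmat≡ (suc (suc zero)) (suc (suc zero)) = eq (⟨- s ⟩ ⟨+⟩ # 2)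
      Qmat≡ (suc (suc zero)) (suc (suc (suc zero))) = refl
      Qmat≡ (suc (suc (suc zero))) zero = refl
      Qmat≡ (suc (suc (suc zero))) (suc zero) = refl
      Qmat≡ (suc (suc (suc zero))) (suc (suc zero)) = eq (⟨- divide 2 (+ 2 * (u * u)) N (ring u) ⟩ ⟨+⟩ # 2)
        where
        ring : ∀ u → + 4 * (u * u) ≡ + 2 * (+ 2 * (u * u))
        ring = solve-∀
      Qmat≡ (suc (suc (suc zero))) (suc (suc (suc zero))) = eq (N/2-1)

-- Application to the Kerdock code

HasEigenmatrices-resp : ∀ {n d} {R : Rels n d} {P Q P′ Q′} → (∀ i j → P i j ≡ P′ i j) → (∀ i j → Q i j ≡ Q′ i j) →
  HasEigenmatrices R P′ Q′ → HasEigenmatrices R P Q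
HasEigenmatrices-resp {R = R} P≡ Q≡ (E , idem , res , A≡ , E≡) = E , idem , res ,
  (λ j x y → trans (A≡ j x y) (Σℚ-cong λ i → cong (ℚ._* E i x y) (sym (P≡ i j)))) ,
  (λ j x y → trans (E≡ j x y) (Σℚ-cong λ i → cong (ℚ._* adjacency R i x y) (sym (Q≡ i j))))

module KerdockScheme (k : ℕ) (k≥1 : 1 ≤ k) (S : List (BinMat (suc (k ℕ.+ k))))
  (kerdock : IsKerdockSet (suc (k ℕ.+ k)) S) (z4linear : IsZ4Linear (kerdockCode S))
  (i : Fin (2 ^ suc (k ℕ.+ k))) where

  m : ℕ
  m = suc (k ℕ.+ k)

  open Setting m S i
  open KerdockCode k S kerdock z4linear i using
    ( short; short--; code⁺; Kshort⁺; Kshort-injective; 0∈Kshort; +∈Kshort; -∈Kshort; n≡; difference-type; types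
    ; inC⇒⊥; ⊥⇒inC; reps-injective; reps-cover; classA⇒; ⇒classA )
  open LeeWeights k using (weight; weight-≡ᵇ; leeWeight≡)

  u : ℤ
  u = + 2 ^ k

  classK-type : ∀ {t d} → Type u t d → ∀ j → classK j d ≡ (t == j)
  classK-type {t} {d} ty j = trans (unfold j)
    (trans (cong (_≡ᵇ weight j) (leeWeight≡ n≡ ty)) (weight-≡ᵇ t j))
    where
    unfold : ∀ j → classK j d ≡ (leeWeight d ≡ᵇ weight j)
    unfold zero                   = refl
    unfold (suc zero)             = refl
    unfold (suc (suc zero))       = refl
    unfold (suc (suc (suc zero))) = refl

  type-zero : ∀ {t} {x : Word n} → Type u t x → (t ≡ zero → x ≡ 0w) × (x ≡ 0w → t ≡ zero)
  type-zero {t} {x} ty =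
    (λ t≡0 → leeWeight≡0⇒≡0w x (≡ᵇ-sound (trans (classK-type ty zero) (cong (_== zero) t≡0)))) ,
    (λ x≡0 → ==⇒≡ (trans (sym (classK-type ty zero)) (≡ᵇ-complete (trans (cong leeWeight x≡0) (leeWeight-0w n)))))

  module _ (a : Fin (2 ^ m)) (b : Fin (2 ^ m)) where

    private
      R : BinMat m
      R = List.lookup S (Fin.cast (sym (IsKerdockSet.size kerdock)) a)
      t : ℤ₄
      t = T-form R (toBits m i) ⊕ twoDot (toBits m b) (toBits m i)

    -- For given R and s, the constant - t is the only ε that makes the word vanish at i; this
    -- leaves q² words indexed by the pairs (R, s).
    normalised : Word (2 ^ m)
    normalised = kerdockWord R (toBits m b) (neg₄ t)

    normalised-0 : lookup normalised i ≡ z0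
    normalised-0 = trans (lookup-kerdockWord R (toBits m b) (neg₄ t) i) (⊕-inverseʳ t)

    normalised∈ : short normalised ∈ Kshort
    normalised∈ = Kshort⁺ (code⁺ (Fin.cast (sym (IsKerdockSet.size kerdock)) a) (toBits m b) (neg₄ t)) normalised-0

  normalised-injective : ∀ a b a′ b′ → short (normalised a b) ≡ short (normalised a′ b′) → a ≡ a′ × b ≡ b′
  normalised-injective a b a′ b′ e =
    let t , ty , same = difference-type _ _ _ _ _ _ (trans (Vecₚ.lookup-zipWith _⊕_ i (normalised a b) (-w normalised a′ b′))
          (cong₂ _⊕_ (normalised-0 a b) (trans (Vecₚ.lookup-map i neg₄ (normalised a′ b′)) (cong neg₄ (normalised-0 a′ b′)))))
        a≡ , b≡ = same (proj₂ (type-zero ty) (trans (short-- (normalised a b) (normalised a′ b′))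
          (trans (cong (_-w short (normalised a′ b′)) e) (-w-inverse (short (normalised a′ b′))))))
    in cast-injective a≡ , toBits-injective m b≡
    where
    cast-injective : ∀ {x y} → Fin.cast (sym (IsKerdockSet.size kerdock)) x ≡ Fin.cast (sym (IsKerdockSet.size kerdock)) y → x ≡ y
    cast-injective {x} {y} e = Finₚ.toℕ-injective (trans (sym (Finₚ.toℕ-cast _ x)) (trans (cong toℕ e) (Finₚ.toℕ-cast _ y)))

  -- Only ≥ is proved by counting codewords; nK*total gives the reverse inequality.
  large : size u ℤ.≤ + nK
  large = subst (ℤ._≤ + nK) (sym (size≡q² k)) (ℤ.+≤+ (Finₚ.injective⇒≤ {f = embed} embed-injective))
    where
    coords : Fin (2 ^ m ℕ.* 2 ^ m) → Fin (2 ^ m) × Fin (2 ^ m)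
    coords = Fin.remQuot (2 ^ m)
    embed : Fin (2 ^ m ℕ.* 2 ^ m) → Fin nK
    embed p = Any.index (normalised∈ (proj₁ (coords p)) (proj₂ (coords p)))
    embed-injective : ∀ {p p′} → embed p ≡ embed p′ → p ≡ p′
    embed-injective {p} {p′} e = trans (sym (Finₚ.combine-remQuot {2 ^ m} (2 ^ m) p))
      (trans (cong₂ Fin.combine (proj₁ same) (proj₂ same)) (Finₚ.combine-remQuot {2 ^ m} (2 ^ m) p′))
      where
      same : proj₁ (coords p) ≡ proj₁ (coords p′) × proj₂ (coords p) ≡ proj₂ (coords p′)
      same = normalised-injective _ _ _ _ (trans (Anyₚ.lookup-index (normalised∈ (proj₁ (coords p)) (proj₂ (coords p))))
        (trans (cong elK e) (sym (Anyₚ.lookup-index (normalised∈ (proj₁ (coords p′)) (proj₂ (coords p′)))))))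

  u≥2 : ∃ λ v → + suc (suc v) ≡ u
  u≥2 = 2 ^ k ∸ 2 , cong +_ (ℕₚ.m+[n∸m]≡n (ℕₚ.^-monoʳ-≤ 2 k≥1))

  open Duality n u (size>0 k)
    (λ j → subst (λ u → Pz u zero j ≢ 0ℤ) (proj₂ u≥2) (Row₀.Pz-row₀≢0 (proj₁ u≥2) j))
    (λ j → subst (λ u → Qz u zero j ≢ 0ℤ) (proj₂ u≥2) (Row₀.Qz-row₀≢0 (proj₁ u≥2) j))
    Kshort Kshort-injective 0∈Kshort +∈Kshort -∈Kshort types type-zero large
    inC inC⇒⊥ ⊥⇒inC cosetReps reps-injective reps-cover classK classA classK-type classA⇒ ⇒classA
    using (module SK; module SA; tp; tp-type; cA; cA-class; character-re; character-im; nA≡size; nA-nonZero)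

  open Integrality using (Pmat≡; Qmat≡)

  schemeK : IsAssocScheme relK
  schemeK = SK.scheme

  eigenK : HasEigenmatrices relK (Pmat m) (Qmat m)
  eigenK = HasEigenmatrices-resp {R = relK} (Pmat≡ k) (Qmat≡ k) SK.eigenmatrices

  schemeA : IsAssocScheme relA
  schemeA = SA.scheme

  eigenA : HasEigenmatrices relA (Qmat m) (Pmat m)
  eigenA = HasEigenmatrices-resp {R = relA} (Qmat≡ k) (Pmat≡ k) SA.eigenmatrices

  charSumRe≡ : ∀ y j → charSumRe y j ≡ Pz u (cA y) j
  charSumRe≡ y j = trans (sym (∑F≡Σℤ (λ x → if classK j (elK x) then reI (dot (elK x) y) else 0ℤ)))
    (trans (∑-cong (allFin nK) λ x → trans (cong (λ b → if b then reI (dot (elK x) y) else 0ℤ) (classK-type (tp-type x) j))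
      (term (tp x == j) (dot (elK x) y))) (character-re j y))
    where
    term : ∀ b a → (if b then reI a else 0ℤ) ≡ ⟦ b ⟧ * re a
    term false a  = refl
    term true  z0 = refl
    term true  z1 = refl
    term true  z2 = refl
    term true  z3 = refl

  charSumIm≡ : ∀ y j → charSumIm y j ≡ 0ℤ
  charSumIm≡ y j = trans (sym (∑F≡Σℤ (λ x → if classK j (elK x) then imI (dot (elK x) y) else 0ℤ)))
    (trans (∑-cong (allFin nK) λ x → trans (cong (λ b → if b then imI (dot (elK x) y) else 0ℤ) (classK-type (tp-type x) j))
      (term (tp x == j) (dot (elK x) y))) (character-im j y))
    where
    term : ∀ b a → (if b then imI a else 0ℤ) ≡ ⟦ b ⟧ * im a
    term false a  = refl
    term true  z0 = refl
    term true  z1 = refl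
    term true  z2 = refl
    term true  z3 = refl

  -- The character sums of y form row `cA y` of P, which gives one direction; conversely the rows of
  -- P are distinct, so the sums determine the class.
  dual : IsDual
  dual a r =
    (λ e j → trans (cong ι (trans (charSumRe≡ (elA a) j) (cong (λ c → Pz u c j) (class e)))) (sym (Pmat≡ k r j)) ,
             charSumIm≡ (elA a) j) ,
    (λ sums → trans (cA-class r (elA a)) (trans (cong (_== r) (rows-distinct nA (Qz u) (Pz u)
      (λ c j → trans (PzQz u c j) (cong (_* ⟦ c == j ⟧) (sym nA≡size))) (cA (elA a)) r
      (λ j → trans (sym (charSumRe≡ (elA a) j)) (ι-injective (trans (proj₁ (sums j)) (Pmat≡ k r j)))))) (==-refl r)))
    where
    class : classA r (elA a) ≡ true → cA (elA a) ≡ r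
    class e = ==⇒≡ (trans (sym (cA-class r (elA a))) e)

theorem1 : (m : ℕ) → 3 ≤ m → Odd m →
    (S : List (BinMat m)) → IsKerdockSet m S → IsZ4Linear (kerdockCode S) →
    (i : Fin (2 ^ m)) →
    (IsAssocScheme (Setting.relK m S i)
    × HasEigenmatrices (Setting.relK m S i) (Pmat m) (Qmat m))
    × (IsAssocScheme (Setting.relA m S i)
    × HasEigenmatrices (Setting.relA m S i) (Qmat m) (Pmat m)
    × Setting.IsDual m S i)
theorem1 _ (s≤s ())  (zero , refl)  S kerdock z4linear i
theorem1 _ _ (k@(suc _) , refl) S kerdock z4linear i = (schemeK , eigenK) , (schemeA , eigenA , dual)
  where open KerdockScheme k (s≤s z≤n) S kerdock z4linear i
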